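{- (a) There is a constant $s$ such that the Restricted 4-Set Packing algorithm with parameter $s$ has approximation ratio $\frac{7}{16}$. (b) For every $k\ge 5$ and every $\epsilon>0$ there is a parameter $s$ (e.g. any $s\ge \frac{2}{k\epsilon}$) such that the Restricted $k$-Set Packing algorithm with parameter $s$ has approximation ratio $\frac{2}{k}-\epsilon$.
   Context: Let $U$ be a finite set and $\mathscr{S}$ a collection of subsets of $U$, each of size at most $k$, closed under taking subsets; a $k$-set is a member of $\mathscr{S}$ of size $k$. For a collection $\mathscr{P}$ of pairwise disjoint $k$-sets, let $\mu(\mathscr{P})$ denote the number of 1-sets needed to finish covering $U\setminus\bigcup\mathscr{P}$, i.e. the number of 1-element sets in the cover of $U\setminus\bigcup\mathscr{P}$ produced by the semi-local $(2,1)$-improvement, which equals the minimum number of 1-element sets in a partition of $U\setminus\bigcup\mathscr{P}$ into members of $\mathscr{S}$ of size at most 3. (Semi-local $(2,1)$-improvement: greedily pick a maximal collection of disjoint 3-sets, then repeatedly replace one chosen 3-set by two disjoint 3-sets whenever, after covering the remaining elements by a maximum matching of 2-sets plus 1-sets, the total number of sets decreases, or stays equal while the number of 1-sets decreases.) Restricted $k$-Set Packing algorithm with parameter $s$: start with the empty packing $\mathscr{A}$ and let $\mu_0=\mu(\emptyset)$. Repeatedly, if some $p\le s$ sets of $\mathscr{A}$ can be replaced by $p+1$ $k$-sets so that the result $\mathscr{A}'$ is still a collection of pairwise disjoint $k$-sets and the number of 1-sets needed does not increase, perform the replacement; stop when no such replacement exists, and output $\mathscr{A}$. An optimal solution of the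 Restricted $k$-Set Packing problem is a maximum-cardinality collection $\mathscr{O}$ of pairwise disjoint $k$-sets that likewise does not increase the number of 1-sets needed, i.e. $\mu(\mathscr{O})\le \mu_0$. The algorithm has approximation ratio $\rho$ if on every instance its output satisfies $|\mathscr{A}|\ge \rho\,|\mathscr{O}|$. -}

module Defs where

open import Data.Nat using (ℕ; suc; _≤_; _≟_)
open import Data.Fin using (Fin)
open import Data.Fin.Subset using (Subset; _∈_; _⊆_; _∩_; ∁; ⋃; ∣_∣; Empty)
open import Data.List using (List; []; _++_; length; filter)
open import Data.List.Relation.Unary.All using (All)
open import Data.List.Relation.Unary.AllPairs using (AllPairs)
open import Data.List.Relation.Binary.Permutation.Propositional using (_↭_)
open import Data.Product using (∃; _×_)
open import Data.Integer using (+_)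
import Data.Rational as ℚ
open import Data.Rational using (ℚ)
open import Relation.Nullary using (¬_)
open import Relation.Unary using (Decidable)
open import Relation.Binary.PropositionalEquality using (_≡_)
open import Relation.Binary.Construct.Closure.ReflexiveTransitive using (Star)

-- The ground set U is Fin n.  As always for set cover, the collection covers U;
-- by downward closure every singleton is then a member, so that every subset
-- of U has a partition into members of size at most 3.
record Instance (k : ℕ) : Set₁ where
  field
    n       : ℕ
    𝒮       : Subset n → Set
    𝒮?      : Decidable 𝒮
    bounded : ∀ {X} → 𝒮 X → ∣ X ∣ ≤ k
    closed  : ∀ {X Y} → Y ⊆ X → 𝒮 X → 𝒮 Y
    covers  : ∀ (x : Fin n) → ∃ λ X → x ∈ X × 𝒮 X

Disjoint : ∀ {n} → Subset n → Subset n → Set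
Disjoint X Y = Empty (X ∩ Y)

module _ {k : ℕ} (I : Instance k) where
  open Instance I

  -- Collections of pairwise disjoint nonempty sets are lists; such a list has
  -- no repetitions, so its length is the cardinality of the collection.

  record IsPartition (V : Subset n) (Q : List (Subset n)) : Set where
    field
      members   : All 𝒮 Q
      nonempty  : All (λ X → 1 ≤ ∣ X ∣) Q
      atMost3   : All (λ X → ∣ X ∣ ≤ 3) Q
      disjoint  : AllPairs Disjoint Q
      union     : ⋃ Q ≡ V

  ones : List (Subset n) → ℕ
  ones Q = length (filter (λ X → ∣ X ∣ ≟ 1) Q)

  -- The graph of μ: IsMu P m says μ(P) = m, where μ(P) is the least number of
  -- 1-sets in a partition of U ∖ ⋃ P into members of size at most 3.
  record IsMu (P : List (Subset n)) (m : ℕ) : Set where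
    field
      attained : ∃ λ Q → IsPartition (∁ (⋃ P)) Q × ones Q ≡ m
      minimal  : ∀ Q → IsPartition (∁ (⋃ P)) Q → m ≤ ones Q

  record IsPacking (P : List (Subset n)) : Set where
    field
      members  : All 𝒮 P
      size-k   : All (λ X → ∣ X ∣ ≡ k) P
      disjoint : AllPairs Disjoint P

  -- μ(P) ≤ μ₀ = μ(∅).  Splitting k-sets (k ≥ 4) into pairs and triples shows
  -- μ(∅) ≤ μ(P) for every packing P, so along a run of the algorithm it makes
  -- no difference whether μ(A′) is compared with μ₀ or with μ(A).
  NoIncrease : List (Subset n) → Set
  NoIncrease P = ∃ λ m → ∃ λ m₀ → IsMu P m × IsMu [] m₀ × m ≤ m₀

  -- One replacement of p ≤ s sets of A by p + 1 k-sets, where p = length removed.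
  record Step (s : ℕ) (A A′ : List (Subset n)) : Set where
    field
      removed added kept : List (Subset n)
      before     : A ↭ removed ++ kept
      after      : A′ ↭ added ++ kept
      p≤s        : length removed ≤ s
      one-more   : length added ≡ suc (length removed)
      packing    : IsPacking A′
      noIncrease : NoIncrease A′

  -- The algorithm is nondeterministic: A is a possible output if it is
  -- reachable from the empty packing and admits no further replacement.
  record IsOutput (s : ℕ) (A : List (Subset n)) : Set where
    field
      reachable : Star (Step s) [] A
      stuck     : ¬ ∃ (Step s A)

  record IsOptimal (O : List (Subset n)) : Set where
    field
      packing    : IsPacking O
      noIncrease : NoIncrease O
      maximum    : ∀ P → IsPacking P → NoIncrease P → length P ≤ length O

fromℕ : ℕ → ℚ
fromℕ m = + m ℚ./ 1

HasApproximationRatio : (k s : ℕ) → ℚ → Set₁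
HasApproximationRatio k s ρ =
  (I : Instance k) → ∀ A O → IsOutput I s A → IsOptimal I O →
  ρ ℚ.* fromℕ (length O) ℚ.≤ fromℕ (length A)

{-# OPTIONS --safe #-}
module Submission where

-- Complete the output A and the optimum O to partitions of U with μ₀ 1-sets each, and glue a new
-- element to every 1-set, so that all blocks have size at least 2.  Moving a set F of elements
-- from their A-blocks to their O-blocks creates no 1-set if no A-block keeps exactly one element
-- and no O-block receives exactly one; such F are called valid.  Local optimality says that a
-- valid F meeting at most s members of A contains at most as many members of O as it meets
-- members of A.
--
-- Let F be maximal among the valid sets avoiding some blocked members of A.  Pruning shows that
-- the numbers of elements which the O-blocks have outside F (lowered by 2 for O-blocks disjoint
-- from F) add up to at most the number of blocked elements.  With all of A blocked this yields
-- 2|O| ≤ k|A| + D, where D counts the members of O with one element outside F.  Each of these is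
-- joined by an alternating walk to a member of A, and distinct ones to distinct members.  Unblocking
-- the members of A so reached gives for k = 4 also |O| ≤ 4|A| - 3D, and hence 7|O| ≤ 16|A|; for
-- k ≥ 5 the step is iterated as long as the improvements involved have at most s members of A,
-- in the manner of Hurkens and Schrijver.

open import Defs
import Algebra.Properties.CommutativeMonoid.Sum as CommutativeMonoidSum
import Algebra.Properties.Semiring.Sum as SemiringSum
open import Data.Bool using (Bool; true; false; T; not; _∧_; _∨_)
open import Data.Bool.Properties using (T?)
open import Data.Empty using (⊥; ⊥-elim)
open import Data.Fin as F using (Fin; zero; suc; toℕ)
open import Data.Fin.Properties as F using (any?; all?)
open import Data.Fin.Subset as S using (Subset; _∈_; _∉_; _⊆_; _∪_; ∁; ⋃; ∣_∣)
open import Data.Fin.Subset.Properties as S using (anySubset?)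
open import Data.List as L using (List; []; _∷_; _++_; length; filter; take)
open import Data.List.Properties as L using (filter-++; filter-all; filter-none; length-++; length-take)
open import Data.List.Membership.Propositional using (find) renaming (_∈_ to _∈ₗ_)
open import Data.List.Membership.Propositional.Properties as L using (∈-lookup; ∈-++⁺ˡ; ∈-++⁺ʳ; ∈-++⁻; ∈-filter⁻; ∈-tabulate⁺; ∈-tabulate⁻)
open import Data.List.Relation.Unary.All as All using (All; []; _∷_)
import Data.List.Relation.Unary.All.Properties as All
open import Data.List.Relation.Unary.AllPairs as AllPairs using (AllPairs; []; _∷_)
import Data.List.Relation.Unary.AllPairs.Properties as AllPairs
open import Data.List.Relation.Unary.Any as Any using (Any; here; there)
open import Data.List.Relation.Unary.Any.Properties as Any using (lookup-index)
open import Data.List.Relation.Binary.Permutation.Propositional using (_↭_; ↭-refl; ↭-prep; ↭-trans; ↭-sym)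
open import Data.List.Relation.Binary.Permutation.Propositional.Properties using (shift)
open import Data.Vec as V using (lookup; tabulate)
open import Data.Vec.Properties as V using (lookup∘tabulate; []=⇒lookup; lookup⇒[]=)
open import Data.Nat using (ℕ; zero; suc; _+_; _*_; _∸_; NonZero; _≤_; _<_; z≤n; s≤s; _≟_; _≤?_)
open import Data.Nat.Properties
open import Data.Integer as ℤ using (+_)
import Data.Integer.Properties as ℤ
open import Data.Rational as ℚ using (ℚ; _/_; _÷_; _-_; Positive)
open import Data.Rational.Properties as ℚ using (pos⇒nonZero)
import Data.Rational.Unnormalised as ℚᵘ
import Data.Rational.Unnormalised.Properties as ℚᵘ
open import Data.Product using (∃; _×_; _,_; proj₁; proj₂)
open import Data.Sum using (_⊎_; inj₁; inj₂; [_,_]′)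
open import Data.Unit using (tt)
open import Relation.Binary.Construct.Closure.ReflexiveTransitive as Star using (Star; _◅_)
open import Relation.Nullary using (¬_; Dec; yes; no; does; ¬?; _×-dec_; _→-dec_)
open import Relation.Nullary.Decidable using (map′)
open import Relation.Binary.PropositionalEquality using (_≡_; _≢_; refl; sym; trans; cong; cong₂; subst; subst₂)
open import Data.Nat.Tactic.RingSolver using (solve-∀)

open CommutativeMonoidSum +-0-commutativeMonoid using (sum; sum-cong-≗; ∑-distrib-+; ∑-comm; sum-replicate-zero)
open SemiringSum +-*-semiring using (*-distribˡ-sum)

-- Counting

-- The completions of A and O have the same number of 1-sets, so one set of μ₀ new elements serves
-- both sides. A block with at least two elements after an exchange can become a 1-set only if it
-- contains a new element, and each new element lies on one side of the exchange; hence a valid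
-- exchange needs at most μ₀ 1-sets. The obstacle is that validity is not closed under unions,
-- whereas improvements have to be glued together. The sets in use are therefore built so that only
-- members of A can violate validity, and there elements are counted. This count separates the two
-- cases: two glued sets may take three elements of a member of A, the one at which an earlier
-- improvement ended and one more for each set. At least two remain if k ≥ 5, but only one if k = 4;
-- there the unblocking is done once, and a potential bounded by the size 4 of a member of O
-- replaces the gluing. The bound for k ≥ 5 amounts to 2|O|(1 - 1/s) ≤ k|A|, which explains the
-- condition s ≥ 2/(kε).

Sub : ℕ → Set
Sub n = Fin n → Bool

⟦_⟧ : Bool → ℕ
⟦ true ⟧  = 1
⟦ false ⟧ = 0

infix 5 _==_ _≈ᵇ_

_≈ᵇ_ : ℕ → ℕ → Bool
x ≈ᵇ y = does (x ≟ y)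

T-does : ∀ {a} {P : Set a} (P? : Dec P) → P → T (does P?)
T-does (yes _) _ = tt
T-does (no ¬p) p = ¬p p

does-T : ∀ {a} {P : Set a} (P? : Dec P) → T (does P?) → P
does-T (yes p) _ = p

opaque

  _==_ : ∀ {n} → Fin n → Fin n → Bool
  x == y = does (x F.≟ y)

  ==⇒≡ : ∀ {n} {x y : Fin n} → T (x == y) → x ≡ y
  ==⇒≡ {x = x} {y} = does-T (x F.≟ y)

  ≡⇒== : ∀ {n} {x y : Fin n} → x ≡ y → T (x == y)
  ≡⇒== {x = x} {y} = T-does (x F.≟ y)

∧-intro : ∀ {x y} → T x → T y → T (x ∧ y)
∧-intro {true} {true} _ _ = tt

∧-left : ∀ {x y} → T (x ∧ y) → T x
∧-left {true} _ = tt

∧-right : ∀ {x y} → T (x ∧ y) → T y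
∧-right {true} {true} _ = tt

∨-left : ∀ {x y} → T x → T (x ∨ y)
∨-left {true} _ = tt

∨-right : ∀ {x y} → T y → T (x ∨ y)
∨-right {true} _ = tt
∨-right {false} {true} _ = tt

∨-elim : ∀ {x y} → T (x ∨ y) → T x ⊎ T y
∨-elim {true}  _ = inj₁ tt
∨-elim {false} t = inj₂ t

not-intro : ∀ {x} → ¬ T x → T (not x)
not-intro {true}  f = f tt
not-intro {false} f = tt

not-elim : ∀ {x} → T (not x) → ¬ T x
not-elim {false} _ ()

⟦⟧-T : ∀ {x} → T x → ⟦ x ⟧ ≡ 1
⟦⟧-T {true} _ = refl

⟦⟧-¬T : ∀ {x} → ¬ T x → ⟦ x ⟧ ≡ 0
⟦⟧-¬T {true}  f = ⊥-elim (f tt)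
⟦⟧-¬T {false} f = refl

⟦⟧-mono : ∀ {x y} → (T x → T y) → ⟦ x ⟧ ≤ ⟦ y ⟧
⟦⟧-mono {false}        f = z≤n
⟦⟧-mono {true} {true}  f = ≤-refl
⟦⟧-mono {true} {false} f = ⊥-elim (f tt)

⟦⟧≤1 : ∀ x → ⟦ x ⟧ ≤ 1
⟦⟧≤1 true  = ≤-refl
⟦⟧≤1 false = z≤n

∑-mono : ∀ {n} {f g : Fin n → ℕ} → (∀ i → f i ≤ g i) → sum f ≤ sum g
∑-mono {zero}  f≤g = z≤n
∑-mono {suc n} f≤g = +-mono-≤ (f≤g zero) (∑-mono (λ i → f≤g (suc i)))

opaque

  # : ∀ {n} → Sub n → ℕ
  # p = sum (λ e → ⟦ p e ⟧)

  #-mono : ∀ {n} {p q : Sub n} → (∀ e → T (p e) → T (q e)) → # p ≤ # q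
  #-mono p⊆q = ∑-mono (λ e → ⟦⟧-mono (p⊆q e))

#-cong : ∀ {n} {p q : Sub n} → (∀ e → T (p e) → T (q e)) → (∀ e → T (q e) → T (p e)) → # p ≡ # q
#-cong p⊆q q⊆p = ≤-antisym (#-mono p⊆q) (#-mono q⊆p)

opaque
  unfolding #

  #-empty : ∀ {n} {p : Sub n} → (∀ e → ¬ T (p e)) → # p ≡ 0
  #-empty {zero}  ∅ = refl
  #-empty {suc n} ∅ = cong₂ _+_ (⟦⟧-¬T (∅ zero)) (#-empty (λ e → ∅ (suc e)))

  #-strict : ∀ {n} {p q : Sub n} → (∀ e → T (p e) → T (q e)) →
             ∀ x → T (q x) → ¬ T (p x) → # p < # q
  #-strict p⊆q zero qx ¬px
    rewrite ⟦⟧-T qx | ⟦⟧-¬T ¬px = s≤s (#-mono (λ e → p⊆q (suc e)))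
  #-strict p⊆q (suc x) qx ¬px =
    +-mono-≤-< (⟦⟧-mono (p⊆q zero)) (#-strict (λ e → p⊆q (suc e)) x qx ¬px)

#-pos : ∀ {n} {p : Sub n} x → T (p x) → 1 ≤ # p
#-pos {n} {p} x px = ≤-trans (s≤s z≤n) (#-strict {p = λ _ → false} (λ _ ()) x px λ ())

#-find : ∀ {n} (p q : Sub n) → # p < # q → ∃ λ x → T (q x) × ¬ T (p x)
#-find p q p<q with any? (λ x → T? (q x ∧ not (p x)))
... | yes (x , t) = x , ∧-left {q x} t , not-elim (∧-right {q x} t)
... | no ∄x = ⊥-elim (<⇒≱ p<q (#-mono q⊆p))
  where
  q⊆p : ∀ e → T (q e) → T (p e)
  q⊆p e qe with T? (p e)
  ... | yes pe = pe
  ... | no ¬pe = ⊥-elim (∄x (e , ∧-intro qe (not-intro ¬pe)))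

#-∃ : ∀ {n} (p : Sub n) → 1 ≤ # p → ∃ λ x → T (p x)
#-∃ p 1≤p with #-find (λ _ → false) p (≤-trans (s≤s (≤-reflexive (#-empty {p = λ _ → false} (λ _ ())))) 1≤p)
... | x , px , _ = x , px

#-none : ∀ {n} (p : Sub n) → # p ≡ 0 → ∀ x → ¬ T (p x)
#-none p p≡0 x px = <⇒≢ (#-pos {p = p} x px) (sym p≡0)

opaque
  unfolding #

  #-∨ : ∀ {n} (p q : Sub n) → # (λ e → p e ∨ q e) ≤ # p + # q
  #-∨ p q = ≤-trans (∑-mono pointwise) (≤-reflexive (∑-distrib-+ (λ e → ⟦ p e ⟧) (λ e → ⟦ q e ⟧)))
    where
    pointwise : ∀ e → ⟦ p e ∨ q e ⟧ ≤ ⟦ p e ⟧ + ⟦ q e ⟧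
    pointwise e with p e
    ... | true  = s≤s z≤n
    ... | false = ≤-refl

  #-split : ∀ {n} (p f : Sub n) → # p ≡ # (λ e → p e ∧ f e) + # (λ e → p e ∧ not (f e))
  #-split p f = trans (sum-cong-≗ pointwise)
                      (∑-distrib-+ (λ e → ⟦ p e ∧ f e ⟧) (λ e → ⟦ p e ∧ not (f e) ⟧))
    where
    pointwise : ∀ e → ⟦ p e ⟧ ≡ ⟦ p e ∧ f e ⟧ + ⟦ p e ∧ not (f e) ⟧
    pointwise e with p e | f e
    ... | true  | true  = refl
    ... | true  | false = refl
    ... | false | _     = refl

  #-≤1 : ∀ {n} (p : Sub n) → (∀ x y → T (p x) → T (p y) → x ≡ y) → # p ≤ 1
  #-≤1 {zero}  p unique = z≤n
  #-≤1 {suc n} p unique with T? (p zero)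
  ... | yes p₀ = ≤-reflexive (cong₂ _+_ (⟦⟧-T p₀) (#-empty (λ e pe → 0≢1+n (cong toℕ (unique zero (suc e) p₀ pe)))))
  ... | no ¬p₀ rewrite ⟦⟧-¬T ¬p₀ = #-≤1 (λ e → p (suc e)) (λ x y px py → F.suc-injective (unique (suc x) (suc y) px py))

#-single : ∀ {n} (x : Fin n) → # (λ e → e == x) ≡ 1
#-single x = ≤-antisym (#-≤1 _ (λ y z y≡x z≡x → trans (==⇒≡ y≡x) (sym (==⇒≡ z≡x))))
                       (#-pos {p = λ e → e == x} x (≡⇒== refl))

#-unique : ∀ {n} (p : Sub n) → # p ≤ 1 → ∀ x y → T (p x) → T (p y) → x ≡ y
#-unique p p≤1 x y px py with x F.≟ y
... | yes x≡y = x≡y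
... | no  x≢y = ⊥-elim (<⇒≱ (<-≤-trans (s≤s (≤-reflexive (sym (#-single x))))
                      (#-strict {p = _== x} (λ e t → subst (λ z → T (p z)) (sym (==⇒≡ t)) px) y py
                         (λ t → x≢y (sym (==⇒≡ t))))) p≤1)

#-insert : ∀ {n} (p : Sub n) x → # (λ e → p e ∨ (e == x)) ≤ suc (# p)
#-insert p x = ≤-trans (#-∨ p (_== x)) (≤-reflexive (trans (cong (λ z → # p + z) (#-single x)) (+-comm (# p) 1)))

#-≤2 : ∀ {n} (p : Sub n) → # p ≤ 2 → ∀ x → T (p x) → ∃ λ y → T (p y) × (∀ z → T (p z) → z ≡ x ⊎ z ≡ y)
#-≤2 p p≤2 x px with any? (λ y → T? (p y ∧ not (y == x)))
... | no ∄y = x , px , λ z pz → inj₁ (only z pz)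
  where
  only : ∀ z → T (p z) → z ≡ x
  only z pz with z F.≟ x
  ... | yes z≡x = z≡x
  ... | no  z≢x = ⊥-elim (∄y (z , ∧-intro pz (not-intro (λ t → z≢x (==⇒≡ t)))))
... | yes (y , t) = y , ∧-left t , either
  where
  q : Sub _
  q z = p z ∧ not (z == x)
  q<p : # q < # p
  q<p = #-strict (λ e qe → ∧-left {p e} qe) x px (λ qx → not-elim (∧-right {p x} qx) (≡⇒== refl))
  either : ∀ z → T (p z) → z ≡ x ⊎ z ≡ y
  either z pz with z F.≟ x
  ... | yes z≡x = inj₁ z≡x
  ... | no  z≢x = inj₂ (#-unique q (≤-pred (≤-trans q<p p≤2)) z y (∧-intro pz (not-intro (λ t → z≢x (==⇒≡ t)))) t)

hit miss : ∀ {m n} → Sub n → (Fin n → Fin m) → Fin m → ℕ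
hit  F g i = # (λ e → F e ∧ (g e == i))
miss F g i = # (λ e → not (F e) ∧ (g e == i))

size : ∀ {m n} → (Fin n → Fin m) → Fin m → ℕ
size g i = # (λ e → g e == i)

opaque
  unfolding #

  ∑-hit : ∀ {m n} (F : Sub n) (g : Fin n → Fin m) → sum (hit F g) ≡ # F
  ∑-hit {m} F g = trans (∑-comm (λ i e → ⟦ F e ∧ (g e == i) ⟧)) (sum-cong-≗ fibre)
    where
    fibre : ∀ e → sum (λ i → ⟦ F e ∧ (g e == i) ⟧) ≡ ⟦ F e ⟧
    fibre e with F e
    ... | false = sum-replicate-zero m
    ... | true  = trans (#-cong (λ i t → ≡⇒== (sym (==⇒≡ {x = g e} t))) (λ i t → ≡⇒== (sym (==⇒≡ {x = i} t)))) (#-single (g e))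

size-hit-miss : ∀ {m n} (F : Sub n) (g : Fin n → Fin m) i → size g i ≡ hit F g i + miss F g i
size-hit-miss F g i = trans (#-split (λ e → g e == i) F)
  (cong₂ _+_ (#-cong (λ e t → ∧-intro (∧-right {g e == i} t) (∧-left t)) (λ e t → ∧-intro (∧-right {F e} t) (∧-left t)))
             (#-cong (λ e t → ∧-intro (∧-right {g e == i} t) (∧-left t)) (λ e t → ∧-intro (∧-right {not (F e)} t) (∧-left t))))

infixl 5 _⊔_ _⊕_

_⊔_ : ∀ {n} → Sub n → Sub n → Sub n
(F ⊔ G) e = F e ∨ G e

_⊕_ : ∀ {n} → Sub n → Fin n → Sub n
F ⊕ x = F ⊔ (_== x)

infix 4 _⊑_

_⊑_ : ∀ {n} → Sub n → Sub n → Set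
F ⊑ G = ∀ e → T (F e) → T (G e)

⊕-self : ∀ {n} {F : Sub n} {x} → T ((F ⊕ x) x)
⊕-self {F = F} {x} = ∨-right {F x} (≡⇒== refl)

⊕-elim : ∀ {n} {F : Sub n} {x} {P : Fin n → Set} → (∀ e → T (F e) → P e) → P x → ∀ e → T ((F ⊕ x) e) → P e
⊕-elim {F = F} {x} {P} old new e t with ∨-elim {F e} t
... | inj₁ Fe = old e Fe
... | inj₂ t′ = subst P (sym (==⇒≡ t′)) new

module _ {m n : ℕ} {g : Fin n → Fin m} where

  hit-mono : ∀ {F G i} → (∀ e → g e ≡ i → T (F e) → T (G e)) → hit F g i ≤ hit G g i
  hit-mono {F} sub = #-mono (λ e t → ∧-intro (sub e (==⇒≡ (∧-right {F e} t)) (∧-left t)) (∧-right {F e} t))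

  miss-anti : ∀ {F G i} → (∀ e → g e ≡ i → T (F e) → T (G e)) → miss G g i ≤ miss F g i
  miss-anti {F} {G} sub = #-mono (λ e t → ∧-intro
    (not-intro (λ Fe → not-elim {G e} (∧-left t) (sub e (==⇒≡ (∧-right {not (G e)} t)) Fe))) (∧-right {not (G e)} t))

  hit-strict : ∀ {F G} → F ⊑ G → ∀ x → T (G x) → ¬ T (F x) → hit F g (g x) < hit G g (g x)
  hit-strict {F} F⊑G x Gx ¬Fx = #-strict (λ e t → ∧-intro (F⊑G e (∧-left t)) (∧-right {F e} t)) x
    (∧-intro Gx (≡⇒== refl)) (λ t → ¬Fx (∧-left t))

  miss-strict : ∀ {F G} → F ⊑ G → ∀ x → T (G x) → ¬ T (F x) → miss G g (g x) < miss F g (g x)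
  miss-strict {F} {G} F⊑G x Gx ¬Fx = #-strict
    (λ e t → ∧-intro (not-intro (λ Fe → not-elim {G e} (∧-left t) (F⊑G e Fe))) (∧-right {not (G e)} t)) x
    (∧-intro (not-intro ¬Fx) (≡⇒== refl)) (λ t → not-elim {G x} (∧-left t) Gx)

  hit-pos : ∀ {F} e → T (F e) → 1 ≤ hit F g (g e)
  hit-pos e Fe = #-pos e (∧-intro Fe (≡⇒== refl))

  miss-pos : ∀ {F} e → ¬ T (F e) → 1 ≤ miss F g (g e)
  miss-pos e ¬Fe = #-pos e (∧-intro (not-intro ¬Fe) (≡⇒== refl))

  ⊕-other : ∀ F {x i} → i ≢ g x → ∀ e → g e ≡ i → T ((F ⊕ x) e) → T (F e)
  ⊕-other F {x} i≢gx e ge≡i t with ∨-elim {F e} t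
  ... | inj₁ Fe  = Fe
  ... | inj₂ e≡x = ⊥-elim (i≢gx (trans (sym ge≡i) (cong g (==⇒≡ e≡x))))

  hit-⊕-other : ∀ F {x i} → i ≢ g x → hit (F ⊕ x) g i ≡ hit F g i
  hit-⊕-other F i≢gx = ≤-antisym (hit-mono (⊕-other F i≢gx)) (hit-mono (λ e _ → ∨-left))

  hit-cong : ∀ {F G i} → (∀ e → g e ≡ i → T (F e) → T (G e)) → (∀ e → g e ≡ i → T (G e) → T (F e)) → hit F g i ≡ hit G g i
  hit-cong p q = ≤-antisym (hit-mono p) (hit-mono q)

  miss-cong : ∀ {F G i} → (∀ e → g e ≡ i → T (F e) → T (G e)) → (∀ e → g e ≡ i → T (G e) → T (F e)) → miss F g i ≡ miss G g i
  miss-cong p q = ≤-antisym (miss-anti q) (miss-anti p)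

  miss-full : ∀ {F i} → (∀ e → g e ≡ i → T (F e)) → miss F g i ≡ 0
  miss-full {F} all = #-empty (λ e t → not-elim {F e} (∧-left t) (all e (==⇒≡ (∧-right {not (F e)} t))))

  miss-zero : ∀ {F i} → miss F g i ≡ 0 → ∀ e → g e ≡ i → T (F e)
  miss-zero {F} {i} m≡0 e ge≡i with T? (F e)
  ... | yes Fe = Fe
  ... | no ¬Fe = ⊥-elim (#-none _ m≡0 e (∧-intro (not-intro ¬Fe) (≡⇒== ge≡i)))

  miss-void : ∀ {F i} → (∀ e → g e ≡ i → ¬ T (F e)) → miss F g i ≡ size g i
  miss-void {F} {i} none = #-cong (λ e → ∧-right {not (F e)}) (λ e t → ∧-intro (not-intro (none e (==⇒≡ t))) t)

  hit-full : ∀ {F i} → (∀ e → g e ≡ i → T (F e)) → hit F g i ≡ size g i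
  hit-full {F} {i} all = #-cong (λ e → ∧-right {F e}) (λ e t → ∧-intro (all e (==⇒≡ t)) t)

opaque
  unfolding #

  #≤n : ∀ {n} (p : Sub n) → # p ≤ n
  #≤n {zero}  p = z≤n
  #≤n {suc n} p = +-mono-≤ (⟦⟧≤1 (p zero)) (#≤n (λ e → p (suc e)))

  sum-⟦⟧ : ∀ {n} (p : Sub n) → sum (λ e → ⟦ p e ⟧) ≡ # p
  sum-⟦⟧ p = refl

⊏-# : ∀ {n} {F G : Sub n} → F ⊑ G → ∀ x → T (G x) → ¬ T (F x) → # F < # G
⊏-# = #-strict

-- The recursions below enlarge a subset of `Fin n`. Keeping `n < d + # F` lets the fuel `d` drop
-- with each enlargement, and `d = 0` would mean a subset with more than n elements.
burn : ∀ {n d} {F G : Sub n} → n < suc d + # F → # F < # G → n < d + # G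
burn {d = d} {F} fuel F<G = ≤-trans fuel (≤-trans (≤-reflexive (sym (+-suc d (# F)))) (+-monoʳ-≤ d F<G))

no-fuel : ∀ {n} {F : Sub n} {X : Set} → n < 0 + # F → X
no-fuel {F = F} fuel = ⊥-elim (<⇒≱ fuel (#≤n F))

∑-grow : ∀ {n} {f g : Fin n → ℕ} x → (∀ i → f i ≤ g i + ⟦ i == x ⟧) → sum f ≤ suc (sum g)
∑-grow {f = f} {g} x f≤g = ≤-trans (∑-mono f≤g) (≤-reflexive (trans (∑-distrib-+ g (λ i → ⟦ i == x ⟧))
  (trans (cong (λ z → sum g + z) (trans (sum-⟦⟧ (_== x)) (#-single x))) (+-comm (sum g) 1))))

∑-shrink : ∀ {n} {f g : Fin n → ℕ} x → (∀ i → f i + ⟦ i == x ⟧ ≤ g i) → suc (sum f) ≤ sum g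
∑-shrink {f = f} x f≤g = ≤-trans (≤-reflexive (sym (trans (∑-distrib-+ f (λ i → ⟦ i == x ⟧))
  (trans (cong (λ z → sum f + z) (trans (sum-⟦⟧ (_== x)) (#-single x))) (+-comm (sum f) 1))))) (∑-mono f≤g)
-- Exchanging between two partitions

-- Two partitions of Fin N are given by labellings π and ρ.  A set F of elements selects a new
-- partition: the elements of F move to their ρ-block, the others stay in their π-block.
module Exchange {N a b : ℕ} (π : Fin N → Fin a) (ρ : Fin N → Fin b)
                (π-size : ∀ i → 2 ≤ size π i) (ρ-size : ∀ j → 2 ≤ size ρ j) where

  record Valid (F : Sub N) : Set where
    field
      no-miss-1 : ∀ i → miss F π i ≢ 1
      no-hit-1  : ∀ j → hit F ρ j ≢ 1
  open Valid

  Avoids : Sub a → Sub N → Set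
  Avoids B F = ∀ e → T (F e) → ¬ T (B (π e))

  record Maximal (B : Sub a) (F : Sub N) : Set where
    field
      valid   : Valid F
      avoids  : Avoids B F
      maximal : ∀ G → Valid G → Avoids B G → F ⊑ G → G ⊑ F
  open Maximal

  valid-∅ : Valid (λ _ → false)
  valid-∅ .no-miss-1 i eq = <⇒≢ (π-size i) (sym (trans (sym (miss-void (λ _ _ ()))) eq))
  valid-∅ .no-hit-1 j eq = 0≢1+n (trans (sym (#-empty (λ _ ()))) eq)

  valid-full : Valid (λ _ → true)
  valid-full .no-miss-1 i eq = 0≢1+n (trans (sym (miss-full {g = π} {F = λ _ → true} {i} (λ _ _ → tt))) eq)
  valid-full .no-hit-1 j eq = <⇒≢ (ρ-size j) (sym (trans (sym (hit-full {F = λ _ → true} (λ _ _ → tt))) eq))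

  private
    Larger : Sub a → Sub N → Sub N → Set
    Larger B F G = (Valid G × Avoids B G) × (F ⊑ G × ∃ λ x → T (G x) × ¬ T (F x))

    valid? : ∀ G → Dec (Valid G)
    valid? G = map′ (λ (p , q) → record { no-miss-1 = p ; no-hit-1 = q }) (λ v → no-miss-1 v , no-hit-1 v)
      (all? (λ i → ¬? (miss G π i ≟ 1)) ×-dec all? (λ j → ¬? (hit G ρ j ≟ 1)))

    larger? : ∀ B F G → Dec (Larger B F G)
    larger? B F G = (valid? G ×-dec all? (λ e → T? (G e) →-dec ¬? (T? (B (π e)))))
              ×-dec (all? (λ e → T? (F e) →-dec T? (G e)) ×-dec any? (λ x → T? (G x) ×-dec ¬? (T? (F x))))

    -- The search runs over vectors, while a `Sub` is a function. A given `G` is replaced by its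
    -- tabulated copy, which agrees with it pointwise and so has the same hits and misses.
    any-larger? : ∀ B F → Dec (∃ (Larger B F))
    any-larger? B F with anySubset? (λ s → larger? B F (lookup s))
    ... | yes (s , l) = yes (lookup s , l)
    ... | no ∄s = no λ (G , (v , av) , F⊑G , x , Gx , ¬Fx) →
      let to : ∀ e → T (G e) → T (lookup (tabulate G) e)
          to e = subst T (sym (lookup∘tabulate G e))
          from : ∀ e → T (lookup (tabulate G) e) → T (G e)
          from e = subst T (lookup∘tabulate G e)
      in ∄s (tabulate G ,
        ( record { no-miss-1 = λ i eq → no-miss-1 v i (trans (miss-cong {F = G} (λ e _ → to e) (λ e _ → from e)) eq)
                 ; no-hit-1  = λ j eq → no-hit-1 v j (trans (hit-cong {F = G} (λ e _ → to e) (λ e _ → from e)) eq) }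
        , λ e t → av e (from e t))
        , (λ e t → to e (F⊑G e t)) , x , to x Gx , ¬Fx)

  extend : ∀ B F → Valid F → Avoids B F → ∃ λ G → F ⊑ G × Maximal B G
  extend B F = loop (suc N) F (m≤m+n (suc N) (# F))
    where
    loop : ∀ d F → N < d + # F → Valid F → Avoids B F → ∃ λ G → F ⊑ G × Maximal B G
    loop zero F fuel v av = no-fuel {F = F} fuel
    loop (suc d) F fuel v av with any-larger? B F
    ... | yes (G , (vG , avG) , F⊑G , x , Gx , ¬Fx) =
      let (H , G⊑H , max) = loop d G (burn {F = F} fuel (⊏-# F⊑G x Gx ¬Fx)) vG avG
      in H , (λ e t → G⊑H e (F⊑G e t)) , max
    ... | no ∄G = F , (λ _ t → t) , record { valid = v ; avoids = av ; maximal = λ G vG avG F⊑G x Gx → sub G vG avG F⊑G x Gx }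
      where
      sub : ∀ G → Valid G → Avoids B G → F ⊑ G → G ⊑ F
      sub G vG avG F⊑G x Gx with T? (F x)
      ... | yes Fx = Fx
      ... | no ¬Fx = ⊥-elim (∄G (G , (vG , avG) , F⊑G , x , Gx , ¬Fx))

  -- The discount of 2 is what an O-block disjoint from `F` contributes towards the unblocked
  -- elements left outside `F`. As such a block has at least two elements, all of them outside `F`,
  -- the subtraction never truncates.
  weight : Sub N → Fin b → ℕ
  weight F j = miss F ρ j ∸ 2 * ⟦ hit F ρ j ≈ᵇ 0 ⟧

  module _ (B : Sub a) (F : Sub N) (M : Maximal B F) where

    private
      outside : Sub N → Sub N
      outside G e = not (G e) ∧ not (B (π e))

      unhit : Sub N → Sub b
      unhit G j = hit G ρ j ≈ᵇ 0

      opened : Sub N → Sub a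
      opened G i = not (B i) ∧ does (2 ≤? miss G π i)

      Inv : Sub N → Set
      Inv G = # (outside G) ≤ # (unhit G) + # (opened G)

      remove : Sub N → Fin N → Sub N
      remove G x e = G e ∧ not (e == x)

      module _ {G : Sub N} {x : Fin N} (Gx : T (G x)) where

        remove-⊑ : remove G x ⊑ G
        remove-⊑ e = ∧-left

        ¬removed : ¬ T (remove G x x)
        ¬removed t = not-elim (∧-right {G x} t) (≡⇒== refl)

        keep : ∀ e → e ≢ x → T (G e) → T (remove G x e)
        keep e e≢x Ge = ∧-intro Ge (not-intro (λ t → e≢x (==⇒≡ t)))

        remove-< : # (remove G x) < # G
        remove-< = #-strict remove-⊑ x Gx ¬removed

        outside-remove : # (outside (remove G x)) ≤ suc (# (outside G))
        outside-remove = ≤-trans (#-mono sub) (#-insert (outside G) x)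
          where
          sub : ∀ e → T (outside (remove G x) e) → T (outside G e ∨ (e == x))
          sub e t with e F.≟ x
          ... | yes e≡x = ∨-right {outside G e} (≡⇒== e≡x)
          ... | no e≢x = ∨-left (∧-intro (not-intro (λ Ge → not-elim (∧-left t) (keep e e≢x Ge)))
                                         (∧-right {not (remove G x e)} t))

        unhit-mono : ∀ j → T (unhit G j) → T (unhit (remove G x) j)
        unhit-mono j t = T-does (_ ≟ 0) (n≤0⇒n≡0 (≤-trans (hit-mono (λ e _ → remove-⊑ e))
          (≤-reflexive (does-T (hit G ρ j ≟ 0) t))))

        opened-mono : ∀ i → T (opened G i) → T (opened (remove G x) i)
        opened-mono i t = ∧-intro (∧-left t) (T-does (2 ≤? _) (≤-trans
          (does-T (2 ≤? miss G π i) (∧-right {not (B i)} t)) (miss-anti (λ e _ → remove-⊑ e))))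

        inv-unhit : hit G ρ (ρ x) ≡ 1 → Inv G → Inv (remove G x)
        inv-unhit h≡1 inv = ≤-trans outside-remove (≤-trans (s≤s inv) (+-mono-≤
          (#-strict unhit-mono (ρ x)
            (T-does (_ ≟ 0) (n<1⇒n≡0 (<-≤-trans (hit-strict remove-⊑ x Gx ¬removed) (≤-reflexive h≡1))))
            (λ t → 0≢1+n (trans (sym (does-T (hit G ρ (ρ x) ≟ 0) t)) h≡1)))
          (#-mono opened-mono)))

        inv-opened : miss G π (π x) ≡ 1 → ¬ T (B (π x)) → Inv G → Inv (remove G x)
        inv-opened m≡1 ¬B inv = ≤-trans outside-remove (≤-trans (s≤s inv) (≤-trans
          (≤-reflexive (sym (+-suc _ _)))
          (+-mono-≤ (#-mono unhit-mono)
            (#-strict opened-mono (π x)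
              (∧-intro (not-intro ¬B) (T-does (2 ≤? _)
                (≤-trans (s≤s (≤-reflexive (sym m≡1))) (miss-strict remove-⊑ x Gx ¬removed))))
              (λ t → <⇒≢ (does-T (2 ≤? miss G π (π x)) (∧-right {not (B (π x))} t)) (sym m≡1))))))

      -- Starting from all unblocked elements, each block of either partition forces at most
      -- one removal; when nothing is forced any more, maximality of F says that F is left.
      prune : ∀ d G → # G < d → F ⊑ G → Avoids B G → Inv G → Inv F
      prune (suc d) G (s≤s G<d) F⊑G av inv with any? (λ j → hit G ρ j ≟ 1)
      ... | yes (j , h≡1) = removeQ (#-∃ (λ e → G e ∧ (ρ e == j)) (≤-reflexive (sym h≡1)))
        where
        removeQ : (∃ λ x → T (G x ∧ (ρ x == j))) → Inv F
        removeQ (x , t) = prune d (remove G x) (≤-trans (remove-< Gx) G<d)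
            (λ e Fe → keep Gx e (λ e≡x → ¬Fx (subst (λ z → T (F z)) e≡x Fe)) (F⊑G e Fe))
            (λ e u → av e (∧-left u)) (inv-unhit Gx (trans (cong (hit G ρ) ρx≡j) h≡1) inv)
          where
          Gx = ∧-left {G x} t
          ρx≡j = ==⇒≡ (∧-right {G x} t)
          ¬Fx : ¬ T (F x)
          ¬Fx Fx = no-hit-1 (valid M) (ρ x) (≤-antisym
            (≤-trans (hit-mono (λ e _ → F⊑G e)) (≤-reflexive (trans (cong (hit G ρ) ρx≡j) h≡1)))
            (hit-pos x Fx))
      ... | no ¬q with any? (λ i → miss G π i ≟ 1)
      -- The valid set `F` cannot miss exactly one element of this block, so it misses more than `G`
      -- does. An element of `G` outside `F` can be removed, and it shows that the block is
      -- unblocked.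
      ...   | yes (i , m≡1) = removeP (#-find (λ e → not (G e) ∧ (π e == i)) (λ e → not (F e) ∧ (π e == i))
                                (≤∧≢⇒< (miss-anti (λ e _ → F⊑G e)) (λ eq → no-miss-1 (valid M) i (trans (sym eq) m≡1))))
        where
        removeP : (∃ λ x → T (not (F x) ∧ (π x == i)) × ¬ T (not (G x) ∧ (π x == i))) → Inv F
        removeP (x , t , u) = prune d (remove G x) (≤-trans (remove-< Gx) G<d)
            (λ e Fe → keep Gx e (λ e≡x → ¬Fx (subst (λ z → T (F z)) e≡x Fe)) (F⊑G e Fe))
            (λ e u → av e (∧-left u)) (inv-opened Gx (trans (cong (miss G π) πx≡i) m≡1) (av x Gx) inv)
          where
          πx≡i = ==⇒≡ (∧-right {not (F x)} t)
          ¬Fx = not-elim {F x} (∧-left t)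
          Gx : T (G x)
          Gx with T? (G x)
          ... | yes g = g
          ... | no ¬g = ⊥-elim (u (∧-intro (not-intro ¬g) (≡⇒== πx≡i)))
      ...   | no ¬p = subst₂ _≤_ (#-cong (same F⊑G) (same G⊑F))
                        (cong₂ _+_ (#-cong (sameH G⊑F F⊑G) (sameH F⊑G G⊑F)) (#-cong (sameM G⊑F F⊑G) (sameM F⊑G G⊑F))) inv
        where
        G⊑F : G ⊑ F
        G⊑F = maximal M G (record { no-miss-1 = λ i eq → ¬p (i , eq) ; no-hit-1 = λ j eq → ¬q (j , eq) }) av F⊑G
        same : ∀ {G H} → H ⊑ G → ∀ e → T (outside G e) → T (outside H e)
        same {G} H⊑G e t = ∧-intro (not-intro (λ He → not-elim (∧-left t) (H⊑G e He))) (∧-right {not (G e)} t)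
        sameH : ∀ {G H} → G ⊑ H → H ⊑ G → ∀ j → T (unhit G j) → T (unhit H j)
        sameH p q j = subst T (cong (_≈ᵇ 0) (hit-cong (λ e _ → p e) (λ e _ → q e)))
        sameM : ∀ {G H} → G ⊑ H → H ⊑ G → ∀ i → T (opened G i) → T (opened H i)
        sameM p q i = subst T (cong (λ z → not (B i) ∧ does (2 ≤? z)) (miss-cong (λ e _ → p e) (λ e _ → q e)))

      inv-F : Inv F
      inv-F = prune (suc (# (λ e → not (B (π e))))) (λ e → not (B (π e))) ≤-refl
        (λ e Fe → not-intro (avoids M e Fe)) (λ e t → not-elim t)
        (≤-trans (≤-reflexive (#-empty (λ e t → not-elim {not (B (π e))} (∧-left t) (∧-right {not (not (B (π e)))} t)))) z≤n)

      2opened≤outside : 2 * # (opened F) ≤ # (outside F)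
      2opened≤outside = ≤-trans (≤-reflexive (cong₂ _+_ (sym (sum-⟦⟧ (opened F))) (trans (+-identityʳ _) (sym (sum-⟦⟧ (opened F))))))
        (≤-trans (≤-reflexive (sym (∑-distrib-+ (λ i → ⟦ opened F i ⟧) (λ i → ⟦ opened F i ⟧))))
        (≤-trans (∑-mono pointwise) (≤-reflexive (∑-hit (outside F) π))))
        where
        pointwise : ∀ i → ⟦ opened F i ⟧ + ⟦ opened F i ⟧ ≤ hit (outside F) π i
        pointwise i with T? (opened F i)
        ... | no ¬o rewrite ⟦⟧-¬T ¬o = z≤n
        ... | yes o rewrite ⟦⟧-T o = ≤-trans (does-T (2 ≤? miss F π i) (∧-right {not (B i)} o))
          (#-mono (λ e t → ∧-intro (∧-intro (∧-left t) (subst (λ z → T (not (B z))) (sym (==⇒≡ (∧-right {not (F e)} t))) (∧-left o)))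
                                   (∧-right {not (F e)} t)))

      -- An opened block holds two outside elements, so in twice the invariant the term for the
      -- opened blocks is absorbed by one copy of the left-hand side.
      outside≤2unhit : # (outside F) ≤ 2 * # (unhit F)
      outside≤2unhit = +-cancelʳ-≤ (# (outside F)) (# (outside F)) (2 * # (unhit F)) (begin
        # (outside F) + # (outside F)                ≤⟨ +-mono-≤ inv-F inv-F ⟩
        (q + r) + (q + r)                            ≡⟨ rearrange q r ⟩
        2 * q + 2 * r                                ≤⟨ +-monoʳ-≤ (2 * q) 2opened≤outside ⟩
        2 * q + # (outside F)                        ∎)
        where
        open ≤-Reasoning
        q = # (unhit F)
        r = # (opened F)
        rearrange : ∀ q r → (q + r) + (q + r) ≡ 2 * q + 2 * r
        rearrange = solve-∀

    -- The discounts add up to twice the number of O-blocks disjoint from `F`, which is just the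
    -- bound on the unblocked elements outside `F`. Only blocked elements remain to be paid for.
    ∑-weight : sum (weight F) ≤ # (λ e → B (π e))
    ∑-weight = +-cancelʳ-≤ (2 * # (unhit F)) _ _ (begin
      sum (weight F) + 2 * # (unhit F)                                ≡⟨ cong₂ (λ x y → sum (weight F) + (x + y)) (sym (sum-⟦⟧ (unhit F))) (trans (+-identityʳ _) (sym (sum-⟦⟧ (unhit F)))) ⟩
      sum (weight F) + (sum (λ j → ⟦ unhit F j ⟧) + sum (λ j → ⟦ unhit F j ⟧))
                                                                      ≡⟨ cong (λ z → sum (weight F) + z) (sym (∑-distrib-+ (λ j → ⟦ unhit F j ⟧) (λ j → ⟦ unhit F j ⟧))) ⟩
      sum (weight F) + sum (λ j → ⟦ unhit F j ⟧ + ⟦ unhit F j ⟧)      ≡⟨ sym (∑-distrib-+ (weight F) (λ j → ⟦ unhit F j ⟧ + ⟦ unhit F j ⟧)) ⟩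
      sum (λ j → weight F j + (⟦ unhit F j ⟧ + ⟦ unhit F j ⟧))        ≤⟨ ∑-mono pointwise ⟩
      sum (miss F ρ)                                                  ≡⟨ ∑-hit (λ e → not (F e)) ρ ⟩
      # (λ e → not (F e))                                             ≡⟨ #-split (λ e → not (F e)) (λ e → B (π e)) ⟩
      # (λ e → not (F e) ∧ B (π e)) + # (outside F)                   ≤⟨ +-mono-≤ (#-mono (λ e → ∧-right {not (F e)})) outside≤2unhit ⟩
      # (λ e → B (π e)) + 2 * # (unhit F)                             ∎)
      where
      open ≤-Reasoning
      pointwise : ∀ j → weight F j + (⟦ unhit F j ⟧ + ⟦ unhit F j ⟧) ≤ miss F ρ j
      pointwise j with hit F ρ j ≟ 0
      ... | yes h≡0 rewrite h≡0 = ≤-reflexive (m∸n+n≡m {miss F ρ j} {2}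
                        (≤-trans (ρ-size j) (≤-reflexive (trans (size-hit-miss F ρ j) (cong (λ z → z + miss F ρ j) h≡0)))))
      ... | no h≢0 with hit F ρ j
      ...   | zero = ⊥-elim (h≢0 refl)
      ...   | suc _ = ≤-reflexive (+-identityʳ _)

-- Alternating walks and sets that can be united

module Walk {N a b : ℕ} (π : Fin N → Fin a) (ρ : Fin N → Fin b)
            (π-size : ∀ i → 2 ≤ size π i) (ρ-size : ∀ j → 2 ≤ size ρ j) (isA : Sub a)
            (F : Sub N) (M : Exchange.Maximal π ρ π-size ρ-size isA F) where

  open Exchange π ρ π-size ρ-size
  open Valid
  open Maximal

  -- For `F ⊑ K`, a π-block outside A loses to `K` either what it loses to `F` or everything, so it
  -- never keeps exactly one element. Members of A are left free here; on them validity is checked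
  -- by counting.
  Uniform : Sub N → Set
  Uniform K = ∀ i → ¬ T (isA i) → (∀ e → π e ≡ i → T (K e) → T (F e)) ⊎ (∀ e → π e ≡ i → T (K e))

  -- Unlike validity, softness is preserved by unions.
  record Soft (K : Sub N) : Set where
    field
      base     : F ⊑ K
      no-hit-1 : ∀ j → hit K ρ j ≢ 1
      uniform  : Uniform K

  soft-F : Soft F
  soft-F = record { base = λ _ t → t ; no-hit-1 = no-hit-1 (valid M) ; uniform = λ _ _ → inj₁ (λ _ _ t → t) }

  -- An element that is alone in its ρ-block within the union is already alone there within
  -- whichever of the two sets contains it.
  ⊔-no-hit-1 : ∀ {K L} → (∀ j → hit K ρ j ≢ 1) → (∀ j → hit L ρ j ≢ 1) → ∀ j → hit (K ⊔ L) ρ j ≢ 1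
  ⊔-no-hit-1 {K} {L} qK qL j eq with #-∃ (λ e → (K ⊔ L) e ∧ (ρ e == j)) (≤-reflexive (sym eq))
  ... | x , t = [ left , right ]′ (∨-elim {K x} (∧-left t))
    where
    ρx≡j : T (ρ x == j)
    ρx≡j = ∧-right {(K ⊔ L) x} t
    left : ¬ T (K x)
    left Kx = qK j (≤-antisym (≤-trans (hit-mono (λ e _ → ∨-left)) (≤-reflexive eq)) (#-pos x (∧-intro Kx ρx≡j)))
    right : ¬ T (L x)
    right Lx = qL j (≤-antisym (≤-trans (hit-mono (λ e _ → ∨-right {K e})) (≤-reflexive eq)) (#-pos x (∧-intro Lx ρx≡j)))

  soft-⊔ : ∀ {K L} → Soft K → Soft L → Soft (K ⊔ L)
  soft-⊔ {K} {L} sK sL = record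
    { base = λ e Fe → ∨-left (Soft.base sK e Fe)
    ; no-hit-1 = ⊔-no-hit-1 (Soft.no-hit-1 sK) (Soft.no-hit-1 sL)
    ; uniform = uni }
    where
    uni : Uniform (K ⊔ L)
    uni i ¬A with Soft.uniform sK i ¬A | Soft.uniform sL i ¬A
    ... | inj₂ all  | _         = inj₂ (λ e eq → ∨-left (all e eq))
    ... | inj₁ none | inj₂ all  = inj₂ (λ e eq → ∨-right {K e} (all e eq))
    ... | inj₁ n₁   | inj₁ n₂   = inj₁ (λ e eq t → [ n₁ e eq , n₂ e eq ]′ (∨-elim {K e} t))

  uniform-miss : ∀ {K} → F ⊑ K → Uniform K → ∀ i → ¬ T (isA i) → miss K π i ≢ 1
  uniform-miss F⊑K uni i ¬A eq with uni i ¬A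
  ... | inj₁ none = no-miss-1 (valid M) i (trans (sym (miss-cong none (λ e _ → F⊑K e))) eq)
  ... | inj₂ all  = 0≢1+n (trans (sym (miss-full all)) eq)

  soft-valid : ∀ {K} → Soft K → (∀ i → T (isA i) → miss K π i ≢ 1) → Valid K
  soft-valid {K} sK onA = record { no-miss-1 = onP ; no-hit-1 = Soft.no-hit-1 sK }
    where
    onP : ∀ i → miss K π i ≢ 1
    onP i with T? (isA i)
    ... | yes A = onA i A
    ... | no ¬A = uniform-miss (Soft.base sK) (Soft.uniform sK) i ¬A

  avoids-miss : ∀ {K} → Avoids isA K → ∀ i → T (isA i) → miss K π i ≢ 1
  avoids-miss av i A eq = <⇒≢ (π-size i) (sym (trans (sym (miss-void
    (λ e πe≡i Ke → av e Ke (subst (λ z → T (isA z)) (sym πe≡i) A)))) eq))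

  -- An arm takes a single element from all of A. The valid set `B` confines the walk: with all
  -- elements for `B` the walk is free, while a `B` avoiding blocked members forces the end into an
  -- unblocked one.
  record Arm (B L : Sub N) : Set where
    field
      K     : Sub N
      soft  : Soft K
      above : L ⊑ K
      below : K ⊑ B
      end   : Fin N
      end∈A : T (isA (π end))
      end∈K : T (K end)
      only  : ∀ e → T (K e) → T (isA (π e)) → e ≡ end

  -- An alternating walk: a π-block left with one element is emptied, a ρ-block receiving one
  -- element receives another.  By maximality of F the walk can only end inside A.
  walk : ∀ {B} → Valid B → ∀ d H x → N < d + # H → F ⊑ H → H ⊑ B → Avoids isA H → Uniform H →
         ¬ T (H x) → T (B x) → (∀ j → hit (H ⊕ x) ρ j ≢ 1) → Arm B (H ⊕ x)
  walk vB zero H x fuel = no-fuel {F = H} fuel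
  walk {B} vB (suc d) H x fuel F⊑H H⊑B avH uniH ¬Hx Bx qH with T? (isA (π x))
  ... | yes Ax = record
    { K = H ⊕ x
    ; soft = record { base = λ e Fe → ∨-left (F⊑H e Fe) ; no-hit-1 = qH ; uniform = uni }
    ; above = λ _ t → t
    ; below = ⊕-elim {F = H} H⊑B Bx
    ; end = x ; end∈A = Ax ; end∈K = ⊕-self {F = H}
    ; only = ⊕-elim {F = H} (λ e He A → ⊥-elim (avH e He A)) (λ _ → refl) }
    where
    uni : Uniform (H ⊕ x)
    uni i ¬A with uniH i ¬A
    ... | inj₁ none = inj₁ (λ e eq t → none e eq (⊕-other {g = π} H {x} (λ i≡πx → ¬A (subst (λ z → T (isA z)) (sym i≡πx) Ax)) e eq t))
    ... | inj₂ all  = inj₂ (λ e eq → ∨-left (all e eq))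
  ... | no ¬Ax = continue
    where
    H′ : Sub N
    H′ = H ⊕ x

    H′⊑B : H′ ⊑ B
    H′⊑B = ⊕-elim {F = H} H⊑B Bx

    avH′ : Avoids isA H′
    avH′ = ⊕-elim {F = H} avH ¬Ax

    uni′ : ∀ i → i ≢ π x → ¬ T (isA i) → (∀ e → π e ≡ i → T (H′ e) → T (F e)) ⊎ (∀ e → π e ≡ i → T (H′ e))
    uni′ i i≢πx ¬A with uniH i ¬A
    ... | inj₁ none = inj₁ (λ e eq t → none e eq (⊕-other {g = π} H {x} i≢πx e eq t))
    ... | inj₂ all  = inj₂ (λ e eq → ∨-left (all e eq))

    -- Whenever the walk could stop outside A, it would yield a valid set avoiding A that contains
    -- `F` and also `x`, against the maximality of `F`.
    too-large : ∀ {G} → F ⊑ G → H′ ⊑ G → Avoids isA G → Valid G → Arm B H′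
    too-large F⊑G H′⊑G avG vG = ⊥-elim (¬Hx (F⊑H x (maximal M _ vG avG F⊑G x (H′⊑G x (⊕-self {F = H})))))

    continue : Arm B H′
    continue with miss H′ π (π x) ≟ 1
    ... | no m≢1 = too-large (λ e Fe → ∨-left (F⊑H e Fe)) (λ _ t → t) avH′
                     (record { no-miss-1 = onP ; no-hit-1 = qH })
      where
      onP : ∀ i → miss H′ π i ≢ 1
      onP i eq with i F.≟ π x
      ... | yes refl = m≢1 eq
      ... | no i≢πx with T? (isA i)
      ...   | yes A = avoids-miss avH′ i A eq
      ...   | no ¬A with uni′ i i≢πx ¬A
      ...     | inj₁ none = no-miss-1 (valid M) i (trans (sym (miss-cong none (λ e _ Fe → ∨-left (F⊑H e Fe)))) eq)
      ...     | inj₂ all  = 0≢1+n (trans (sym (miss-full all)) eq)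
    ... | yes m≡1 = forced (#-∃ (λ e → not (H′ e) ∧ (π e == π x)) (≤-reflexive (sym m≡1)))
      where
      forced : (∃ λ y → T (not (H′ y) ∧ (π y == π x))) → Arm B H′
      forced (y , t) = close
        where
        πy≡πx : π y ≡ π x
        πy≡πx = ==⇒≡ (∧-right {not (H′ y)} t)

        -- `H′ ⊑ B` leaves only `y` in this π-block, so a `B` without `y` would leave exactly one
        -- element. In the same way the validity of `B` supplies the element `z` of the next
        -- ρ-block.
        By : T (B y)
        By with T? (B y)
        ... | yes p = p
        ... | no ¬By = ⊥-elim (no-miss-1 vB (π y) (≤-antisym
                (≤-trans (miss-anti (λ e _ → H′⊑B e)) (≤-reflexive (trans (cong (miss H′ π) πy≡πx) m≡1)))
                (miss-pos y ¬By)))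

        H″ : Sub N
        H″ = H′ ⊕ y

        H″⊑B : H″ ⊑ B
        H″⊑B = ⊕-elim {F = H′} H′⊑B By

        F⊑H″ : F ⊑ H″
        F⊑H″ e Fe = ∨-left (∨-left (F⊑H e Fe))

        avH″ : Avoids isA H″
        avH″ = ⊕-elim {F = H′} avH′ (λ A → ¬Ax (subst (λ z → T (isA z)) πy≡πx A))

        full : ∀ e → π e ≡ π x → T (H″ e)
        full e πe≡πx with T? (H′ e)
        ... | yes p = ∨-left p
        ... | no ¬p = ∨-right {H′ e} (≡⇒== (#-unique _ (≤-reflexive m≡1) e y
                        (∧-intro (not-intro ¬p) (≡⇒== πe≡πx)) t))

        uni″ : Uniform H″
        uni″ i ¬A with i F.≟ π x
        ... | yes refl = inj₂ full
        ... | no i≢πx with uni′ i i≢πx ¬A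
        ...   | inj₁ none = inj₁ (λ e eq u → none e eq (⊕-other {g = π} H′ {y} (λ i≡πy → i≢πx (trans i≡πy πy≡πx)) e eq u))
        ...   | inj₂ all  = inj₂ (λ e eq → ∨-left (all e eq))

        close : Arm B H′
        close with hit H″ ρ (ρ y) ≟ 1
        ... | no h≢1 = too-large F⊑H″ (λ e → ∨-left) avH″ (record { no-miss-1 = onP ; no-hit-1 = onQ })
          where
          onP : ∀ i → miss H″ π i ≢ 1
          onP i with T? (isA i)
          ... | yes A = avoids-miss avH″ i A
          ... | no ¬A = uniform-miss F⊑H″ uni″ i ¬A
          onQ : ∀ j → hit H″ ρ j ≢ 1
          onQ j eq with j F.≟ ρ y
          ... | yes refl = h≢1 eq
          ... | no j≢ρy = qH j (trans (sym (hit-⊕-other H′ j≢ρy)) eq)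
        ... | yes h≡1 = onward (#-find (λ e → H″ e ∧ (ρ e == ρ y)) (λ e → B e ∧ (ρ e == ρ y))
                          (≤∧≢⇒< (hit-mono (λ e _ → H″⊑B e)) (λ eq → no-hit-1 vB (ρ y) (trans (sym eq) h≡1))))
          where
          onward : (∃ λ z → T (B z ∧ (ρ z == ρ y)) × ¬ T (H″ z ∧ (ρ z == ρ y))) → Arm B H′
          onward (z , u , v) = record
            { K = Arm.K arm ; soft = Arm.soft arm ; below = Arm.below arm
            ; above = λ e p → Arm.above arm e (∨-left (∨-left p))
            ; end = Arm.end arm ; end∈A = Arm.end∈A arm ; end∈K = Arm.end∈K arm ; only = Arm.only arm }
            where
            ρz≡ρy : ρ z ≡ ρ y
            ρz≡ρy = ==⇒≡ (∧-right {B z} u)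

            ¬H″z : ¬ T (H″ z)
            ¬H″z p = v (∧-intro p (≡⇒== ρz≡ρy))

            onQ : ∀ j → hit (H″ ⊕ z) ρ j ≢ 1
            onQ j eq with j F.≟ ρ z
            ... | yes refl = <⇒≢ (hit-strict (λ e → ∨-left) z (⊕-self {F = H″}) ¬H″z) (trans (trans (cong (hit H″ ρ) ρz≡ρy) h≡1) (sym eq))
            ... | no j≢ρz = qH j (trans (sym (hit-⊕-other H′ (λ j≡ρy → j≢ρz (trans j≡ρy (sym ρz≡ρy)))))
                                   (trans (sym (hit-⊕-other H″ j≢ρz)) eq))

            arm : Arm B (H″ ⊕ z)
            arm = walk vB d H″ z (burn {F = H} fuel (⊏-# (λ e p → ∨-left (∨-left p)) x (∨-left (⊕-self {F = H})) ¬Hx))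
                    F⊑H″ H″⊑B avH″ uni″ ¬H″z (∧-left u) onQ

  -- `F` already has an element in the ρ-block of `x`, so adding `x` makes no element alone there;
  -- the walk starts with all ρ-blocks in order.
  arm : ∀ {B} → Valid B → F ⊑ B → ∀ x → ¬ T (F x) → T (B x) → 1 ≤ hit F ρ (ρ x) → Arm B (F ⊕ x)
  arm vB F⊑B x ¬Fx Bx 1≤hit = walk vB (suc N) F x (m≤m+n (suc N) (# F)) (λ _ t → t) F⊑B (avoids M)
    (λ _ _ → inj₁ (λ _ _ t → t)) ¬Fx Bx onQ
    where
    onQ : ∀ j → hit (F ⊕ x) ρ j ≢ 1
    onQ j eq with j F.≟ ρ x
    ... | yes refl = <⇒≢ (≤-trans (s≤s 1≤hit) (hit-strict (λ e → ∨-left) x (⊕-self {F = F}) ¬Fx)) (sym eq)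
    ... | no j≢ρx = no-hit-1 (valid M) j (trans (sym (hit-⊕-other F j≢ρx)) eq)

-- Local optimality and the charging of members of A to members of O

module Search {N a b : ℕ} (π : Fin N → Fin a) (ρ : Fin N → Fin b)
              (π-size : ∀ i → 2 ≤ size π i) (ρ-size : ∀ j → 2 ≤ size ρ j)
              (isA : Sub a) (isO : Sub b) (k s : ℕ)
              (A-size : ∀ i → T (isA i) → size π i ≡ k) (O-size : ∀ j → T (isO j) → size ρ j ≡ k)
  where

  open Exchange π ρ π-size ρ-size
  open Valid
  open Maximal

  touched : Sub N → ℕ
  touched G = # (λ i → isA i ∧ does (1 ≤? hit G π i))

  contained : Sub N → ℕ
  contained G = # (λ j → isO j ∧ (miss G ρ j ≈ᵇ 0))

  LocallyOptimal : Set
  LocallyOptimal = ∀ G → Valid G → touched G ≤ s → ¬ touched G < contained G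

  touched-mono : ∀ {K L} → (∀ e → T (K e) → T (isA (π e)) → 1 ≤ hit L π (π e)) → touched K ≤ touched L
  touched-mono {K} {L} sub = #-mono mono
    where
    mono : ∀ i → T (isA i ∧ does (1 ≤? hit K π i)) → T (isA i ∧ does (1 ≤? hit L π i))
    mono i t with #-∃ (λ e → K e ∧ (π e == i)) (does-T (1 ≤? hit K π i) (∧-right {isA i} t))
    ... | e , u with ==⇒≡ {x = π e} (∧-right {K e} u)
    ... | refl = ∧-intro (∧-left t) (T-does (1 ≤? _) (sub e (∧-left u) (∧-left t)))

  touched-⊔ : ∀ K L → touched (K ⊔ L) ≤ touched K + touched L
  touched-⊔ K L = ≤-trans (#-mono sub) (#-∨ (λ i → isA i ∧ does (1 ≤? hit K π i)) (λ i → isA i ∧ does (1 ≤? hit L π i)))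
    where
    sub : ∀ i → T (isA i ∧ does (1 ≤? hit (K ⊔ L) π i)) →
          T ((isA i ∧ does (1 ≤? hit K π i)) ∨ (isA i ∧ does (1 ≤? hit L π i)))
    sub i t with #-∃ (λ e → (K ⊔ L) e ∧ (π e == i)) (does-T (1 ≤? hit (K ⊔ L) π i) (∧-right {isA i} t))
    ... | e , u with ∨-elim {K e} (∧-left u)
    ...   | inj₁ Ke = ∨-left {isA i ∧ does (1 ≤? hit K π i)} (∧-intro (∧-left t) (T-does (1 ≤? _) (#-pos e (∧-intro Ke (∧-right {(K ⊔ L) e} u)))))
    ...   | inj₂ Le = ∨-right {isA i ∧ does (1 ≤? hit K π i)}
                        (∧-intro (∧-left t) (T-does (1 ≤? _) (#-pos e (∧-intro Le (∧-right {(K ⊔ L) e} u)))))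

  touched-none : ∀ {K} → Avoids isA K → touched K ≡ 0
  touched-none {K} av = n≤0⇒n≡0 (≤-trans (touched-mono {L = λ _ → false} (λ e Ke A → ⊥-elim (av e Ke A)))
    (≤-reflexive (#-empty (λ i t → <⇒≢ (does-T (1 ≤? _) (∧-right {isA i} t)) (sym (#-empty (λ _ ())))))))

  -- Every member of A met by `K` is charged to a set of `R` attached to it and contained in `K`, so
  -- these sets are at least as many as the members met. The set `o` comes on top, which makes `K`
  -- an improvement.
  overfull : LocallyOptimal → ∀ (R : Sub b) (β : Fin b → Fin N) {K} → Valid K → touched K ≤ s →
             (∀ o → T (R o) → T (isO o)) →
             (∀ e → T (K e) → T (isA (π e)) → ∃ λ o → T (R o) × π (β o) ≡ π e × (∀ x → ρ x ≡ o → T (K x))) →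
             ∀ o → T (isO o) → ¬ T (R o) → ¬ (∀ x → ρ x ≡ o → T (K x))
  overfull opt R β {K} vK few R⊆O roots o Oo ¬Ro o⊆K = opt K vK few (≤-trans (s≤s touched≤Z) Z<contained)
    where
    Z : Sub b
    Z j = R j ∧ (miss K ρ j ≈ᵇ 0)

    pointwise : ∀ i → ⟦ isA i ∧ does (1 ≤? hit K π i) ⟧ ≤ hit Z (λ j → π (β j)) i
    pointwise i with T? (isA i ∧ does (1 ≤? hit K π i))
    ... | no ¬t rewrite ⟦⟧-¬T ¬t = z≤n
    ... | yes t rewrite ⟦⟧-T t with #-∃ (λ e → K e ∧ (π e == i)) (does-T (1 ≤? hit K π i) (∧-right {isA i} t))
    ...   | e , u with ==⇒≡ {x = π e} (∧-right {K e} u)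
    ...     | refl with roots e (∧-left u) (∧-left t)
    ...       | o′ , Ro′ , eq , o′⊆K = #-pos o′ (∧-intro (∧-intro Ro′ (T-does (_ ≟ 0) (miss-full o′⊆K))) (≡⇒== eq))

    touched≤Z : touched K ≤ # Z
    touched≤Z = ≤-trans (≤-reflexive (sym (sum-⟦⟧ _))) (≤-trans (∑-mono pointwise) (≤-reflexive (∑-hit Z (λ j → π (β j)))))

    Z<contained : # Z < contained K
    Z<contained = #-strict (λ j t → ∧-intro (R⊆O j (∧-left t)) (∧-right {R j} t)) o
      (∧-intro Oo (T-does (_ ≟ 0) (miss-full o⊆K))) (λ t → ¬Ro (∧-left t))

  rooted : Sub b → (Fin b → Fin N) → Sub a
  rooted R β i = does (any? (λ o → T? (R o ∧ (π (β o) == i))))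

  blocked : Sub b → (Fin b → Fin N) → Sub a
  blocked R β i = isA i ∧ not (rooted R β i)

  rooted-intro : ∀ {R β} o → T (R o) → T (rooted R β (π (β o)))
  rooted-intro {R} {β} o Ro = T-does (any? (λ o′ → T? (R o′ ∧ (π (β o′) == π (β o))))) (o , ∧-intro Ro (≡⇒== refl))

  rooted-elim : ∀ {R β i} → T (rooted R β i) → ∃ λ o → T (R o) × π (β o) ≡ i
  rooted-elim {R} {β} {i} t with does-T (any? (λ o → T? (R o ∧ (π (β o) == i)))) t
  ... | o , u = o , ∧-left u , ==⇒≡ (∧-right {R o} u)

  ¬blocked : ∀ {R β i} → T (isA i) → ¬ T (blocked R β i) → ∃ λ o → T (R o) × π (β o) ≡ i
  ¬blocked {R} {β} {i} A ¬B with T? (rooted R β i)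
  ... | yes r = rooted-elim {R} {β} r
  ... | no ¬r = ⊥-elim (¬B (∧-intro A (not-intro ¬r)))

  #-elements : ∀ B → (∀ i → T (B i) → T (isA i)) → # (λ e → B (π e)) ≤ k * # B
  #-elements B B⊆A = ≤-trans (≤-reflexive (sym (∑-hit (λ e → B (π e)) π)))
      (≤-trans (∑-mono {g = λ i → k * ⟦ B i ⟧} pointwise) (≤-reflexive (trans (sym (*-distribˡ-sum k (λ i → ⟦ B i ⟧))) (cong (λ z → k * z) (sum-⟦⟧ B)))))
    where
    pointwise : ∀ i → hit (λ e → B (π e)) π i ≤ k * ⟦ B i ⟧
    pointwise i with T? (B i)
    ... | yes t rewrite ⟦⟧-T t = ≤-trans (#-mono (λ e → ∧-right {B (π e)}))
            (≤-reflexive (trans (A-size i (B⊆A i t)) (sym (*-identityʳ k))))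
    ... | no ¬t = ≤-trans (≤-reflexive (#-empty (λ e u →
            ¬t (subst (λ z → T (B z)) (==⇒≡ (∧-right {B (π e)} u)) (∧-left u))))) z≤n

  #-blocked : ∀ R β → (∀ o → T (R o) → T (isA (π (β o)))) →
              (∀ o o′ → T (R o) → T (R o′) → π (β o) ≡ π (β o′) → o ≡ o′) →
              # (λ e → blocked R β (π e)) + k * # R ≤ k * # isA
  #-blocked R β βA injective = begin
    # (λ e → blocked R β (π e)) + k * # R            ≤⟨ +-mono-≤ (#-elements B (λ i → ∧-left)) (*-monoʳ-≤ k roots) ⟩
    k * # (blocked R β) + k * # (λ i → isA i ∧ rooted R β i) ≡⟨ sym (*-distribˡ-+ k (# (blocked R β)) _) ⟩
    k * (# (blocked R β) + # (λ i → isA i ∧ rooted R β i))   ≡⟨ cong (λ z → k * z) (trans (+-comm (# (blocked R β)) _) (sym (#-split isA (rooted R β)))) ⟩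
    k * # isA                                        ∎
    where
    open ≤-Reasoning
    B = blocked R β

    -- By injectivity the sets of `R` unblock distinct members of A, so `k` elements are saved for
    -- each of them.
    roots : # R ≤ # (λ i → isA i ∧ rooted R β i)
    roots = ≤-trans (≤-reflexive (sym (∑-hit R (λ o → π (β o)))))
      (≤-trans (∑-mono pointwise) (≤-reflexive (sum-⟦⟧ (λ i → isA i ∧ rooted R β i))))
      where
      pointwise : ∀ i → hit R (λ o → π (β o)) i ≤ ⟦ isA i ∧ rooted R β i ⟧
      pointwise i with T? (isA i ∧ rooted R β i)
      ... | yes t rewrite ⟦⟧-T t = #-≤1 _ (λ o o′ u u′ → injective o o′ (∧-left u) (∧-left u′)
              (trans (==⇒≡ (∧-right {R o} u)) (sym (==⇒≡ (∧-right {R o′} u′)))))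
      ... | no ¬t = ≤-trans (≤-reflexive (#-empty (λ o u → ¬t (subst (λ z → T (isA z ∧ rooted R β z))
              (==⇒≡ (∧-right {R o} u)) (∧-intro (βA o (∧-left u)) (rooted-intro {R} {β} o (∧-left u))))))) z≤n

  weight-hit : ∀ {G j} → 1 ≤ hit G ρ j → weight G j ≡ miss G ρ j
  weight-hit {G} {j} 1≤h with hit G ρ j
  ... | suc _ = refl
  weight-hit () | zero

  weight-unhit : ∀ {G j} → hit G ρ j ≡ 0 → T (isO j) → weight G j + 2 ≡ k
  weight-unhit {G} {j} h≡0 Oj rewrite h≡0 = trans (cong (λ z → z ∸ 2 + 2) m≡k)
      (m∸n+n≡m (≤-trans (ρ-size j) (≤-reflexive (O-size j Oj))))
    where
    m≡k : miss G ρ j ≡ k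
    m≡k = trans (trans (cong (λ z → z + miss G ρ j) (sym h≡0)) (sym (size-hit-miss G ρ j))) (O-size j Oj)

-- The case k = 4

module FourSets {N a b : ℕ} (π : Fin N → Fin a) (ρ : Fin N → Fin b)
                (π-size : ∀ i → 2 ≤ size π i) (ρ-size : ∀ j → 2 ≤ size ρ j)
                (isA : Sub a) (isO : Sub b) (s : ℕ)
                (A-size : ∀ i → T (isA i) → size π i ≡ 4) (O-size : ∀ j → T (isO j) → size ρ j ≡ 4)
                (4≤s : 4 ≤ s) (F : Sub N) (M : Exchange.Maximal π ρ π-size ρ-size isA F)
                (optimal : Search.LocallyOptimal π ρ π-size ρ-size isA isO 4 s A-size O-size)
  where

  open Exchange π ρ π-size ρ-size
  open Valid
  open Maximal
  open Search π ρ π-size ρ-size isA isO 4 s A-size O-size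

  open Walk π ρ π-size ρ-size isA F M

  private
    few-hits : ∀ {K i} x y → T (isA i) → (∀ e → T (K e) → π e ≡ i → e ≡ x ⊎ e ≡ y) → 2 ≤ miss K π i
    few-hits {K} {i} x y A sub = +-cancelˡ-≤ 2 2 (miss K π i) (≤-trans
      (≤-reflexive (trans (sym (A-size i A)) (size-hit-miss K π i))) (+-monoˡ-≤ (miss K π i) hit≤2))
      where
      hit≤2 : hit K π i ≤ 2
      hit≤2 = ≤-trans (#-mono (λ e t → [ (λ e≡x → ∨-left (≡⇒== e≡x)) , (λ e≡y → ∨-right {e == x} (≡⇒== e≡y)) ]′
                  (sub e (∧-left t) (==⇒≡ (∧-right {K e} t)))))
                (≤-trans (#-∨ (_== x) (_== y)) (≤-reflexive (cong₂ _+_ (#-single x) (#-single y))))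

    -- `F` meets no member of A, so a member of O inside it could be added without removing
    -- anything.
    F-not-full : ∀ o → T (isO o) → miss F ρ o ≢ 0
    F-not-full o Oo m≡0 = overfull optimal (λ _ → false) (λ o′ → proj₁ (#-∃ (λ e → ρ e == o′) (≤-trans (s≤s z≤n) (ρ-size o′))))
      (valid M) (≤-trans (≤-reflexive (touched-none (avoids M))) z≤n) (λ _ ()) (λ e Fe A → ⊥-elim (avoids M e Fe A))
      o Oo (λ ()) (miss-zero m≡0)

    -- The members of O of weight 1 in `F`. All others have weight at least 2, those disjoint from
    -- `F` because 4 - 2 = 2.
    R : Sub b
    R o = isO o ∧ (does (1 ≤? hit F ρ o) ∧ (miss F ρ o ≈ᵇ 1))

    R⇒O : ∀ o → T (R o) → T (isO o)
    R⇒O o = ∧-left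

    record Companion (o : Fin b) (x : Fin N) (C : Sub N) : Set where
      field
        soft : Soft C
        full : ∀ e → ρ e ≡ o → T (C e)
        x∈A  : T (isA (π x))
        x∈C  : T (C x)
        only : ∀ e → T (C e) → T (isA (π e)) → e ≡ x

    opaque

      pick : ∀ o → ∃ λ x → ∃ λ C → T (R o) → Companion o x C
      pick o with T? (R o)
      -- Default values outside `R`, so that `β` and `C` are total functions.
      ... | no ¬R = proj₁ (#-∃ (λ e → ρ e == o) (≤-trans (s≤s z≤n) (ρ-size o))) , (λ _ → false) , λ r → ⊥-elim (¬R r)
      ... | yes r with does-T (_ ≟ 1) (∧-right {does (1 ≤? hit F ρ o)} (∧-right {isO o} r))
      ...   | m≡1 with #-∃ (λ e → not (F e) ∧ (ρ e == o)) (≤-reflexive (sym m≡1))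
      ...     | u , t = Arm.end A , Arm.K A , λ _ → record
        { soft = Arm.soft A
        ; full = λ e ρe≡o → Arm.above A e (full e ρe≡o)
        ; x∈A = Arm.end∈A A ; x∈C = Arm.end∈K A ; only = Arm.only A }
        where
        ρu≡o : ρ u ≡ o
        ρu≡o = ==⇒≡ (∧-right {not (F u)} t)
        A : Arm (λ _ → true) (F ⊕ u)
        A = arm valid-full (λ _ _ → tt) u (not-elim (∧-left t)) tt
              (subst (λ z → 1 ≤ hit F ρ z) (sym ρu≡o) (does-T (1 ≤? _) (∧-left (∧-right {isO o} r))))
        full : ∀ e → ρ e ≡ o → T ((F ⊕ u) e)
        full e ρe≡o with T? (F e)
        ... | yes Fe = ∨-left Fe
        ... | no ¬Fe = ∨-right {F e} (≡⇒== (#-unique _ (≤-reflexive m≡1) e u (∧-intro (not-intro ¬Fe) (≡⇒== ρe≡o)) t))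

    β : Fin b → Fin N
    β o = proj₁ (pick o)

    C : Fin b → Sub N
    C o = proj₁ (proj₂ (pick o))

    companion : ∀ o → T (R o) → Companion o (β o) (C o)
    companion o = proj₂ (proj₂ (pick o))

    β∈A : ∀ o → T (R o) → T (isA (π (β o)))
    β∈A o Ro = Companion.x∈A (companion o Ro)

    -- Two companions ending in the same member take at most two of its four elements, so their
    -- union is valid. It would replace this one member of A by both `o` and `o′`.
    injective : ∀ o o′ → T (R o) → T (R o′) → π (β o) ≡ π (β o′) → o ≡ o′
    injective o o′ Ro Ro′ eq with o F.≟ o′
    ... | yes o≡o′ = o≡o′
    ... | no  o≢o′ = ⊥-elim (overfull optimal (_== o) β valid-K (≤-trans touched≤1 (≤-trans (s≤s z≤n) 4≤s))
        (λ j t → subst (λ z → T (isO z)) (sym (==⇒≡ t)) (R⇒O o Ro))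
        (λ e Ke A → o , ≡⇒== refl , sym (at e Ke A) , λ x ρx≡o → ∨-left (Companion.full c x ρx≡o))
        o′ (R⇒O o′ Ro′) (λ t → o≢o′ (sym (==⇒≡ t))) (λ x ρx≡o′ → ∨-right {C o x} (Companion.full c′ x ρx≡o′)))
      where
      c = companion o Ro
      c′ = companion o′ Ro′
      K = C o ⊔ C o′
      either : ∀ e → T (K e) → T (isA (π e)) → e ≡ β o ⊎ e ≡ β o′
      either e Ke A = [ (λ t → inj₁ (Companion.only c e t A)) , (λ t → inj₂ (Companion.only c′ e t A)) ]′ (∨-elim {C o e} Ke)
      at : ∀ e → T (K e) → T (isA (π e)) → π e ≡ π (β o)
      at e Ke A = [ (λ p → cong π p) , (λ p → trans (cong π p) (sym eq)) ]′ (either e Ke A)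
      valid-K : Valid K
      valid-K = soft-valid (soft-⊔ (Companion.soft c) (Companion.soft c′))
        (λ i A m≡1 → <⇒≢ (few-hits (β o) (β o′) A (λ e Ke πe≡i → either e Ke (subst (λ z → T (isA z)) (sym πe≡i) A))) (sym m≡1))
      touched≤1 : touched K ≤ 1
      touched≤1 = #-≤1 _ (λ i i′ t t′ → trans (loc i t) (sym (loc i′ t′)))
        where
        loc : ∀ i → T (isA i ∧ does (1 ≤? hit K π i)) → i ≡ π (β o)
        loc i t with #-∃ (λ e → K e ∧ (π e == i)) (does-T (1 ≤? hit K π i) (∧-right {isA i} t))
        ... | e , u with ==⇒≡ {x = π e} (∧-right {K e} u)
        ... | refl = at e (∧-left u) (∧-left t)

    companions : Sub N
    companions e = does (any? (λ o → T? (R o ∧ C o e)))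

    U : Sub N
    U = F ⊔ companions

    C⊑U : ∀ o → T (R o) → C o ⊑ U
    C⊑U o Ro e Ce = ∨-right {F e} (T-does (any? (λ o → T? (R o ∧ C o e))) (o , ∧-intro Ro Ce))

    U-elim : ∀ e → T (U e) → T (F e) ⊎ (∃ λ o → T (R o) × T (C o e))
    U-elim e Ue with ∨-elim {F e} Ue
    ... | inj₁ Fe = inj₁ Fe
    ... | inj₂ t with does-T (any? (λ o → T? (R o ∧ C o e))) t
    ...   | o , u = inj₂ (o , ∧-left u , ∧-right {R o} u)

    U∩A : ∀ e → T (U e) → T (isA (π e)) → ∃ λ o → T (R o) × e ≡ β o
    U∩A e Ue A with U-elim e Ue
    ... | inj₁ Fe = ⊥-elim (avoids M e Fe A)
    ... | inj₂ (o , Ro , Ce) = o , Ro , Companion.only (companion o Ro) e Ce A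

    soft-U : Soft U
    soft-U = record { base = λ e → ∨-left ; no-hit-1 = onQ ; uniform = uni }
      where
      onQ : ∀ j → hit U ρ j ≢ 1
      onQ j eq with #-∃ (λ e → U e ∧ (ρ e == j)) (≤-reflexive (sym eq))
      ... | x , t with U-elim x (∧-left t)
      ...   | inj₁ Fx = no-hit-1 (valid M) j (≤-antisym (≤-trans (hit-mono (λ e _ → ∨-left)) (≤-reflexive eq))
                          (#-pos x (∧-intro Fx (∧-right {U x} t))))
      ...   | inj₂ (o , Ro , Cx) = Soft.no-hit-1 (Companion.soft (companion o Ro)) j
                          (≤-antisym (≤-trans (hit-mono (λ e _ → C⊑U o Ro e)) (≤-reflexive eq))
                          (#-pos x (∧-intro Cx (∧-right {U x} t))))
      uni : Uniform U
      uni i ¬A with miss U π i ≟ 0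
      ... | yes m≡0 = inj₂ (miss-zero m≡0)
      ... | no m≢0 = inj₁ λ e πe≡i Ue → [ (λ Fe → Fe) , (λ (o , Ro , Ce) →
              [ (λ none → none e πe≡i Ce) , (λ all → ⊥-elim (m≢0 (miss-full (λ x eq → C⊑U o Ro x (all x eq))))) ]′
              (Soft.uniform (Companion.soft (companion o Ro)) i ¬A)) ]′ (U-elim e Ue)

    -- Companions of distinct sets end in distinct members of A, so the union of all of them takes
    -- at most one element of each member and leaves three.
    valid-U : Valid U
    valid-U = soft-valid soft-U onA
      where
      onA : ∀ i → T (isA i) → miss U π i ≢ 1
      onA i A m≡1 with #-∃ (λ e → U e ∧ (π e == i)) (≤-trans (s≤s z≤n) (+-cancelʳ-≤ 1 3 (hit U π i)
              (≤-reflexive (trans (sym (A-size i A)) (trans (size-hit-miss U π i) (cong (λ z → hit U π i + z) m≡1))))))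
      ... | x , t = <⇒≢ (few-hits x x A (λ e Ue πe≡i → inj₁ (same e Ue πe≡i))) (sym m≡1)
        where
        πx≡i = ==⇒≡ (∧-right {U x} t)
        same : ∀ e → T (U e) → π e ≡ i → e ≡ x
        same e Ue πe≡i with U∩A e Ue (subst (λ z → T (isA z)) (sym πe≡i) A) | U∩A x (∧-left t) (subst (λ z → T (isA z)) (sym πx≡i) A)
        ... | o , Ro , e≡ | o′ , Ro′ , x≡ = trans e≡ (trans (cong β (injective o o′ Ro Ro′
                (trans (cong π (sym e≡)) (trans πe≡i (trans (sym πx≡i) (cong π x≡)))))) (sym x≡))

    avoids-U : Avoids (blocked R β) U
    avoids-U e Ue B with U∩A e Ue (∧-left B)
    ... | o , Ro , refl = not-elim {rooted R β (π e)} (∧-right {isA (π e)} B) (rooted-intro {R} {β} o Ro)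

    opaque

      extension : ∃ λ G → U ⊑ G × Maximal (blocked R β) G
      extension = extend (blocked R β) U valid-U avoids-U

    G : Sub N
    G = proj₁ extension

    U⊑G : U ⊑ G
    U⊑G = proj₁ (proj₂ extension)

    MG : Maximal (blocked R β) G
    MG = proj₂ (proj₂ extension)

    -- `G` may meet far too many members of A to contradict local optimality directly. A small
    -- exchange containing `o` is grown inside `G` instead: from `F`, the elements of `o` are
    -- inserted and then only what validity forces.
    module Repair (o : Fin b) (Oo : T (isO o)) (¬Ro : ¬ T (R o)) (o⊆G : ∀ e → ρ e ≡ o → T (G e)) where

      -- By `closed`, each member of A that `H` meets comes with the companion attached to it, so
      -- that in the end the member can be charged to a set of `R` inside `H`.
      record State (H : Sub N) : Set where
        field
          base   : F ⊑ H
          below  : H ⊑ G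
          closed : ∀ e o′ → T (H e) → T (R o′) → π (β o′) ≡ π e → C o′ ⊑ H

      -- The second summand is a debt and concerns all π-blocks: a block with one element left must
      -- give it up, and this insertion may later lead to a new member of A. In `μ` the set `o` is
      -- excepted because `rest` already pays for all its elements.
      κ : Sub N → Fin a → ℕ
      κ H i = ⟦ isA i ∧ does (1 ≤? hit H π i) ⟧ + ⟦ miss H π i ≈ᵇ 1 ⟧

      μ : Sub N → Fin b → ℕ
      μ H j = ⟦ (hit H ρ j ≈ᵇ 1) ∧ not (j == o) ⟧

      rest : Sub N → ℕ
      rest H = miss H ρ o

      -- Repairs do not increase this bound on the number of members of A met in the end.
      potential : Sub N → ℕ
      potential H = sum (κ H) + sum (μ H) + rest H

      κ-cong : ∀ {H H′ i} → (∀ e → π e ≡ i → T (H e) → T (H′ e)) → (∀ e → π e ≡ i → T (H′ e) → T (H e)) → κ H i ≡ κ H′ i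
      κ-cong {i = i} p q = cong₂ (λ x y → ⟦ isA i ∧ does (1 ≤? x) ⟧ + ⟦ y ≈ᵇ 1 ⟧) (hit-cong p q) (miss-cong p q)

      module Insert {H : Sub N} (st : State H) (x : Fin N) (¬Hx : ¬ T (H x)) (Gx : T (G x)) where
        open State st

        -- The companions attached at the π-block of `x` enter together with `x`, which preserves
        -- `closed`. Being soft, they create no new defect in blocks other than the two that contain
        -- `x`.
        extra : Sub N
        extra e = does (any? (λ o′ → T? (R o′ ∧ ((π (β o′) == π x) ∧ C o′ e))))

        extra-intro : ∀ o′ → T (R o′) → π (β o′) ≡ π x → C o′ ⊑ extra
        extra-intro o′ Ro′ eq e Ce = T-does (any? (λ o′ → T? (R o′ ∧ ((π (β o′) == π x) ∧ C o′ e)))) (o′ , ∧-intro Ro′ (∧-intro (≡⇒== eq) Ce))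

        extra-elim : ∀ e → T (extra e) → ∃ λ o′ → T (R o′) × π (β o′) ≡ π x × T (C o′ e)
        extra-elim e t with does-T (any? (λ o′ → T? (R o′ ∧ ((π (β o′) == π x) ∧ C o′ e)))) t
        ... | o′ , u = o′ , ∧-left u , ==⇒≡ (∧-left (∧-right {R o′} u)) , ∧-right {π (β o′) == π x} (∧-right {R o′} u)

        extra∩A : ∀ e → T (extra e) → T (isA (π e)) → ∃ λ o′ → T (R o′) × π (β o′) ≡ π x × e ≡ β o′
        extra∩A e t A with extra-elim e t
        ... | o′ , Ro′ , eq , Ce = o′ , Ro′ , eq , Companion.only (companion o′ Ro′) e Ce A

        H′ : Sub N
        H′ = (H ⊕ x) ⊔ extra

        H⊑H′ : H ⊑ H′
        H⊑H′ e He = ∨-left (∨-left He)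

        H′x : T (H′ x)
        H′x = ∨-left (⊕-self {F = H})

        elim : ∀ e → T (H′ e) → (T (H e) ⊎ e ≡ x) ⊎ T (extra e)
        elim e t with ∨-elim {(H ⊕ x) e} t
        ... | inj₂ u = inj₂ u
        ... | inj₁ u with ∨-elim {H e} u
        ...   | inj₁ He = inj₁ (inj₁ He)
        ...   | inj₂ v = inj₁ (inj₂ (==⇒≡ v))

        state′ : State H′
        state′ = record { base = λ e Fe → H⊑H′ e (base e Fe) ; below = below′ ; closed = closed′ }
          where
          below′ : H′ ⊑ G
          below′ e t with elim e t
          ... | inj₁ (inj₁ He)   = below e He
          ... | inj₁ (inj₂ refl) = Gx
          ... | inj₂ u with extra-elim e u
          ...   | o′ , Ro′ , _ , Ce = U⊑G e (C⊑U o′ Ro′ e Ce)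
          closed′ : ∀ e o′ → T (H′ e) → T (R o′) → π (β o′) ≡ π e → C o′ ⊑ H′
          closed′ e o′ t Ro′ eq y Cy with elim e t
          ... | inj₁ (inj₁ He)   = H⊑H′ y (closed e o′ He Ro′ eq y Cy)
          ... | inj₁ (inj₂ refl) = ∨-right {(H ⊕ x) y} (extra-intro o′ Ro′ eq y Cy)
          ... | inj₂ u with extra∩A e u (subst (λ z → T (isA z)) eq (β∈A o′ Ro′))
          ...   | o″ , Ro″ , eq″ , e≡ = ∨-right {(H ⊕ x) y} (extra-intro o′ Ro′ (trans eq (trans (cong π e≡) eq″)) y Cy)

        extra-no-hit-1 : ∀ j → hit extra ρ j ≢ 1
        extra-no-hit-1 j eq with #-∃ (λ e → extra e ∧ (ρ e == j)) (≤-reflexive (sym eq))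
        ... | y , t with extra-elim y (∧-left t)
        ...   | o′ , Ro′ , eq′ , Cy = Soft.no-hit-1 (Companion.soft (companion o′ Ro′)) j
                (≤-antisym (≤-trans (hit-mono (λ e _ → extra-intro o′ Ro′ eq′ e)) (≤-reflexive eq))
                           (#-pos y (∧-intro Cy (∧-right {extra y} t))))

        hit-elsewhere : ∀ j → j ≢ ρ x → hit H′ ρ j ≡ 1 → hit H ρ j ≡ 1
        hit-elsewhere j j≢ρx eq = trans (hit-cong (λ e _ → H⊑H′ e) back) eq
          where
          no-extra : ∀ e → ρ e ≡ j → ¬ T (extra e)
          no-extra e ρe≡j t = extra-no-hit-1 j (≤-antisym
            (≤-trans (hit-mono (λ y _ → ∨-right {(H ⊕ x) y})) (≤-reflexive eq)) (#-pos e (∧-intro t (≡⇒== ρe≡j))))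
          back : ∀ e → ρ e ≡ j → T (H′ e) → T (H e)
          back e ρe≡j t with elim e t
          ... | inj₁ (inj₁ He)   = He
          ... | inj₁ (inj₂ refl) = ⊥-elim (j≢ρx (sym ρe≡j))
          ... | inj₂ u = ⊥-elim (no-extra e ρe≡j u)

        μ-elsewhere : ∀ j → j ≢ ρ x → μ H′ j ≤ μ H j
        μ-elsewhere j j≢ρx = ⟦⟧-mono (λ t → ∧-intro (T-does (_ ≟ 1) (hit-elsewhere j j≢ρx (does-T (hit H′ ρ j ≟ 1) (∧-left t))))
                                                 (∧-right {hit H′ ρ j ≈ᵇ 1} t))

        μ-grow : ∀ j → μ H′ j ≤ μ H j + ⟦ j == ρ x ⟧
        μ-grow j with j F.≟ ρ x
        ... | no j≢ρx = ≤-trans (μ-elsewhere j j≢ρx) (m≤m+n _ _)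
        ... | yes refl rewrite ⟦⟧-T (≡⇒== {x = ρ x} refl) = ≤-trans (⟦⟧≤1 _) (m≤n+m 1 _)

        μ-shrink : hit H ρ (ρ x) ≡ 1 → ρ x ≢ o → ∀ j → μ H′ j + ⟦ j == ρ x ⟧ ≤ μ H j
        μ-shrink h≡1 ρx≢o j with j F.≟ ρ x
        ... | no j≢ρx rewrite ⟦⟧-¬T {j == ρ x} (λ t → j≢ρx (==⇒≡ t)) = ≤-trans (≤-reflexive (+-identityʳ _)) (μ-elsewhere j j≢ρx)
        ... | yes refl = ≤-trans (≤-reflexive (cong₂ _+_
                (⟦⟧-¬T {(hit H′ ρ j ≈ᵇ 1) ∧ not (j == o)} (λ t → <⇒≢ (≤-trans (s≤s (≤-reflexive (sym h≡1))) (hit-strict H⊑H′ x H′x ¬Hx))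
                    (sym (does-T (hit H′ ρ j ≟ 1) (∧-left t)))))
                (⟦⟧-T (≡⇒== {x = ρ x} refl))))
                (≤-reflexive (sym (⟦⟧-T {(hit H ρ j ≈ᵇ 1) ∧ not (j == o)} (∧-intro (T-does (_ ≟ 1) h≡1) (not-intro (λ t → ρx≢o (==⇒≡ t)))))))

        μ-same : ρ x ≡ o → ∀ j → μ H′ j ≤ μ H j
        μ-same ρx≡o j with j F.≟ ρ x
        ... | no j≢ρx = μ-elsewhere j j≢ρx
        ... | yes refl = ⟦⟧-mono (λ t → ⊥-elim (not-elim {ρ x == o} (∧-right {hit H′ ρ j ≈ᵇ 1} t) (≡⇒== ρx≡o)))

        κ-elsewhere : ∀ i → i ≢ π x → κ H′ i ≤ κ H i
        κ-elsewhere i i≢πx with T? (isA i)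
        ... | yes A = ≤-reflexive (κ-cong back (λ e _ → H⊑H′ e))
          where
          back : ∀ e → π e ≡ i → T (H′ e) → T (H e)
          back e refl t with elim e t
          ... | inj₁ (inj₁ He)   = He
          ... | inj₁ (inj₂ refl) = ⊥-elim (i≢πx refl)
          ... | inj₂ u with extra∩A e u A
          ...   | o′ , _ , eq , refl = ⊥-elim (i≢πx eq)
        ... | no ¬A with miss H′ π i ≟ 0
        ...   | yes m≡0 = ≤-trans (≤-reflexive (cong₂ _+_ (⟦⟧-¬T {isA i ∧ does (1 ≤? hit H′ π i)} (λ t → ¬A (∧-left t)))
                            (⟦⟧-¬T {miss H′ π i ≈ᵇ 1} (λ t → 0≢1+n (trans (sym m≡0) (does-T (_ ≟ 1) t)))))) z≤n
        ...   | no m≢0 = ≤-reflexive (κ-cong back (λ e _ → H⊑H′ e))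
          where
          back : ∀ e → π e ≡ i → T (H′ e) → T (H e)
          back e πe≡i t with elim e t
          ... | inj₁ (inj₁ He)   = He
          ... | inj₁ (inj₂ refl) = ⊥-elim (i≢πx (sym πe≡i))
          ... | inj₂ u with extra-elim e u
          ...   | o′ , Ro′ , eq , Ce with Soft.uniform (Companion.soft (companion o′ Ro′)) i ¬A
          ...     | inj₁ none = base e (none e πe≡i Ce)
          ...     | inj₂ all  = ⊥-elim (m≢0 (miss-full (λ y πy≡i → ∨-right {(H ⊕ x) y} (extra-intro o′ Ro′ eq y (all y πy≡i)))))

        -- Outside A only the second summand can rise. A member of A met before already counts in
        -- the first summand. A member newly met contains just `x` and its root from the new set, so
        -- two elements remain and the second summand is 0.
        κ-at-≤ : κ H′ (π x) ≤ suc (κ H (π x))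
        κ-at-≤ with T? (isA (π x))
        ... | no ¬A rewrite ⟦⟧-¬T {isA (π x) ∧ does (1 ≤? hit H′ π (π x))} (λ t → ¬A (∧-left t)) =
          ≤-trans (⟦⟧≤1 _) (s≤s z≤n)
        ... | yes A with 1 ≤? hit H π (π x)
        ...   | yes p = +-mono-≤ (⟦⟧≤1 (isA (π x) ∧ does (1 ≤? hit H′ π (π x)))) (≤-trans (⟦⟧≤1 (miss H′ π (π x) ≈ᵇ 1)) (≤-trans
                  (≤-reflexive (sym (⟦⟧-T {isA (π x) ∧ does (1 ≤? hit H π (π x))} (∧-intro A (T-does (1 ≤? _) p))))) (m≤m+n _ _)))
        ...   | no ¬p = ≤-trans (+-mono-≤ (⟦⟧≤1 _) (≤-reflexive (⟦⟧-¬T {miss H′ π (π x) ≈ᵇ 1}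
                  (λ t → <⇒≢ (few-hits (β (proj₁ root)) x A two) (sym (does-T (_ ≟ 1) t)))))) (s≤s z≤n)
          where
          root : ∃ λ o′ → T (R o′) × π (β o′) ≡ π x
          root = ¬blocked {R} {β} A (avoids MG x Gx)
          two : ∀ e → T (H′ e) → π e ≡ π x → e ≡ β (proj₁ root) ⊎ e ≡ x
          two e t πe≡πx with elim e t
          ... | inj₁ (inj₁ He)  = ⊥-elim (¬p (#-pos e (∧-intro He (≡⇒== πe≡πx))))
          ... | inj₁ (inj₂ e≡x) = inj₂ e≡x
          ... | inj₂ u with extra∩A e u (subst (λ z → T (isA z)) (sym πe≡πx) A)
          ...   | o′ , Ro′ , eq , e≡ = inj₁ (trans e≡ (cong β (injective o′ (proj₁ root) Ro′ (proj₁ (proj₂ root)) (trans eq (sym (proj₂ (proj₂ root)))))))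

        κ-grow : ∀ i → κ H′ i ≤ κ H i + ⟦ i == π x ⟧
        κ-grow i with i F.≟ π x
        ... | no i≢πx = ≤-trans (κ-elsewhere i i≢πx) (m≤m+n _ _)
        ... | yes refl rewrite ⟦⟧-T (≡⇒== {x = π x} refl) = ≤-trans κ-at-≤ (≤-reflexive (+-comm 1 _))

        -- The block of `x` becomes full, which clears its debt. If it is a member of A, three of
        -- its four elements were taken before, so it had been counted as met.
        κ-shrink : miss H π (π x) ≡ 1 → ∀ i → κ H′ i + ⟦ i == π x ⟧ ≤ κ H i
        κ-shrink m≡1 i with i F.≟ π x
        ... | no i≢πx rewrite ⟦⟧-¬T {i == π x} (λ t → i≢πx (==⇒≡ t)) = ≤-trans (≤-reflexive (+-identityʳ _)) (κ-elsewhere i i≢πx)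
        ... | yes refl = ≤-trans (≤-reflexive (trans (cong₂ (λ y z → (⟦ isA (π x) ∧ does (1 ≤? hit H′ π (π x)) ⟧ + y) + z)
                    (⟦⟧-¬T {miss H′ π (π x) ≈ᵇ 1} (λ t → 0≢1+n (trans (sym m′≡0) (does-T (_ ≟ 1) t)))) (⟦⟧-T (≡⇒== {x = π x} refl)))
                    (cong (λ z → z + 1) (+-identityʳ _))))
                  (+-mono-≤ (⟦⟧-mono touched-before) (≤-reflexive (sym (⟦⟧-T {miss H π (π x) ≈ᵇ 1} (T-does (_ ≟ 1) m≡1)))))
          where
          m′≡0 : miss H′ π (π x) ≡ 0
          m′≡0 = n<1⇒n≡0 (<-≤-trans (miss-strict H⊑H′ x H′x ¬Hx) (≤-reflexive m≡1))
          touched-before : T (isA (π x) ∧ does (1 ≤? hit H′ π (π x))) → T (isA (π x) ∧ does (1 ≤? hit H π (π x)))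
          touched-before t = ∧-intro (∧-left t) (T-does (1 ≤? _) (≤-trans (s≤s z≤n) (+-cancelʳ-≤ 1 3 (hit H π (π x))
            (≤-reflexive (trans (sym (A-size (π x) (∧-left t))) (trans (size-hit-miss H π (π x)) (cong (λ z → hit H π (π x) + z) m≡1)))))))

        grown : # H < # H′
        grown = ⊏-# H⊑H′ x H′x ¬Hx

        rest-≤ : rest H′ ≤ rest H
        rest-≤ = miss-anti (λ e _ → H⊑H′ e)

        rest-< : ρ x ≡ o → suc (rest H′) ≤ rest H
        rest-< refl = miss-strict H⊑H′ x H′x ¬Hx

      -- A unit of the potential moves in three ways: an element of `o` is inserted (`rest` to `κ`),
      -- a lone element of an O-block gets company (`μ` to `κ`), or the last element of a π-block
      -- follows the others (`κ` to `μ`).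
      shift₁ : ∀ {p p′ q q′ r r′} → p′ ≤ suc p → q′ ≤ q → suc r′ ≤ r → p′ + q′ + r′ ≤ p + q + r
      shift₁ {p} {p′} {q} {q′} {r} {r′} hp hq hr = ≤-trans (+-mono-≤ (+-mono-≤ hp hq) (≤-refl {r′}))
        (≤-trans (≤-reflexive (sym (+-suc (p + q) r′))) (+-monoʳ-≤ (p + q) hr))

      shift₂ : ∀ {p p′ q q′ r r′} → p′ ≤ suc p → suc q′ ≤ q → r′ ≤ r → p′ + q′ + r′ ≤ p + q + r
      shift₂ {p} {p′} {q} {q′} {r} {r′} hp hq hr = +-mono-≤ (≤-trans (+-monoˡ-≤ q′ hp)
        (≤-trans (≤-reflexive (sym (+-suc p q′))) (+-monoʳ-≤ p hq))) hr

      shift₃ : ∀ {p p′ q q′ r r′} → suc p′ ≤ p → q′ ≤ suc q → r′ ≤ r → p′ + q′ + r′ ≤ p + q + r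
      shift₃ {p} {p′} {q} {q′} {r} {r′} hp hq hr = +-mono-≤ (≤-trans (+-monoʳ-≤ p′ hq)
        (≤-trans (≤-reflexive (+-suc p′ q)) (+-monoˡ-≤ q hp))) hr

      repair : ∀ d H → N < d + # H → State H → potential H ≤ 4 → ⊥
      repair zero H fuel = no-fuel {F = H} fuel
      repair (suc d) H fuel st pot with any? (λ x → T? (not (H x) ∧ (ρ x == o)))
      ... | yes (x , t) = repair d H′ (burn {F = H} fuel grown) state′
              (≤-trans (shift₁ (∑-grow (π x) κ-grow) (∑-mono (μ-same ρx≡o)) (rest-< ρx≡o)) pot)
        where
        ρx≡o = ==⇒≡ (∧-right {not (H x)} t)
        open Insert st x (not-elim (∧-left t)) (o⊆G x ρx≡o)
      ... | no full with any? (λ j → T? ((hit H ρ j ≈ᵇ 1) ∧ not (j == o)))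
      ...   | yes (j , t) = onQ (#-find (λ e → H e ∧ (ρ e == j)) (λ e → G e ∧ (ρ e == j))
                (≤∧≢⇒< (hit-mono (λ e _ → State.below st e)) (λ eq → no-hit-1 (valid MG) j (trans (sym eq) h≡1))))
        where
        h≡1 = does-T (hit H ρ j ≟ 1) (∧-left t)
        onQ : (∃ λ x → T (G x ∧ (ρ x == j)) × ¬ T (H x ∧ (ρ x == j))) → ⊥
        onQ (x , u , v) with ==⇒≡ {x = ρ x} (∧-right {G x} u)
        ... | refl = repair d H′ (burn {F = H} fuel grown) state′
              (≤-trans (shift₂ {q = sum (μ H)} (∑-grow (π x) κ-grow) (∑-shrink (ρ x) (μ-shrink h≡1 (λ ρx≡o → not-elim {j == o} (∧-right {hit H ρ j ≈ᵇ 1} t) (≡⇒== ρx≡o)))) rest-≤) pot)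
          where
          open Insert st x (λ Hx → v (∧-intro Hx (≡⇒== refl))) (∧-left u)
      ...   | no ¬q with any? (λ i → miss H π i ≟ 1)
      ...     | yes (i , m≡1) = onP (#-∃ (λ e → not (H e) ∧ (π e == i)) (≤-reflexive (sym m≡1)))
        where
        onP : (∃ λ x → T (not (H x) ∧ (π x == i))) → ⊥
        onP (x , t) with ==⇒≡ {x = π x} (∧-right {not (H x)} t)
        ... | refl = repair d H′ (burn {F = H} fuel grown) state′
              (≤-trans (shift₃ {p = sum (κ H)} (∑-shrink (π x) (κ-shrink m≡1)) (∑-grow (ρ x) μ-grow) rest-≤) pot)
          where
          Gx : T (G x)
          Gx with T? (G x)
          ... | yes p = p
          ... | no ¬p = ⊥-elim (no-miss-1 (valid MG) i (≤-antisym
                  (≤-trans (miss-anti (λ e _ → State.below st e)) (≤-reflexive m≡1)) (miss-pos x ¬p)))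
          open Insert st x (not-elim (∧-left t)) Gx
      ...     | no ¬p = overfull optimal R β valid-H touched≤s R⇒O roots o Oo ¬Ro full′
        where
        full′ : ∀ e → ρ e ≡ o → T (H e)
        full′ e ρe≡o with T? (H e)
        ... | yes He = He
        ... | no ¬He = ⊥-elim (full (e , ∧-intro (not-intro ¬He) (≡⇒== ρe≡o)))
        valid-H : Valid H
        valid-H .no-miss-1 i eq = ¬p (i , eq)
        valid-H .no-hit-1 j eq with j F.≟ o
        ... | yes refl = <⇒≢ (ρ-size j) (sym (trans (sym (hit-full full′)) eq))
        ... | no j≢o = ¬q (j , ∧-intro (T-does (_ ≟ 1) eq) (not-intro (λ t → j≢o (==⇒≡ t))))
        touched≤s : touched H ≤ s
        touched≤s = ≤-trans (≤-trans (≤-trans (≤-reflexive (sym (sum-⟦⟧ _))) (∑-mono {g = κ H} (λ i → m≤m+n ⟦ isA i ∧ does (1 ≤? hit H π i) ⟧ _)))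
          (≤-trans (m≤m+n (sum (κ H)) (sum (μ H))) (≤-trans (m≤m+n _ (rest H)) pot))) 4≤s
        roots : ∀ e → T (H e) → T (isA (π e)) → ∃ λ o′ → T (R o′) × π (β o′) ≡ π e × (∀ y → ρ y ≡ o′ → T (H y))
        roots e He A with ¬blocked {R} {β} A (avoids MG e (State.below st e He))
        ... | o′ , Ro′ , eq = o′ , Ro′ , eq , λ y ρy≡o′ → State.closed st e o′ He Ro′ eq y (Companion.full (companion o′ Ro′) y ρy≡o′)

      impossible : ⊥
      -- `F` is valid and avoids A, so at the start only `rest F` contributes. It is at most the
      -- size 4 of `o`; this is where the parameter 4 comes from.
      impossible = repair (suc N) F (m≤m+n (suc N) (# F)) (record
          { base = λ _ t → t ; below = λ e Fe → U⊑G e (∨-left Fe)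
          ; closed = λ e o′ Fe Ro′ eq → ⊥-elim (avoids M e Fe (subst (λ z → T (isA z)) eq (β∈A o′ Ro′))) })
        (≤-trans (≤-reflexive (cong₂ (λ y z → y + z + rest F)
            (zero-sum (λ i → cong₂ _+_ (⟦⟧-¬T (λ t → untouched i t)) (⟦⟧-¬T (λ t → no-miss-1 (valid M) i (does-T (_ ≟ 1) t)))))
            (zero-sum (λ j → ⟦⟧-¬T (λ t → no-hit-1 (valid M) j (does-T (hit F ρ j ≟ 1) (∧-left t)))))))
          (≤-trans (#-mono (λ e → ∧-right {not (F e)})) (≤-reflexive (O-size o Oo))))
        where
        zero-sum : ∀ {n} {f : Fin n → ℕ} → (∀ i → f i ≡ 0) → sum f ≡ 0
        zero-sum {n} f≡0 = trans (sum-cong-≗ f≡0) (sum-replicate-zero n)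
        untouched : ∀ i → ¬ T (isA i ∧ does (1 ≤? hit F π i))
        untouched i t with #-∃ (λ e → F e ∧ (π e == i)) (does-T (1 ≤? hit F π i) (∧-right {isA i} t))
        ... | e , u with ==⇒≡ {x = π e} (∧-right {F e} u)
        ... | refl = avoids M e (∧-left u) (∧-left t)

  -- The number of sets in `R` enters the two bounds with coefficients 1 and -3; taking the first
  -- bound three times and the second once cancels it.
  four-set-bound : 7 * # isO ≤ 16 * # isA
  four-set-bound = +-cancelʳ-≤ (4 * # R) _ _ (begin
    7 * # isO + 4 * # R                       ≡⟨ split (# isO) (# R) ⟩
    3 * (2 * # isO) + (# isO + 4 * # R)       ≤⟨ +-mono-≤ (*-monoʳ-≤ 3 first) second ⟩
    3 * (4 * # isA + # R) + (4 * # isA + # R) ≡⟨ join (# isA) (# R) ⟩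
    16 * # isA + 4 * # R                      ∎)
    where
    open ≤-Reasoning
    split : ∀ o r → 7 * o + 4 * r ≡ 3 * (2 * o) + (o + 4 * r)
    split = solve-∀
    join : ∀ x r → 3 * (4 * x + r) + (4 * x + r) ≡ 16 * x + 4 * r
    join = solve-∀

    weight-F : ∀ j → 2 * ⟦ isO j ⟧ ≤ weight F j + ⟦ R j ⟧
    weight-F j with T? (isO j)
    ... | no ¬O rewrite ⟦⟧-¬T ¬O = z≤n
    ... | yes O rewrite ⟦⟧-T O = by-hit (hit F ρ j ≟ 0)
      where
      by-hit : Dec (hit F ρ j ≡ 0) → 2 ≤ weight F j + ⟦ R j ⟧
      by-hit (yes h≡0) = ≤-trans (≤-reflexive (sym (+-cancelʳ-≡ 2 (weight F j) 2 (weight-unhit {F} {j} h≡0 O)))) (m≤m+n _ _)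
      by-hit (no h≢0) = ≤-trans (by-miss (miss F ρ j ≟ 1)) (≤-reflexive (cong (λ z → z + ⟦ R j ⟧) (sym (weight-hit {F} {j} 1≤h))))
        where
        1≤h = n≢0⇒n>0 h≢0
        by-miss : Dec (miss F ρ j ≡ 1) → 2 ≤ miss F ρ j + ⟦ R j ⟧
        by-miss (yes m≡1) = ≤-reflexive (sym (cong₂ _+_ m≡1
          (⟦⟧-T {R j} (∧-intro O (∧-intro (T-does (1 ≤? hit F ρ j) 1≤h) (T-does (miss F ρ j ≟ 1) m≡1))))))
        by-miss (no m≢1) = ≤-trans (≤∧≢⇒< (n≢0⇒n>0 (F-not-full j O)) (λ eq → m≢1 (sym eq))) (m≤m+n _ _)

    first : 2 * # isO ≤ 4 * # isA + # R
    first = begin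
      2 * # isO                                ≡⟨ cong (λ z → 2 * z) (sym (sum-⟦⟧ isO)) ⟩
      2 * sum (λ j → ⟦ isO j ⟧)                ≡⟨ *-distribˡ-sum 2 (λ j → ⟦ isO j ⟧) ⟩
      sum (λ j → 2 * ⟦ isO j ⟧)                ≤⟨ ∑-mono weight-F ⟩
      sum (λ j → weight F j + ⟦ R j ⟧)         ≡⟨ trans (∑-distrib-+ (weight F) (λ j → ⟦ R j ⟧)) (cong (λ z → sum (weight F) + z) (sum-⟦⟧ R)) ⟩
      sum (weight F) + # R                     ≤⟨ +-monoˡ-≤ (# R) (≤-trans (∑-weight isA F M) (#-elements isA (λ _ t → t))) ⟩
      4 * # isA + # R                          ∎

    weight-G : ∀ j → ⟦ isO j ⟧ ≤ weight G j + ⟦ R j ⟧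
    weight-G j with T? (R j)
    ... | yes r rewrite ⟦⟧-T r = ≤-trans (⟦⟧≤1 (isO j)) (m≤n+m 1 _)
    ... | no ¬r with T? (isO j)
    ...   | no ¬O rewrite ⟦⟧-¬T ¬O = z≤n
    ...   | yes O rewrite ⟦⟧-T O = ≤-trans (positive (hit G ρ j ≟ 0)) (m≤m+n _ _)
      where
      positive : Dec (hit G ρ j ≡ 0) → 1 ≤ weight G j
      positive (yes h≡0) = ≤-trans (s≤s z≤n) (≤-reflexive (sym (+-cancelʳ-≡ 2 (weight G j) 2 (weight-unhit {G} {j} h≡0 O))))
      positive (no h≢0) = ≤-trans (n≢0⇒n>0 (λ m≡0 → Repair.impossible j O ¬r (miss-zero m≡0)))
                            (≤-reflexive (sym (weight-hit {G} {j} (n≢0⇒n>0 h≢0))))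

    second : # isO + 4 * # R ≤ 4 * # isA + # R
    second = begin
      # isO + 4 * # R                                       ≤⟨ +-monoˡ-≤ (4 * # R) count ⟩
      (# (λ e → blocked R β (π e)) + # R) + 4 * # R         ≡⟨ swap (# (λ e → blocked R β (π e))) (# R) ⟩
      (# (λ e → blocked R β (π e)) + 4 * # R) + # R         ≤⟨ +-monoˡ-≤ (# R) (#-blocked R β β∈A injective) ⟩
      4 * # isA + # R                                       ∎
      where
      swap : ∀ x r → (x + r) + 4 * r ≡ (x + 4 * r) + r
      swap = solve-∀
      count : # isO ≤ # (λ e → blocked R β (π e)) + # R
      count = begin
        # isO                                    ≡⟨ sym (sum-⟦⟧ isO) ⟩
        sum (λ j → ⟦ isO j ⟧)                    ≤⟨ ∑-mono weight-G ⟩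
        sum (λ j → weight G j + ⟦ R j ⟧)         ≡⟨ trans (∑-distrib-+ (weight G) (λ j → ⟦ R j ⟧)) (cong (λ z → sum (weight G) + z) (sum-⟦⟧ R)) ⟩
        sum (weight G) + # R                     ≤⟨ +-monoˡ-≤ (# R) (∑-weight (blocked R β) G MG) ⟩
        # (λ e → blocked R β (π e)) + # R        ∎

-- The case k ≥ 5

module ManySets {N a b : ℕ} (π : Fin N → Fin a) (ρ : Fin N → Fin b)
                (π-size : ∀ i → 2 ≤ size π i) (ρ-size : ∀ j → 2 ≤ size ρ j)
                (isA : Sub a) (isO : Sub b) (k s : ℕ)
                (A-size : ∀ i → T (isA i) → size π i ≡ k) (O-size : ∀ j → T (isO j) → size ρ j ≡ k)
                (5≤k : 5 ≤ k) (F : Sub N) (M : Exchange.Maximal π ρ π-size ρ-size isA F)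
                (optimal : Search.LocallyOptimal π ρ π-size ρ-size isA isO k s A-size O-size)
  where

  open Exchange π ρ π-size ρ-size
  open Valid
  open Maximal
  open Search π ρ π-size ρ-size isA isO k s A-size O-size
  open Walk π ρ π-size ρ-size isA F M

  private
    F-not-full : ∀ o → T (isO o) → miss F ρ o ≢ 0
    F-not-full o Oo m≡0 = overfull optimal (λ _ → false) (λ o′ → proj₁ (#-∃ (λ e → ρ e == o′) (≤-trans (s≤s z≤n) (ρ-size o′))))
      (valid M) (≤-trans (≤-reflexive (touched-none (avoids M))) z≤n) (λ _ ()) (λ e Fe A → ⊥-elim (avoids M e Fe A))
      o Oo (λ ()) (miss-zero m≡0)

    -- With at most two elements outside `F`, a member of O can be completed by two sets, one for
    -- each missing element. A member that is not near has weight at least 3 in `F`.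
    near : Sub b
    near o = does (1 ≤? hit F ρ o) ∧ does (miss F ρ o ≤? 2)

    thin thick : Sub b
    thin o  = isO o ∧ near o
    thick o = isO o ∧ not (near o)

    Root : Sub b → (Fin b → Fin N) → Fin N → Set
    Root R β e = ∃ λ o → T (R o) × e ≡ β o

    -- The allowance for one set: a single element of each member of A besides the root. It is
    -- chosen so that any two such sets can be united.
    Slim : Sub b → (Fin b → Fin N) → Sub N → Set
    Slim R β K = ∀ e e′ → T (K e) → T (K e′) → T (isA (π e)) → π e ≡ π e′ → ¬ Root R β e → ¬ Root R β e′ → e ≡ e′

    -- A branch is balanced in itself: each member of A that it meets is attached to some `o` for
    -- which all of `C o` lies in the branch.
    record Branch (R : Sub b) (β : Fin b → Fin N) (C : Fin b → Sub N) (t : ℕ) (K : Sub N) : Set where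
      field
        soft   : Soft K
        closed : ∀ e → T (K e) → T (isA (π e)) → ∃ λ o → T (R o) × π (β o) ≡ π e × C o ⊑ K
        slim   : Slim R β K
        few    : touched K ≤ t

    -- A forest attaches to each o ∈ R its own member π (β o) of A and a set C o making room
    -- for o, such that the members of A met by C o are attached to sets contained in C o.
    record Forest (t : ℕ) : Set where
      field
        R         : Sub b
        β         : Fin b → Fin N
        C         : Fin b → Sub N
        R⇒O       : ∀ o → T (R o) → T (isO o)
        β∈A       : ∀ o → T (R o) → T (isA (π (β o)))
        injective : ∀ o o′ → T (R o) → T (R o′) → π (β o) ≡ π (β o′) → o ≡ o′
        branch    : ∀ o → T (R o) → Branch R β C t (C o)
        full      : ∀ o → T (R o) → ∀ e → ρ e ≡ o → T (C o e)
        β∈C       : ∀ o → T (R o) → T (C o (β o))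
        own       : ∀ o → T (R o) → ∀ e → T (C o e) → π e ≡ π (β o) → e ≡ β o

    empty : Forest 0
    empty = record { R = λ _ → false ; β = λ o → proj₁ (#-∃ (λ e → ρ e == o) (≤-trans (s≤s z≤n) (ρ-size o)))
                   ; C = λ _ _ → false ; R⇒O = λ _ () ; β∈A = λ _ () ; injective = λ _ _ () ; branch = λ _ ()
                   ; full = λ _ () ; β∈C = λ _ () ; own = λ _ () }

    branch-F : ∀ {R β C t} → Branch R β C t F
    branch-F = record
      { soft = soft-F ; closed = λ e Fe A → ⊥-elim (avoids M e Fe A) ; slim = λ e e′ Fe _ A → ⊥-elim (avoids M e Fe A)
      ; few = ≤-trans (≤-reflexive (touched-none (avoids M))) z≤n }

    touched-arm : ∀ {B L} (A : Arm B L) → touched (Arm.K A) ≤ 1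
    touched-arm A = #-≤1 _ (λ i i′ t t′ → trans (loc i t) (sym (loc i′ t′)))
      where
      loc : ∀ i → T (isA i ∧ does (1 ≤? hit (Arm.K A) π i)) → i ≡ π (Arm.end A)
      loc i t with #-∃ (λ e → Arm.K A e ∧ (π e == i)) (does-T (1 ≤? hit (Arm.K A) π i) (∧-right {isA i} t))
      ... | e , u with ==⇒≡ {x = π e} (∧-right {Arm.K A e} u)
      ... | refl = cong π (Arm.only A e (∧-left u) (∧-left t))

    -- By injectivity a member of A has at most one root, so the union takes at most three of its
    -- elements, the root and one more for each set. At least k - 3 ≥ 2 elements remain.
    slim-valid : ∀ {R β K L} → (∀ o o′ → T (R o) → T (R o′) → π (β o) ≡ π (β o′) → o ≡ o′) →
                 Soft K → Slim R β K → Soft L → Slim R β L → Valid (K ⊔ L)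
    slim-valid {R} {β} {K} {L} injective softK slimK softL slimL = soft-valid (soft-⊔ softK softL) onA
      where
      root? : ∀ e → Dec (∃ λ o → T (R o ∧ (e == β o)))
      root? e = any? (λ o → T? (R o ∧ (e == β o)))
      root : Sub N
      root e = does (root? e)
      ¬root : ∀ e → ¬ T (root e) → ¬ Root R β e
      ¬root e ¬r (o , Ro , eq) = ¬r (T-does (root? e) (o , ∧-intro Ro (≡⇒== eq)))
      onA : ∀ i → T (isA i) → miss (K ⊔ L) π i ≢ 1
      onA i A m≡1 = <⇒≱ (s≤s 5≤k) (≤-trans (≤-reflexive (trans (cong suc (sym (A-size i A)))
          (cong suc (trans (size-hit-miss (K ⊔ L) π i) (cong (λ z → hit (K ⊔ L) π i + z) m≡1))))) (s≤s (+-monoˡ-≤ 1 hit≤3)))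
        where
        at : Sub N → Sub N
        at J e = not (root e) ∧ (J e ∧ (π e == i))
        at≤1 : ∀ {J} → Slim R β J → # (at J) ≤ 1
        at≤1 {J} slim = #-≤1 _ λ e e′ t t′ →
          let u = ∧-right {not (root e)} t
              u′ = ∧-right {not (root e′)} t′
              πe≡i = ==⇒≡ (∧-right {J e} u)
          in slim e e′ (∧-left u) (∧-left u′) (subst (λ z → T (isA z)) (sym πe≡i) A)
               (trans πe≡i (sym (==⇒≡ (∧-right {J e′} u′))))
               (¬root e (not-elim (∧-left t))) (¬root e′ (not-elim (∧-left t′)))
        roots≤1 : # (λ e → root e ∧ (π e == i)) ≤ 1
        roots≤1 = #-≤1 _ unique
          where
          unique : ∀ e e′ → T (root e ∧ (π e == i)) → T (root e′ ∧ (π e′ == i)) → e ≡ e′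
          unique e e′ t t′ with does-T (root? e) (∧-left t) | does-T (root? e′) (∧-left t′)
          ... | o , u | o′ , u′ with ==⇒≡ {x = e} (∧-right {R o} u) | ==⇒≡ {x = e′} (∧-right {R o′} u′)
          ... | refl | refl = cong β (injective o o′ (∧-left u) (∧-left u′)
                  (trans (==⇒≡ (∧-right {root e} t)) (sym (==⇒≡ (∧-right {root e′} t′)))))
        sub : ∀ e → T ((K ⊔ L) e ∧ (π e == i)) → T ((root e ∧ (π e == i)) ∨ (at K e ∨ at L e))
        sub e t with T? (root e)
        ... | yes r = ∨-left (∧-intro r (∧-right {(K ⊔ L) e} t))
        ... | no ¬r with ∨-elim {K e} (∧-left t)
        ...   | inj₁ Ke = ∨-right {root e ∧ (π e == i)} (∨-left {at K e} (∧-intro (not-intro ¬r) (∧-intro Ke (∧-right {(K ⊔ L) e} t))))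
        ...   | inj₂ Le = ∨-right {root e ∧ (π e == i)} (∨-right {at K e} (∧-intro (not-intro ¬r) (∧-intro Le (∧-right {(K ⊔ L) e} t))))
        hit≤3 : hit (K ⊔ L) π i ≤ 3
        hit≤3 = ≤-trans (#-mono sub) (≤-trans (#-∨ (λ e → root e ∧ (π e == i)) (λ e → at K e ∨ at L e))
          (+-mono-≤ roots≤1 (≤-trans (#-∨ (at K) (at L)) (+-mono-≤ (at≤1 slimK) (at≤1 slimL)))))

    thin-settled : ∀ o → T (thin o) → 1 ≤ hit F ρ o
    thin-settled o t = does-T (1 ≤? _) (∧-left (∧-right {isO o} t))

    -- `y` may coincide with `u`, so that one and two elements outside `F` are treated alike.
    thin-two : ∀ o → T (thin o) → ∀ u → ρ u ≡ o → ¬ T (F u) →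
               ∃ λ y → (ρ y ≡ o × ¬ T (F y)) × (∀ z → ρ z ≡ o → ¬ T (F z) → z ≡ u ⊎ z ≡ y)
    thin-two o t u ρu≡o ¬Fu with #-≤2 (λ e → not (F e) ∧ (ρ e == o))
        (does-T (_ ≤? 2) (∧-right {does (1 ≤? hit F ρ o)} (∧-right {isO o} t))) u (∧-intro (not-intro ¬Fu) (≡⇒== ρu≡o))
    ... | y , v , either = y , (==⇒≡ (∧-right {not (F y)} v) , not-elim (∧-left v)) ,
            λ z ρz≡o ¬Fz → either z (∧-intro (not-intro ¬Fz) (≡⇒== ρz≡o))

    -- The improvements to be excluded are unions of two sets that meet at most t + 1 members of A
    -- each; hence the room of 2(t + 1).
    module Grow {t : ℕ} (S : Forest t) (room : 2 * suc t ≤ s) where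
      open Forest S

      t+t+1≤s : suc t + suc t ≤ s
      t+t+1≤s = ≤-trans (≤-reflexive (cong (λ z → suc t + z) (sym (+-identityʳ (suc t))))) room

      -- Adding `C o′` pays for the member in which the arm ends. By `own`, `C o′` takes only the
      -- root of that member, so the end of the arm stays within the slim allowance, and by `β∈C` no
      -- further member is met.
      join : ∀ {B L o′} (A : Arm B L) → T (R o′) → π (β o′) ≡ π (Arm.end A) → Branch R β C t (Arm.K A ⊔ C o′)
      join {o′ = o′} A Ro′ eq = record { soft = soft-⊔ (Arm.soft A) (Branch.soft (branch o′ Ro′)) ; closed = closed′ ; slim = slim′ ; few = few′ }
        where
        H = Arm.K A
        closed′ : ∀ e → T ((H ⊔ C o′) e) → T (isA (π e)) → ∃ λ o → T (R o) × π (β o) ≡ π e × C o ⊑ (H ⊔ C o′)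
        closed′ e u Ae with ∨-elim {H e} u
        ... | inj₁ He = o′ , Ro′ , trans eq (cong π (sym (Arm.only A e He Ae))) , λ x → ∨-right {H x}
        ... | inj₂ Ce with Branch.closed (branch o′ Ro′) e Ce Ae
        ...   | o , Ro , eq′ , sub = o , Ro , eq′ , λ x Cx → ∨-right {H x} (sub x Cx)
        at-end : ∀ e → T ((H ⊔ C o′) e) → T (isA (π e)) → π e ≡ π (Arm.end A) → ¬ Root R β e → e ≡ Arm.end A
        at-end e u Ae πe≡ ¬r with ∨-elim {H e} u
        ... | inj₁ He = Arm.only A e He Ae
        ... | inj₂ Ce = ⊥-elim (¬r (o′ , Ro′ , own o′ Ro′ e Ce (trans πe≡ (sym eq))))
        slim′ : Slim R β (H ⊔ C o′)
        slim′ e e′ u u′ Ae πe≡πe′ ¬r ¬r′ with π e F.≟ π (Arm.end A)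
        ... | yes p = trans (at-end e u Ae p ¬r)
                (sym (at-end e′ u′ (subst (λ z → T (isA z)) πe≡πe′ Ae) (trans (sym πe≡πe′) p) ¬r′))
        ... | no ¬p = Branch.slim (branch o′ Ro′) e e′ (in-C e u Ae ¬p)
                (in-C e′ u′ (subst (λ z → T (isA z)) πe≡πe′ Ae) (λ p → ¬p (trans πe≡πe′ p))) Ae πe≡πe′ ¬r ¬r′
          where
          in-C : ∀ e → T ((H ⊔ C o′) e) → T (isA (π e)) → π e ≢ π (Arm.end A) → T (C o′ e)
          in-C e u Ae ¬p with ∨-elim {H e} u
          ... | inj₁ He = ⊥-elim (¬p (cong π (Arm.only A e He Ae)))
          ... | inj₂ Ce = Ce
        few′ : touched (H ⊔ C o′) ≤ t
        few′ = ≤-trans (touched-mono met) (Branch.few (branch o′ Ro′))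
          where
          met : ∀ e → T ((H ⊔ C o′) e) → T (isA (π e)) → 1 ≤ hit (C o′) π (π e)
          met e u Ae with ∨-elim {H e} u
          ... | inj₁ He = subst (λ z → 1 ≤ hit (C o′) π z) (trans eq (cong π (sym (Arm.only A e He Ae)))) (hit-pos (β o′) (β∈C o′ Ro′))
          ... | inj₂ Ce = hit-pos e Ce

      -- Two branches together are still balanced and, being slim, form a valid set. A set outside
      -- `R` contained in them would be the surplus that local optimality forbids.
      dead : ∀ {K L} → Branch R β C t K → Branch R β C t L → ∀ o → T (isO o) → ¬ T (R o) →
             ¬ (∀ e → ρ e ≡ o → T ((K ⊔ L) e))
      dead {K} {L} bK bL o Oo ¬Ro = overfull optimal R β
          (slim-valid injective (Branch.soft bK) (Branch.slim bK) (Branch.soft bL) (Branch.slim bL))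
          (≤-trans (touched-⊔ K L) (≤-trans (+-mono-≤ (≤-trans (Branch.few bK) (n≤1+n t)) (≤-trans (Branch.few bL) (n≤1+n t))) t+t+1≤s))
          R⇒O roots o Oo ¬Ro
        where
        roots : ∀ e → T ((K ⊔ L) e) → T (isA (π e)) → ∃ λ o → T (R o) × π (β o) ≡ π e × (∀ x → ρ x ≡ o → T ((K ⊔ L) x))
        roots e u A with ∨-elim {K e} u
        ... | inj₁ Ke with Branch.closed bK e Ke A
        ...   | o , Ro , eq , sub = o , Ro , eq , λ x ρx≡o → ∨-left (sub x (full o Ro x ρx≡o))
        roots e u A | inj₂ Le with Branch.closed bL e Le A
        ...   | o , Ro , eq , sub = o , Ro , eq , λ x ρx≡o → ∨-right {K x} (sub x (full o Ro x ρx≡o))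

      opaque

        extension : ∃ λ G → F ⊑ G × Maximal (blocked R β) G
        extension = extend (blocked R β) F (valid M) (λ e Fe B → avoids M e Fe (∧-left B))

      G : Sub N
      G = proj₁ extension

      F⊑G : F ⊑ G
      F⊑G = proj₁ (proj₂ extension)

      MG : Maximal (blocked R β) G
      MG = proj₂ (proj₂ extension)

      -- A walk confined to `G` can only end in an unblocked member of A. This member is attached to
      -- some `o′` in `R`, and `C o′` completes the arm to a branch.
      branch-in-G : ∀ o → T (thin o) → ∀ z → ρ z ≡ o → T (G z) → ∃ λ K → Branch R β C t K × T (K z)
      branch-in-G o th z ρz≡o Gz with T? (F z)
      ... | yes Fz = F , branch-F , Fz
      ... | no ¬Fz = _ , join A (proj₁ (proj₂ root)) (proj₂ (proj₂ root)) , ∨-left (Arm.above A z (⊕-self {F = F}))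
        where
        A : Arm G (F ⊕ z)
        A = arm (valid MG) F⊑G z ¬Fz Gz (subst (λ j → 1 ≤ hit F ρ j) (sym ρz≡o) (thin-settled o th))
        root : ∃ λ o′ → T (R o′) × π (β o′) ≡ π (Arm.end A)
        root = ¬blocked {R} {β} (Arm.end∈A A) (avoids MG (Arm.end A) (Arm.below A (Arm.end A) (Arm.end∈K A)))

      G-not-full : ∀ o → T (thin o) → ¬ T (R o) → miss G ρ o ≢ 0
      G-not-full o th ¬Ro m≡0 with #-∃ (λ e → not (F e) ∧ (ρ e == o)) (n≢0⇒n>0 (F-not-full o (∧-left th)))
      ... | u , v with ==⇒≡ {x = ρ u} (∧-right {not (F u)} v)
      ... | ρu≡o with thin-two o th u ρu≡o (not-elim (∧-left v))
      ... | y , (ρy≡o , ¬Fy) , either with branch-in-G o th u ρu≡o (miss-zero m≡0 u ρu≡o) | branch-in-G o th y ρy≡o (miss-zero m≡0 y ρy≡o)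
      ... | K , bK , Ku | L , bL , Ly = dead bK bL o (∧-left th) ¬Ro covered
        where
        covered : ∀ e → ρ e ≡ o → T ((K ⊔ L) e)
        covered e ρe≡o with T? (F e)
        ... | yes Fe = ∨-left (Soft.base (Branch.soft bK) e Fe)
        ... | no ¬Fe with either e ρe≡o ¬Fe
        ...   | inj₁ refl = ∨-left Ku
        ...   | inj₂ refl = ∨-right {K e} Ly

      record Fresh (o : Fin b) (x : Fin N) (K : Sub N) : Set where
        field
          soft   : Soft K
          full   : ∀ e → ρ e ≡ o → T (K e)
          x∈K    : T (K x)
          x∈A    : T (isA (π x))
          new    : ∀ o′ → T (R o′) → π (β o′) ≢ π x
          closed : ∀ e → T (K e) → T (isA (π e)) → π e ≢ π x → ∃ λ o′ → T (R o′) × π (β o′) ≡ π e × C o′ ⊑ K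
          at-x   : ∀ e → T (K e) → π e ≡ π x → e ≡ x
          slim   : Slim R β K
          few    : touched K ≤ suc t

      -- The thin sets outside `R` whose weight in `G` is only 1. They fall short of 2 and become
      -- the new sets of the forest.
      D : Sub b
      D o = thin o ∧ (not (R o) ∧ (miss G ρ o ≈ᵇ 1))

      -- The element of `o` outside `G` is reached by a free arm, the other missing element by a
      -- branch. If the arm ended in an attached member, it would extend to a branch as well, and
      -- two branches cannot cover `o`.
      fresh : ∀ o → T (D o) → ∃ λ x → ∃ λ K → Fresh o x K
      fresh o d = from-miss (#-∃ (λ e → not (G e) ∧ (ρ e == o)) (≤-reflexive (sym m≡1)))
        where
        th : T (thin o)
        th = ∧-left d
        ¬Ro : ¬ T (R o)
        ¬Ro = not-elim (∧-left (∧-right {thin o} d))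
        m≡1 : miss G ρ o ≡ 1
        m≡1 = does-T (_ ≟ 1) (∧-right {not (R o)} (∧-right {thin o} d))
        from-miss : (∃ λ u → T (not (G u) ∧ (ρ u == o))) → ∃ λ x → ∃ λ K → Fresh o x K
        from-miss (u , v) = Arm.end A , K₂ ⊔ H , record
            { soft = soft-⊔ (Branch.soft bK₂) (Arm.soft A) ; full = covered ; x∈K = ∨-right {K₂ (Arm.end A)} (Arm.end∈K A) ; x∈A = Arm.end∈A A
            ; new = new ; closed = closed ; at-x = at-x ; slim = slim
            ; few = ≤-trans (touched-⊔ K₂ H) (≤-trans (+-mono-≤ (Branch.few bK₂) (touched-arm A)) (≤-reflexive (+-comm t 1))) }
          where
          ρu≡o : ρ u ≡ o
          ρu≡o = ==⇒≡ (∧-right {not (G u)} v)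
          ¬Fu : ¬ T (F u)
          ¬Fu Fu = not-elim (∧-left v) (F⊑G u Fu)
          two = thin-two o th u ρu≡o ¬Fu
          y = proj₁ two
          A : Arm (λ _ → true) (F ⊕ u)
          A = arm valid-full (λ _ _ → tt) u ¬Fu tt (subst (λ j → 1 ≤ hit F ρ j) (sym ρu≡o) (thin-settled o th))
          H = Arm.K A
          other : ∃ λ K → Branch R β C t K × (T (K y) ⊎ y ≡ u)
          other with T? (G y)
          ... | yes Gy = let (K , bK , Ky) = branch-in-G o th y (proj₁ (proj₁ (proj₂ two))) Gy in K , bK , inj₁ Ky
          -- Both `y` and `u` lie outside `G`, which misses one element of `o`; so they coincide and
          -- `F` serves as the second set.
          ... | no ¬Gy = F , branch-F , inj₂ (#-unique _ (≤-reflexive m≡1) y u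
                  (∧-intro (not-intro ¬Gy) (≡⇒== (proj₁ (proj₁ (proj₂ two))))) v)
          K₂ = proj₁ other
          bK₂ : Branch R β C t K₂
          bK₂ = proj₁ (proj₂ other)
          Hu : T (H u)
          Hu = Arm.above A u (⊕-self {F = F})
          covered : ∀ e → ρ e ≡ o → T ((K₂ ⊔ H) e)
          covered e ρe≡o with T? (F e)
          ... | yes Fe = ∨-left (Soft.base (Branch.soft bK₂) e Fe)
          ... | no ¬Fe with proj₂ (proj₂ two) e ρe≡o ¬Fe
          ...   | inj₁ refl = ∨-right {K₂ e} Hu
          ...   | inj₂ refl with proj₂ (proj₂ other)
          ...     | inj₁ Ky  = ∨-left Ky
          ...     | inj₂ y≡u = ∨-right {K₂ e} (subst (λ z → T (H z)) (sym y≡u) Hu)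
          new : ∀ o′ → T (R o′) → π (β o′) ≢ π (Arm.end A)
          new o′ Ro′ eq = dead bK₂ (join A Ro′ eq) o (∧-left th) ¬Ro
            (λ e ρe≡o → [ ∨-left , (λ He → ∨-right {K₂ e} (∨-left He)) ]′ (∨-elim {K₂ e} (covered e ρe≡o)))
          closed : ∀ e → T ((K₂ ⊔ H) e) → T (isA (π e)) → π e ≢ π (Arm.end A) →
                   ∃ λ o′ → T (R o′) × π (β o′) ≡ π e × C o′ ⊑ (K₂ ⊔ H)
          closed e w Ae ¬p with ∨-elim {K₂ e} w
          ... | inj₂ He = ⊥-elim (¬p (cong π (Arm.only A e He Ae)))
          ... | inj₁ Ke with Branch.closed bK₂ e Ke Ae
          ...   | o′ , Ro′ , eq , sub = o′ , Ro′ , eq , λ z Cz → ∨-left (sub z Cz)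
          at-x : ∀ e → T ((K₂ ⊔ H) e) → π e ≡ π (Arm.end A) → e ≡ Arm.end A
          at-x e w eq with subst (λ z → T (isA z)) (sym eq) (Arm.end∈A A)
          ... | Ae with ∨-elim {K₂ e} w
          ...   | inj₂ He = Arm.only A e He Ae
          ...   | inj₁ Ke with Branch.closed bK₂ e Ke Ae
          ...     | o′ , Ro′ , eq′ , _ = ⊥-elim (new o′ Ro′ (trans eq′ eq))
          slim : Slim R β (K₂ ⊔ H)
          slim e e′ w w′ Ae πe≡πe′ ¬r ¬r′ with π e F.≟ π (Arm.end A)
          ... | yes p = trans (at-x e w p) (sym (at-x e′ w′ (trans (sym πe≡πe′) p)))
          ... | no ¬p = Branch.slim bK₂ e e′ (in-K₂ e w Ae ¬p)
                  (in-K₂ e′ w′ (subst (λ z → T (isA z)) πe≡πe′ Ae) (λ p → ¬p (trans πe≡πe′ p))) Ae πe≡πe′ ¬r ¬r′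
            where
            in-K₂ : ∀ e → T ((K₂ ⊔ H) e) → T (isA (π e)) → π e ≢ π (Arm.end A) → T (K₂ e)
            in-K₂ e w Ae ¬p with ∨-elim {K₂ e} w
            ... | inj₁ Ke = Ke
            ... | inj₂ He = ⊥-elim (¬p (cong π (Arm.only A e He Ae)))

      opaque

        pick : ∀ o → ∃ λ x → ∃ λ K → (T (R o) → x ≡ β o × K ≡ C o) × (¬ T (R o) → T (D o) → Fresh o x K)
        pick o with T? (R o) | T? (D o)
        ... | yes Ro | _     = β o , C o , (λ _ → refl , refl) , λ ¬Ro → ⊥-elim (¬Ro Ro)
        ... | no ¬Ro | no ¬d = β o , C o , (λ _ → refl , refl) , λ _ d → ⊥-elim (¬d d)
        ... | no ¬Ro | yes d = let (x , K , f) = fresh o d in x , K , (λ Ro → ⊥-elim (¬Ro Ro)) , λ _ _ → f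

      R′ : Sub b
      R′ o = R o ∨ D o

      β′ : Fin b → Fin N
      β′ o = proj₁ (pick o)

      C′ : Fin b → Sub N
      C′ o = proj₁ (proj₂ (pick o))

      β′-old : ∀ o → T (R o) → β′ o ≡ β o
      β′-old o Ro = proj₁ (proj₁ (proj₂ (proj₂ (pick o))) Ro)

      C′-old : ∀ o → T (R o) → C′ o ≡ C o
      C′-old o Ro = proj₂ (proj₁ (proj₂ (proj₂ (pick o))) Ro)

      origin : ∀ o → T (R′ o) → T (R o) ⊎ (¬ T (R o) × Fresh o (β′ o) (C′ o))
      origin o t with T? (R o)
      ... | yes Ro = inj₁ Ro
      ... | no ¬Ro with ∨-elim {R o} t
      ...   | inj₁ Ro = ⊥-elim (¬Ro Ro)
      ...   | inj₂ d = inj₂ (¬Ro , proj₂ (proj₂ (proj₂ (pick o))) ¬Ro d)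

      R′⇒O : ∀ o → T (R′ o) → T (isO o)
      R′⇒O o t with ∨-elim {R o} t
      ... | inj₁ Ro = R⇒O o Ro
      ... | inj₂ d  = ∧-left {isO o} (∧-left {thin o} d)

      slim-mono : ∀ {K} → Slim R β K → Slim R′ β′ K
      slim-mono slim e e′ u u′ Ae eq ¬r ¬r′ = slim e e′ u u′ Ae eq (lift ¬r) (lift ¬r′)
        where
        lift : ∀ {x} → ¬ Root R′ β′ x → ¬ Root R β x
        lift ¬r (o , Ro , eq) = ¬r (o , ∨-left Ro , trans eq (sym (β′-old o Ro)))

      transfer : ∀ {K e} → (∃ λ o → T (R o) × π (β o) ≡ π e × C o ⊑ K) → ∃ λ o → T (R′ o) × π (β′ o) ≡ π e × C′ o ⊑ K
      transfer {K} (o , Ro , eq , sub) = o , ∨-left Ro , trans (cong π (β′-old o Ro)) eq , subst (_⊑ K) (sym (C′-old o Ro)) sub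

      branch′ : ∀ o → T (R′ o) → Branch R′ β′ C′ (suc t) (C′ o)
      branch′ o r with origin o r
      ... | inj₁ Ro = subst (Branch R′ β′ C′ (suc t)) (sym (C′-old o Ro)) (record
          { soft = Branch.soft (branch o Ro)
          ; closed = λ e Ce A → transfer (Branch.closed (branch o Ro) e Ce A)
          ; slim = slim-mono (Branch.slim (branch o Ro))
          ; few = ≤-trans (Branch.few (branch o Ro)) (n≤1+n t) })
      ... | inj₂ (_ , f) = record { soft = Fresh.soft f ; closed = closed ; slim = slim-mono (Fresh.slim f) ; few = Fresh.few f }
        where
        closed : ∀ e → T (C′ o e) → T (isA (π e)) → ∃ λ o′ → T (R′ o′) × π (β′ o′) ≡ π e × C′ o′ ⊑ C′ o
        closed e Ce A with π e F.≟ π (β′ o)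
        ... | yes p = o , r , sym p , λ _ u → u
        ... | no ¬p = transfer (Fresh.closed f e Ce A ¬p)

      -- `R⁺` contains `o` but not `o′`: the common new member is charged to `o`, all others to `R`,
      -- and `o′` is the surplus. Slimness is taken relative to the old roots, where the new end
      -- counts as the one extra element.
      fresh-apart : ∀ o o′ → T (R′ o) → T (R′ o′) → ¬ T (R o′) → Fresh o (β′ o) (C′ o) → Fresh o′ (β′ o′) (C′ o′) →
                    π (β′ o) ≡ π (β′ o′) → o ≢ o′ → ⊥
      fresh-apart o o′ r r′ ¬Ro′ f f′ eq o≢o′ = overfull optimal R⁺ β′
          (slim-valid injective (Fresh.soft f) (Fresh.slim f) (Fresh.soft f′) (Fresh.slim f′))
          (≤-trans (touched-⊔ (C′ o) (C′ o′)) (≤-trans (+-mono-≤ (Fresh.few f) (Fresh.few f′)) t+t+1≤s))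
          (λ j u → [ R⇒O j , (λ p → subst (λ z → T (isO z)) (sym (==⇒≡ p)) (R′⇒O o r)) ]′ (∨-elim {R j} u)) roots
          o′ (R′⇒O o′ r′) (λ u → [ ¬Ro′ , (λ p → o≢o′ (sym (==⇒≡ p))) ]′ (∨-elim {R o′} u))
          (λ x ρx≡o′ → ∨-right {C′ o x} (Fresh.full f′ x ρx≡o′))
        where
        R⁺ : Sub b
        R⁺ j = R j ∨ (j == o)
        K = C′ o ⊔ C′ o′
        old : ∀ {e} → (∃ λ j → T (R j) × π (β j) ≡ π e × C j ⊑ K) → ∃ λ j → T (R⁺ j) × π (β′ j) ≡ π e × (∀ x → ρ x ≡ j → T (K x))
        old (j , Rj , eq , sub) = j , ∨-left Rj , trans (cong π (β′-old j Rj)) eq , λ x ρx≡j → sub x (full j Rj x ρx≡j)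
        roots : ∀ e → T (K e) → T (isA (π e)) → ∃ λ j → T (R⁺ j) × π (β′ j) ≡ π e × (∀ x → ρ x ≡ j → T (K x))
        roots e u A with π e F.≟ π (β′ o)
        ... | yes p = o , ∨-right {R o} (≡⇒== refl) , sym p , λ x ρx≡o → ∨-left (Fresh.full f x ρx≡o)
        ... | no ¬p with ∨-elim {C′ o e} u
        ...   | inj₁ Ce = let (j , Rj , eq′ , sub) = Fresh.closed f e Ce A ¬p in old (j , Rj , eq′ , λ x Cx → ∨-left (sub x Cx))
        ...   | inj₂ Ce = let (j , Rj , eq′ , sub) = Fresh.closed f′ e Ce A (λ p → ¬p (trans p (sym eq)))
                          in old (j , Rj , eq′ , λ x Cx → ∨-right {C′ o x} (sub x Cx))

      injective′ : ∀ o o′ → T (R′ o) → T (R′ o′) → π (β′ o) ≡ π (β′ o′) → o ≡ o′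
      injective′ o o′ r r′ eq with origin o r | origin o′ r′
      ... | inj₁ Ro | inj₁ Ro′ = injective o o′ Ro Ro′ (trans (cong π (sym (β′-old o Ro))) (trans eq (cong π (β′-old o′ Ro′))))
      ... | inj₁ Ro | inj₂ (_ , f′) = ⊥-elim (Fresh.new f′ o Ro (trans (cong π (sym (β′-old o Ro))) eq))
      ... | inj₂ (_ , f) | inj₁ Ro′ = ⊥-elim (Fresh.new f o′ Ro′ (trans (cong π (sym (β′-old o′ Ro′))) (sym eq)))
      ... | inj₂ (_ , f) | inj₂ (¬Ro′ , f′) with o F.≟ o′
      ...   | yes o≡o′ = o≡o′
      ...   | no o≢o′ = ⊥-elim (fresh-apart o o′ r r′ ¬Ro′ f f′ eq o≢o′)

      next : Forest (suc t)
      next = record { R = R′ ; β = β′ ; C = C′ ; R⇒O = R′⇒O ; β∈A = β∈A′ ; injective = injective′ ; branch = branch′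
                    ; full = full′ ; β∈C = β∈C′ ; own = own′ }
        where
        β∈A′ : ∀ o → T (R′ o) → T (isA (π (β′ o)))
        β∈A′ o r with origin o r
        ... | inj₁ Ro = subst (λ z → T (isA (π z))) (sym (β′-old o Ro)) (β∈A o Ro)
        ... | inj₂ (_ , f) = Fresh.x∈A f
        full′ : ∀ o → T (R′ o) → ∀ e → ρ e ≡ o → T (C′ o e)
        full′ o r e ρe≡o with origin o r
        ... | inj₁ Ro = subst (λ K → T (K e)) (sym (C′-old o Ro)) (full o Ro e ρe≡o)
        ... | inj₂ (_ , f) = Fresh.full f e ρe≡o
        β∈C′ : ∀ o → T (R′ o) → T (C′ o (β′ o))
        β∈C′ o r with origin o r
        ... | inj₁ Ro = subst₂ (λ K z → T (K z)) (sym (C′-old o Ro)) (sym (β′-old o Ro)) (β∈C o Ro)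
        ... | inj₂ (_ , f) = Fresh.x∈K f
        own′ : ∀ o → T (R′ o) → ∀ e → T (C′ o e) → π e ≡ π (β′ o) → e ≡ β′ o
        own′ o r e Ce eq with origin o r
        ... | inj₁ Ro = trans (own o Ro e (subst (λ K → T (K e)) (C′-old o Ro) Ce) (trans eq (cong π (β′-old o Ro)))) (sym (β′-old o Ro))
        ... | inj₂ (_ , f) = Fresh.at-x f e Ce eq

      thin-hit-G : ∀ j → T (thin j) → 1 ≤ hit G ρ j
      thin-hit-G j th = ≤-trans (thin-settled j th) (hit-mono (λ e _ → F⊑G e))

      thin-weight : ∀ j → T (thin j) → ¬ T (R j) → 2 ≤ weight G j + ⟦ R′ j ⟧
      thin-weight j th ¬Rj = ≤-trans (by-miss (miss G ρ j ≟ 1)) (≤-reflexive (cong (λ z → z + ⟦ R′ j ⟧) (sym (weight-hit {G} {j} (thin-hit-G j th)))))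
        where
        by-miss : Dec (miss G ρ j ≡ 1) → 2 ≤ miss G ρ j + ⟦ R′ j ⟧
        by-miss (yes m≡1) = ≤-reflexive (sym (cong₂ _+_ m≡1 (⟦⟧-T {R′ j}
          (∨-right {R j} (∧-intro th (∧-intro (not-intro ¬Rj) (T-does (miss G ρ j ≟ 1) m≡1)))))))
        by-miss (no m≢1) = ≤-trans (≤∧≢⇒< (n≢0⇒n>0 (G-not-full j th ¬Rj)) (λ eq → m≢1 (sym eq))) (m≤m+n _ _)

      -- A set of `R` is counted in both `R` and `R′`, a thick set twice, and a thin set of weight 1
      -- once through `R′`; every other set has weight at least 2 by itself. Each root lowers the
      -- number of blocked elements by `k`.
      growth : 2 * # isO + k * # R ≤ k * # isA + (2 * # thick + (# R + # R′))
      growth = begin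
        2 * # isO + k * # R                                              ≤⟨ +-monoˡ-≤ (k * # R) count ⟩
        (# (λ e → blocked R β (π e)) + (2 * # thick + (# R + # R′))) + k * # R
                                                                         ≡⟨ swap (# (λ e → blocked R β (π e))) (2 * # thick + (# R + # R′)) (k * # R) ⟩
        (# (λ e → blocked R β (π e)) + k * # R) + (2 * # thick + (# R + # R′))
                                                                         ≤⟨ +-monoˡ-≤ _ (#-blocked R β β∈A injective) ⟩
        k * # isA + (2 * # thick + (# R + # R′))                         ∎
        where
        open ≤-Reasoning
        swap : ∀ x y z → (x + y) + z ≡ (x + z) + y
        swap = solve-∀
        pointwise : ∀ j → 2 * ⟦ isO j ⟧ ≤ weight G j + (2 * ⟦ thick j ⟧ + (⟦ R j ⟧ + ⟦ R′ j ⟧))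
        pointwise j with T? (isO j)
        ... | no ¬O rewrite ⟦⟧-¬T ¬O = z≤n
        ... | yes O with T? (near j)
        ...   | no ¬n rewrite ⟦⟧-T O = ≤-trans (≤-reflexive (cong (λ z → 2 * z) (sym (⟦⟧-T {thick j} (∧-intro O (not-intro ¬n))))))
                  (≤-trans (m≤m+n (2 * ⟦ thick j ⟧) (⟦ R j ⟧ + ⟦ R′ j ⟧)) (m≤n+m _ (weight G j)))
        ...   | yes n with T? (R j)
        ...     | yes r = ≤-trans (*-monoʳ-≤ 2 (⟦⟧≤1 (isO j))) (≤-trans (≤-reflexive (sym (cong₂ _+_ (⟦⟧-T {R j} r) (⟦⟧-T {R′ j} (∨-left r)))))
                    (≤-trans (m≤n+m (⟦ R j ⟧ + ⟦ R′ j ⟧) (2 * ⟦ thick j ⟧)) (m≤n+m _ (weight G j))))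
        ...     | no ¬r = ≤-trans (*-monoʳ-≤ 2 (⟦⟧≤1 (isO j))) (≤-trans (thin-weight j (∧-intro O n) ¬r)
                    (+-monoʳ-≤ (weight G j) (≤-trans (m≤n+m ⟦ R′ j ⟧ ⟦ R j ⟧) (m≤n+m _ (2 * ⟦ thick j ⟧)))))
        count : 2 * # isO ≤ # (λ e → blocked R β (π e)) + (2 * # thick + (# R + # R′))
        count = begin
          2 * # isO                                ≡⟨ cong (λ z → 2 * z) (sym (sum-⟦⟧ isO)) ⟩
          2 * sum (λ j → ⟦ isO j ⟧)                ≡⟨ *-distribˡ-sum 2 (λ j → ⟦ isO j ⟧) ⟩
          sum (λ j → 2 * ⟦ isO j ⟧)                ≤⟨ ∑-mono pointwise ⟩
          sum (λ j → weight G j + (2 * ⟦ thick j ⟧ + (⟦ R j ⟧ + ⟦ R′ j ⟧)))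
            ≡⟨ trans (∑-distrib-+ (weight G) (λ j → 2 * ⟦ thick j ⟧ + (⟦ R j ⟧ + ⟦ R′ j ⟧))) (cong (λ z → sum (weight G) + z)
                 (trans (∑-distrib-+ (λ j → 2 * ⟦ thick j ⟧) (λ j → ⟦ R j ⟧ + ⟦ R′ j ⟧)) (cong₂ _+_
                   (trans (sym (*-distribˡ-sum 2 (λ j → ⟦ thick j ⟧))) (cong (λ z → 2 * z) (sum-⟦⟧ thick)))
                   (trans (∑-distrib-+ (λ j → ⟦ R j ⟧) (λ j → ⟦ R′ j ⟧)) (cong₂ _+_ (sum-⟦⟧ R) (sum-⟦⟧ R′)))))) ⟩
          sum (weight G) + (2 * # thick + (# R + # R′)) ≤⟨ +-monoˡ-≤ _ (∑-weight (blocked R β) G MG) ⟩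
          # (λ e → blocked R β (π e)) + (2 * # thick + (# R + # R′)) ∎

      -- Without roots `G` equals `F`, where thick sets weigh at least 3: k - 2 if disjoint from
      -- `F`, and otherwise their more than two elements outside `F`. Their surplus over 2 is what
      -- bounds their number.
      start : (∀ o → ¬ T (R o)) → 2 * # isO + # thick ≤ k * # isA + # R′
      start ¬R = begin
        2 * # isO + # thick                                ≡⟨ cong₂ (λ x y → 2 * x + y) (sym (sum-⟦⟧ isO)) (sym (sum-⟦⟧ thick)) ⟩
        2 * sum (λ j → ⟦ isO j ⟧) + sum (λ j → ⟦ thick j ⟧) ≡⟨ cong (λ z → z + sum (λ j → ⟦ thick j ⟧)) (*-distribˡ-sum 2 (λ j → ⟦ isO j ⟧)) ⟩
        sum (λ j → 2 * ⟦ isO j ⟧) + sum (λ j → ⟦ thick j ⟧) ≡⟨ sym (∑-distrib-+ (λ j → 2 * ⟦ isO j ⟧) (λ j → ⟦ thick j ⟧)) ⟩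
        sum (λ j → 2 * ⟦ isO j ⟧ + ⟦ thick j ⟧)            ≤⟨ ∑-mono pointwise ⟩
        sum (λ j → weight G j + ⟦ R′ j ⟧)                  ≡⟨ trans (∑-distrib-+ (weight G) (λ j → ⟦ R′ j ⟧)) (cong (λ z → sum (weight G) + z) (sum-⟦⟧ R′)) ⟩
        sum (weight G) + # R′                              ≤⟨ +-monoˡ-≤ (# R′) (≤-trans (∑-weight (blocked R β) G MG) (#-elements (blocked R β) (λ i → ∧-left))) ⟩
        k * # (blocked R β) + # R′                         ≤⟨ +-monoˡ-≤ (# R′) (*-monoʳ-≤ k (#-mono (λ i → ∧-left))) ⟩
        k * # isA + # R′                                   ∎
        where
        open ≤-Reasoning
        G⊑F : G ⊑ F
        G⊑F = maximal M G (valid MG) (λ e Ge A → let (o , Ro , _) = ¬blocked {R} {β} A (avoids MG e Ge) in ¬R o Ro) F⊑G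
        far : ∀ j → T (isO j) → ¬ T (near j) → 3 ≤ weight G j
        far j O ¬n = by-hit (hit G ρ j ≟ 0)
          where
          by-hit : Dec (hit G ρ j ≡ 0) → 3 ≤ weight G j
          by-hit (yes h≡0) = +-cancelʳ-≤ 2 3 (weight G j) (≤-trans 5≤k (≤-reflexive (sym (weight-unhit {G} {j} h≡0 O))))
          by-hit (no h≢0) = ≤-trans (≰⇒> (λ m≤2 → ¬n (∧-intro (T-does (1 ≤? hit F ρ j) (≤-trans (n≢0⇒n>0 h≢0) (hit-mono (λ e _ → G⊑F e))))
                                                    (T-does (miss F ρ j ≤? 2) m≤2))))
            (≤-trans (miss-anti (λ e _ → G⊑F e)) (≤-reflexive (sym (weight-hit {G} {j} (n≢0⇒n>0 h≢0)))))
        pointwise : ∀ j → 2 * ⟦ isO j ⟧ + ⟦ thick j ⟧ ≤ weight G j + ⟦ R′ j ⟧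
        pointwise j with T? (isO j)
        ... | no ¬O = ≤-trans (≤-reflexive (cong₂ (λ x y → 2 * x + y) (⟦⟧-¬T ¬O) (⟦⟧-¬T {thick j} (λ t → ¬O (∧-left t))))) z≤n
        ... | yes O with T? (near j)
        ...   | no ¬n = ≤-trans (+-mono-≤ (*-monoʳ-≤ 2 (⟦⟧≤1 (isO j))) (⟦⟧≤1 (thick j))) (≤-trans (far j O ¬n) (m≤m+n _ _))
        ...   | yes n = ≤-trans (+-mono-≤ (*-monoʳ-≤ 2 (⟦⟧≤1 (isO j))) (≤-reflexive (⟦⟧-¬T {thick j} (λ t → not-elim {near j} (∧-right {isO j} t) n))))
                          (thin-weight j (∧-intro O n) (¬R j))

    X = 2 * # isO
    Y = k * # isA

    -- Let δ = X - Y > 0, and let r and r′ be the sizes of `R` before and after a round. Then r′ ≥ δ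
    -- + (k - 1)r - 2|thick| by `growth`, and |thick| ≤ c - δ with c ≤ r, so `R` gains at least δ
    -- per round. The number `c` is the size of `R` after the first round; it is carried along
    -- because the bound on the thick sets comes from that round.
    forests : ∀ i → 2 * suc i ≤ s → ∃ λ (S : Forest (suc i)) → ∃ λ c →
              X + # thick ≤ Y + c × c ≤ # (Forest.R S) × suc i * X ≤ suc i * Y + # (Forest.R S)
    forests zero room = next , # R′ , start (λ _ ()) , ≤-refl ,
        ≤-trans (≤-reflexive (+-identityʳ X)) (≤-trans (m≤m+n X (# thick)) (≤-trans (start (λ _ ())) (≤-reflexive (cong (λ z → z + # R′) (sym (+-identityʳ Y))))))
      where open Grow empty room
    forests (suc i) room with forests i (≤-trans (*-monoʳ-≤ 2 (n≤1+n (suc i))) room)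
    ... | S , c , X+t≤Y+c , c≤r , bound = next , c , X+t≤Y+c , ≤-trans c≤r (#-mono (λ o → ∨-left)) , bound′ (≤-total X Y)
      where
      open Grow S room
      open ≤-Reasoning
      r = # (Forest.R S)
      r′ = # R′
      th = # thick
      bound′ : X ≤ Y ⊎ Y ≤ X → suc (suc i) * X ≤ suc (suc i) * Y + r′
      bound′ (inj₁ X≤Y) = ≤-trans (*-monoʳ-≤ (suc (suc i)) X≤Y) (m≤m+n _ r′)
      -- Two copies of the bound on the thick sets cancel the term 2|thick| of `growth`; the two
      -- extra copies of X - Y that they bring are dropped by means of `Y≤X`.
      bound′ (inj₂ Y≤X) = +-cancelʳ-≤ (2 * Y + (5 * r + 2 * th)) _ _ (begin
        suc (suc i) * X + (2 * Y + (5 * r + 2 * th))             ≤⟨ +-monoʳ-≤ (suc (suc i) * X) (+-monoˡ-≤ _ (*-monoʳ-≤ 2 Y≤X)) ⟩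
        suc (suc i) * X + (2 * X + (5 * r + 2 * th))             ≡⟨ gather i X r th ⟩
        (suc i * X + 2 * (X + th)) + (X + 5 * r)                 ≤⟨ +-mono-≤ (+-mono-≤ bound (*-monoʳ-≤ 2 (≤-trans X+t≤Y+c (+-monoʳ-≤ Y c≤r))))
                                                                     (≤-trans (+-monoʳ-≤ X (*-monoˡ-≤ r 5≤k)) growth) ⟩
        ((suc i * Y + r) + 2 * (Y + r)) + (Y + (2 * th + (r + r′))) ≤⟨ m≤m+n _ r ⟩
        ((suc i * Y + r) + 2 * (Y + r)) + (Y + (2 * th + (r + r′))) + r ≡⟨ spread i Y r th r′ ⟩
        suc (suc i) * Y + r′ + (2 * Y + (5 * r + 2 * th))        ∎)
        where
        gather : ∀ i x r h → suc (suc i) * x + (2 * x + (5 * r + 2 * h)) ≡ (suc i * x + 2 * (x + h)) + (x + 5 * r)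
        gather = solve-∀
        spread : ∀ i y r h q → ((suc i * y + r) + 2 * (y + r)) + (y + (2 * h + (r + q))) + r ≡ suc (suc i) * y + q + (2 * y + (5 * r + 2 * h))
        spread = solve-∀

    halves : ∀ n → 2 ≤ n → ∃ λ i → 2 * suc i ≤ n × n ≤ suc (2 * suc i)
    halves (suc zero) (s≤s ())
    halves (suc (suc zero)) _ = 0 , ≤-refl , n≤1+n 2
    halves (suc (suc (suc zero))) _ = 0 , n≤1+n 2 , ≤-refl
    halves (suc (suc n@(suc (suc _)))) _ with halves n (s≤s (s≤s z≤n))
    ... | i , lo , hi = suc i , ≤-trans (≤-reflexive (double i)) (s≤s (s≤s lo)) , ≤-trans (s≤s (s≤s hi)) (≤-reflexive (cong suc (sym (double i))))
      where
      double : ∀ i → 2 * suc (suc i) ≡ suc (suc (2 * suc i))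
      double = solve-∀

  -- For s ≥ 2 and X > Y there are ⌊s/2⌋ rounds, after which ⌊s/2⌋(X - Y) ≤ |R|. Distinct sets of
  -- `R` have distinct members of A attached, so k|R| ≤ Y; with k ≥ 5 and s ≤ 1 + 5⌊s/2⌋ this
  -- becomes s(X - Y) ≤ X.
  many-set-bound : s * (2 * # isO) ≤ s * (k * # isA) + 2 * # isO
  many-set-bound with 2 ≤? s
  ... | no s<2 = ≤-trans (*-monoˡ-≤ X (≤-pred (≰⇒> s<2))) (≤-trans (≤-reflexive (*-identityˡ X)) (m≤n+m X (s * Y)))
  ... | yes 2≤s with ≤-total X Y | halves s 2≤s
  ...   | inj₁ X≤Y | _ = ≤-trans (*-monoʳ-≤ s X≤Y) (m≤m+n _ X)
  ...   | inj₂ Y≤X | i , lo , hi with forests i lo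
  ...     | S , _ , _ , _ , bound = subst (λ z → s * z ≤ s * Y + z) (m+[n∸m]≡n Y≤X) (begin
    s * (Y + δ)                          ≡⟨ *-distribˡ-+ s Y δ ⟩
    s * Y + s * δ                        ≤⟨ +-monoʳ-≤ (s * Y) (*-monoˡ-≤ δ (≤-trans hi (s≤s (*-monoˡ-≤ (suc i) {2} {5} (s≤s (s≤s z≤n)))))) ⟩
    s * Y + (δ + (5 * suc i) * δ)        ≡⟨ cong (λ z → s * Y + (δ + z)) (*-assoc 5 (suc i) δ) ⟩
    s * Y + (δ + 5 * (suc i * δ))        ≤⟨ +-monoʳ-≤ (s * Y) (+-monoʳ-≤ δ (≤-trans (*-monoʳ-≤ 5 excess) (≤-trans (*-monoˡ-≤ (# R) 5≤k) R≤A))) ⟩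
    s * Y + (δ + Y)                      ≡⟨ cong (λ z → s * Y + z) (+-comm δ Y) ⟩
    s * Y + (Y + δ)                      ∎)
    where
    open ≤-Reasoning
    open Forest S
    δ = X ∸ Y
    excess : suc i * δ ≤ # R
    excess = +-cancelˡ-≤ (suc i * Y) _ _ (≤-trans (≤-reflexive (trans (sym (*-distribˡ-+ (suc i) Y δ)) (cong (λ z → suc i * z) (m+[n∸m]≡n Y≤X)))) bound)
    R≤A : k * # R ≤ Y
    R≤A = ≤-trans (m≤n+m _ _) (#-blocked R β β∈A injective)
-- Collections of subsets

elem : ∀ {n} → Subset n → Sub n
elem X x = lookup X x

∈⇒T : ∀ {n} {x : Fin n} {X : Subset n} → x ∈ X → T (elem X x)
∈⇒T x∈X = subst T (sym ([]=⇒lookup x∈X)) tt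

T⇒∈ : ∀ {n} {x : Fin n} {X : Subset n} → T (elem X x) → x ∈ X
T⇒∈ {x = x} {X} t = lookup⇒[]= x X (T⇒≡ t)
  where
  T⇒≡ : ∀ {b} → T b → b ≡ true
  T⇒≡ {true} _ = refl

∈-tab⁺ : ∀ {n} (p : Sub n) {x} → T (p x) → x ∈ tabulate p
∈-tab⁺ p {x} t = T⇒∈ (subst T (sym (lookup∘tabulate p x)) t)

∈-tab⁻ : ∀ {n} (p : Sub n) {x} → x ∈ tabulate p → T (p x)
∈-tab⁻ p {x} x∈ = subst T (lookup∘tabulate p x) (∈⇒T x∈)

opaque
  unfolding #

  ∣∣≡# : ∀ {n} (X : Subset n) → ∣ X ∣ ≡ # (elem X)
  ∣∣≡# V.[] = refl
  ∣∣≡# (true  V.∷ X) = cong suc (∣∣≡# X)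
  ∣∣≡# (false V.∷ X) = ∣∣≡# X

  #-⊎ : ∀ {n d} (p : Sub (n + d)) → # p ≡ # (λ x → p (x F.↑ˡ d)) + # (λ y → p (n F.↑ʳ y))
  #-⊎ {zero}  p = refl
  #-⊎ {suc n} {d} p = trans (cong (λ z → ⟦ p zero ⟧ + z) (#-⊎ {n} {d} (λ e → p (suc e)))) (sym (+-assoc ⟦ p zero ⟧ _ _))

∣tabulate∣ : ∀ {n} (p : Sub n) → ∣ tabulate p ∣ ≡ # p
∣tabulate∣ p = trans (∣∣≡# (tabulate p)) (#-cong (λ x → subst T (lookup∘tabulate p x)) (λ x → subst T (sym (lookup∘tabulate p x))))

∈-⋃⁻ : ∀ {n} (Q : List (Subset n)) {x} → x ∈ ⋃ Q → Any (x ∈_) Q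
∈-⋃⁻ [] x∈ = ⊥-elim (S.∉⊥ x∈)
∈-⋃⁻ (X ∷ Q) x∈ = [ here , (λ x∈′ → there (∈-⋃⁻ Q x∈′)) ]′ (S.x∈p∪q⁻ X (⋃ Q) x∈)

∈-⋃⁺ : ∀ {n} {Q : List (Subset n)} {x X} → X ∈ₗ Q → x ∈ X → x ∈ ⋃ Q
∈-⋃⁺ (here refl) x∈X = S.x∈p∪q⁺ (inj₁ x∈X)
∈-⋃⁺ (there X∈Q) x∈X = S.x∈p∪q⁺ (inj₂ (∈-⋃⁺ X∈Q x∈X))

⋃-++ : ∀ {n} (Q Q′ : List (Subset n)) → ⋃ (Q ++ Q′) ≡ ⋃ Q ∪ ⋃ Q′
⋃-++ [] Q′ = sym (S.∪-identityˡ (⋃ Q′))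
⋃-++ (X ∷ Q) Q′ = trans (cong (X ∪_) (⋃-++ Q Q′)) (sym (S.∪-assoc X (⋃ Q) (⋃ Q′)))

disjoint-sub : ∀ {n} {X Y X′ Y′ : Subset n} → X′ ⊆ X → Y′ ⊆ Y → Disjoint X Y → Disjoint X′ Y′
disjoint-sub {X′ = X′} {Y′} X′⊆X Y′⊆Y dis (x , x∈) =
  let (x∈X′ , x∈Y′) = S.x∈p∩q⁻ X′ Y′ x∈ in dis (x , S.x∈p∩q⁺ (X′⊆X x∈X′ , Y′⊆Y x∈Y′))

disjoint-intro : ∀ {n} {X Y : Subset n} → (∀ {x} → x ∈ X → x ∈ Y → ⊥) → Disjoint X Y
disjoint-intro {X = X} {Y} f (x , x∈) = let (x∈X , x∈Y) = S.x∈p∩q⁻ X Y x∈ in f x∈X x∈Y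

disjoint-elim : ∀ {n} {X Y : Subset n} {x} → Disjoint X Y → x ∈ X → x ∈ Y → ⊥
disjoint-elim dis x∈X x∈Y = dis (_ , S.x∈p∩q⁺ (x∈X , x∈Y))

cross-disjoint : ∀ {n} {Q Q′ : List (Subset n)} → Disjoint (⋃ Q) (⋃ Q′) → All (λ X → All (Disjoint X) Q′) Q
cross-disjoint {Q = Q} {Q′} dis = All.tabulate λ X∈Q → All.tabulate λ Y∈Q′ → disjoint-sub {X = ⋃ Q} {⋃ Q′} (∈-⋃⁺ X∈Q) (∈-⋃⁺ Y∈Q′) dis

head-disjoint : ∀ {n} {X : Subset n} {Q} → All (Disjoint X) Q → Disjoint X (⋃ Q)
head-disjoint {Q = Q} dis = disjoint-intro λ x∈X x∈⋃ →
  let i = ∈-⋃⁻ Q x∈⋃ in disjoint-elim (All.lookupAny dis i .proj₁) x∈X (All.lookupAny dis i .proj₂)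

split : ∀ {n} m (X : Subset n) → m ≤ ∣ X ∣ →
        ∃ λ Y → ∃ λ Z → (Y ∪ Z ≡ X × Disjoint Y Z) × (∣ Y ∣ ≡ m × m + ∣ Z ∣ ≡ ∣ X ∣)
split {n} zero X _ = S.⊥ , X , (S.∪-identityˡ X , disjoint-intro (λ x∈⊥ _ → S.∉⊥ x∈⊥)) , S.∣⊥∣≡0 n , refl
split (suc m) (true V.∷ X) (s≤s m≤X) with split m X m≤X
... | Y , Z , (eq , dis) , ∣Y∣ , ∣Z∣ = true V.∷ Y , false V.∷ Z , (cong (true V.∷_) eq , disjoint-intro apart) , cong suc ∣Y∣ , cong suc ∣Z∣
  where
  apart : ∀ {x} → x ∈ true V.∷ Y → x ∈ false V.∷ Z → ⊥
  apart (V.there x∈Y) (V.there x∈Z) = disjoint-elim dis x∈Y x∈Z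
split (suc m) (false V.∷ X) m≤X with split (suc m) X m≤X
... | Y , Z , (eq , dis) , ∣Y∣ , ∣Z∣ = false V.∷ Y , false V.∷ Z , (cong (false V.∷_) eq , disjoint-intro apart) , ∣Y∣ , ∣Z∣
  where
  apart : ∀ {x} → x ∈ false V.∷ Y → x ∈ false V.∷ Z → ⊥
  apart (V.there x∈Y) (V.there x∈Z) = disjoint-elim dis x∈Y x∈Z

module _ {k : ℕ} (I : Instance k) where
  open Instance I

  ones-++ : ∀ Q Q′ → ones I (Q ++ Q′) ≡ ones I Q + ones I Q′
  ones-++ Q Q′ = trans (cong length (filter-++ (λ X → ∣ X ∣ ≟ 1) Q Q′)) (length-++ (filter (λ X → ∣ X ∣ ≟ 1) Q))

  ones-none : ∀ {Q} → All (λ X → ∣ X ∣ ≢ 1) Q → ones I Q ≡ 0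
  ones-none none = cong length (filter-none (λ X → ∣ X ∣ ≟ 1) none)

  partition-++ : ∀ {V W Q Q′} → IsPartition I V Q → IsPartition I W Q′ → Disjoint V W → IsPartition I (V ∪ W) (Q ++ Q′)
  partition-++ {V} {W} {Q} {Q′} P P′ dis = record
    { members  = All.++⁺ (IsPartition.members P) (IsPartition.members P′)
    ; nonempty = All.++⁺ (IsPartition.nonempty P) (IsPartition.nonempty P′)
    ; atMost3  = All.++⁺ (IsPartition.atMost3 P) (IsPartition.atMost3 P′)
    ; disjoint = AllPairs.++⁺ (IsPartition.disjoint P) (IsPartition.disjoint P′)
        (cross-disjoint (subst₂ Disjoint (sym (IsPartition.union P)) (sym (IsPartition.union P′)) dis))
    ; union    = trans (⋃-++ Q Q′) (cong₂ _∪_ (IsPartition.union P) (IsPartition.union P′)) }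

  partition-[] : IsPartition I S.⊥ []
  partition-[] = record { members = [] ; nonempty = [] ; atMost3 = [] ; disjoint = [] ; union = refl }

  partition-single : ∀ {X} → 𝒮 X → 1 ≤ ∣ X ∣ → ∣ X ∣ ≤ 3 → IsPartition I X (X ∷ [])
  partition-single {X} SX 1≤X X≤3 = record
    { members = SX ∷ [] ; nonempty = 1≤X ∷ [] ; atMost3 = X≤3 ∷ [] ; disjoint = [] ∷ [] ; union = S.∪-identityʳ X }

  -- From a set with more than three elements a pair is split off; at least two elements remain, so
  -- no 1-set arises on the way.
  refine : ∀ d X → ∣ X ∣ ≤ d → 𝒮 X → ∃ λ Q → IsPartition I X Q × ones I Q ≡ ones I (X ∷ [])
  refine d X X≤d SX with ∣ X ∣ ≟ 0 | ∣ X ∣ ≤? 3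
  ... | yes X≡0 | _ = [] , subst (λ V → IsPartition I V []) (sym X≡⊥) partition-[] ,
                      sym (ones-none {X ∷ []} ((λ X≡1 → 0≢1+n (trans (sym X≡0) X≡1)) ∷ []))
    where
    X≡⊥ : X ≡ S.⊥
    X≡⊥ = S.⊆-antisym (λ {x} x∈X → ⊥-elim (#-none (elem X) (trans (sym (∣∣≡# X)) X≡0) x (∈⇒T x∈X))) (λ x∈⊥ → ⊥-elim (S.∉⊥ x∈⊥))
  ... | no X≢0 | yes X≤3 = X ∷ [] , partition-single SX (n≢0⇒n>0 X≢0) X≤3 , refl
  refine zero X X≤d SX | no X≢0 | no X≰3 = ⊥-elim (X≢0 (n≤0⇒n≡0 X≤d))
  refine (suc d) X X≤d SX | no X≢0 | no X≰3
    with split 2 X (≤-trans (s≤s (s≤s z≤n)) (≰⇒> X≰3))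
  ... | Y , Z , (eq , dis) , ∣Y∣ , ∣Z∣
    with refine d Z (≤-pred (≤-trans (≤-trans (n≤1+n (suc ∣ Z ∣)) (≤-reflexive ∣Z∣)) X≤d)) (closed (λ x∈Z → subst (_ ∈_) eq (S.x∈p∪q⁺ (inj₂ x∈Z))) SX)
  ... | Q , PQ , onesQ = Y ∷ Q ,
      subst (λ V → IsPartition I V (Y ∷ Q)) eq (partition-++ (partition-single (closed (λ x∈Y → subst (_ ∈_) eq (S.x∈p∪q⁺ (inj₁ x∈Y))) SX)
        (≤-trans (s≤s z≤n) (≤-reflexive (sym ∣Y∣))) (≤-trans (≤-reflexive ∣Y∣) (n≤1+n 2))) PQ dis) ,
      trans (ones-++ (Y ∷ []) Q) (trans (cong₂ _+_ (ones-none {Y ∷ []} ((λ Y≡1 → 1+n≢0 (suc-injective (trans (sym ∣Y∣) Y≡1))) ∷ []))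
        (trans onesQ (ones-none {Z ∷ []} ((λ Z≡1 → X≰3 (≤-reflexive (trans (sym ∣Z∣) (cong (λ z → 2 + z) Z≡1)))) ∷ []))))
        (sym (ones-none {X ∷ []} ((λ X≡1 → X≰3 (≤-trans (≤-reflexive X≡1) (s≤s z≤n))) ∷ []))))

  refine-all : ∀ {Xs} → All 𝒮 Xs → AllPairs Disjoint Xs → ∃ λ Q → IsPartition I (⋃ Xs) Q × ones I Q ≡ ones I Xs
  refine-all [] [] = [] , partition-[] , refl
  refine-all {X ∷ Xs} (SX ∷ SXs) (dis ∷ diss) with refine ∣ X ∣ X ≤-refl SX | refine-all SXs diss
  ... | Q , PQ , onesQ | Q′ , PQ′ , onesQ′ = Q ++ Q′ , partition-++ PQ PQ′ (head-disjoint dis) ,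
        trans (ones-++ Q Q′) (trans (cong₂ _+_ onesQ onesQ′) (sym (ones-++ (X ∷ []) Xs)))

  ∁∪ : ∀ (X : Subset n) → ∁ X ∪ X ≡ ∁ S.⊥
  ∁∪ X = S.⊆-antisym (λ _ → S.x∉p⇒x∈∁p S.∉⊥) (λ {x} _ → S.x∈p∪q⁺ (decide x))
    where
    decide : ∀ x → x ∈ ∁ X ⊎ x ∈ X
    decide x with x S.∈? X
    ... | yes x∈X = inj₂ x∈X
    ... | no x∉X  = inj₁ (S.x∉p⇒x∈∁p x∉X)

  -- Cutting the k-sets of `P` into pairs and triples completes `Q` to a partition of the whole
  -- ground set without adding 1-sets.
  μ-lower : 2 ≤ k → ∀ {P Q m} → IsPacking I P → IsPartition I (∁ (⋃ P)) Q → IsMu I [] m → m ≤ ones I Q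
  μ-lower 2≤k {P} {Q} pack PQ mu with refine-all (IsPacking.members pack) (IsPacking.disjoint pack)
  ... | Q′ , PQ′ , onesQ′ = ≤-trans (IsMu.minimal mu (Q ++ Q′) (subst (λ V → IsPartition I V (Q ++ Q′)) (∁∪ (⋃ P))
          (partition-++ PQ PQ′ (disjoint-intro S.x∈∁p⇒x∉p))))
        (≤-reflexive (trans (ones-++ Q Q′) (trans (cong (λ z → ones I Q + z) (trans onesQ′
          (ones-none (All.map (λ X≡k X≡1 → <⇒≢ 2≤k (sym (trans (sym X≡k) X≡1))) (IsPacking.size-k pack)))))
          (+-identityʳ _))))

  -- The number is exactly `m` and not just at most `m`: the completions of A and O have to receive
  -- the same new elements, one for each 1-set.
  completion : 2 ≤ k → ∀ {P m} → IsPacking I P → NoIncrease I P → IsMu I [] m →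
               ∃ λ Q → IsPartition I (∁ (⋃ P)) Q × ones I Q ≡ m
  completion 2≤k pack (m₁ , m₂ , mu₁ , mu₂ , m₁≤m₂) mu with IsMu.attained mu₁ | IsMu.attained mu
  ... | Q , PQ , onesQ | Q₀ , PQ₀ , onesQ₀ = Q , PQ , ≤-antisym
        (≤-trans (≤-reflexive onesQ) (≤-trans m₁≤m₂ (≤-trans (IsMu.minimal mu₂ Q₀ PQ₀) (≤-reflexive onesQ₀))))
        (μ-lower 2≤k pack PQ mu)

  reached : ∀ {s B A} → Star (Step I s) B A → B ≡ A ⊎ IsPacking I A × NoIncrease I A
  reached Star.ε = inj₁ refl
  reached (step ◅ steps) with reached steps
  ... | inj₁ refl = inj₂ (Step.packing step , Step.noIncrease step)
  ... | inj₂ good = inj₂ good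

  packing-[] : IsPacking I []
  packing-[] = record { members = [] ; size-k = [] ; disjoint = [] }
#-≗ : ∀ {n} {p q : Sub n} → (∀ e → p e ≡ q e) → # p ≡ # q
#-≗ p≗q = #-cong (λ e → subst T (p≗q e)) (λ e → subst T (sym (p≗q e)))

-- From partitions to labellings: gluing new elements to the 1-sets

module _ {X : Set} {p} {P : X → Set p} (P? : ∀ x → Dec (P x)) where

  opaque
    unfolding #

    #-lookup : ∀ xs → # (λ i → does (P? (L.lookup xs i))) ≡ length (filter P? xs)
    #-lookup [] = refl
    #-lookup (x ∷ xs) with does (P? x)
    ... | true  = cong suc (#-lookup xs)
    ... | false = #-lookup xs

  filter-↭ : ∀ xs → xs ↭ filter P? xs ++ filter (λ x → ¬? (P? x)) xs
  filter-↭ [] = ↭-refl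
  filter-↭ (x ∷ xs) with does (P? x)
  ... | true  = ↭-prep x (filter-↭ xs)
  ... | false = ↭-trans (↭-prep x (filter-↭ xs)) (↭-sym (shift x (filter P? xs) _))

  -- An enumeration of the entries satisfying `P`. Applied to the 1-sets it tells to which block
  -- each new element is glued.
  positions : ∀ xs {d} → length (filter P? xs) ≡ d →
              ∃ λ (δ : Fin d → Fin (length xs)) → (∀ y → P (L.lookup xs (δ y))) × (∀ i → P (L.lookup xs i) → ∃ λ y → δ y ≡ i)
  positions [] refl = (λ ()) , (λ ()) , λ ()
  positions (x ∷ xs) eq with P? x
  positions (x ∷ xs) refl | yes px with positions xs refl
  ... | δ , sound , complete = δ′ , sound′ , complete′
    where
    δ′ : Fin (suc (length (filter P? xs))) → Fin (suc (length xs))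
    δ′ zero    = zero
    δ′ (suc y) = suc (δ y)
    sound′ : ∀ y → P (L.lookup (x ∷ xs) (δ′ y))
    sound′ zero    = px
    sound′ (suc y) = sound y
    complete′ : ∀ i → P (L.lookup (x ∷ xs) i) → ∃ λ y → δ′ y ≡ i
    complete′ zero    _ = zero , refl
    complete′ (suc i) p = let (y , δy≡i) = complete i p in suc y , cong suc δy≡i
  positions (x ∷ xs) eq | no ¬px with positions xs eq
  ... | δ , sound , complete = (λ y → suc (δ y)) , sound , complete′
    where
    complete′ : ∀ i → P (L.lookup (x ∷ xs) i) → ∃ λ y → suc (δ y) ≡ i
    complete′ zero    p = ⊥-elim (¬px p)
    complete′ (suc i) p = let (y , δy≡i) = complete i p in y , cong suc δy≡i

filter-≤ : ∀ {X : Set} {p q} {P : X → Set p} {Q : X → Set q} (P? : ∀ x → Dec (P x)) (Q? : ∀ x → Dec (Q x)) {xs} →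
           All (λ x → P x → Q x) xs → length (filter P? xs) ≤ length (filter Q? xs)
filter-≤ P? Q? [] = z≤n
filter-≤ P? Q? {x ∷ xs} (f ∷ fs) with P? x | Q? x
... | yes px | yes qx = s≤s (filter-≤ P? Q? fs)
... | yes px | no ¬qx = ⊥-elim (¬qx (f px))
... | no ¬px | yes qx = m≤n⇒m≤1+n (filter-≤ P? Q? fs)
... | no ¬px | no ¬qx = filter-≤ P? Q? fs

lookup-unique : ∀ {n} {Q : List (Subset n)} {x} → AllPairs Disjoint Q → ∀ i j → x ∈ L.lookup Q i → x ∈ L.lookup Q j → i ≡ j
lookup-unique (dis ∷ diss) zero    zero    _ _ = refl
lookup-unique {Q = X ∷ Q} (dis ∷ diss) zero    (suc j) x∈ x∈′ = ⊥-elim (disjoint-elim (All.lookup dis (∈-lookup j)) x∈ x∈′)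
lookup-unique {Q = X ∷ Q} (dis ∷ diss) (suc i) zero    x∈ x∈′ = ⊥-elim (disjoint-elim (All.lookup dis (∈-lookup i)) x∈′ x∈)
lookup-unique (dis ∷ diss) (suc i) (suc j) x∈ x∈′ = cong suc (lookup-unique diss i j x∈ x∈′)

-- A partition of Fin n is turned into a labelling of Fin (n + d) without blocks of size 1, by
-- adding one new element to each 1-set.
module Glue {n d : ℕ} (Q : List (Subset n)) (disjoint : AllPairs Disjoint Q) (cover : ∀ x → x ∈ ⋃ Q)
            (nonempty : All (λ X → 1 ≤ ∣ X ∣) Q) (ones≡d : length (filter (λ X → ∣ X ∣ ≟ 1) Q) ≡ d) where

  block : Fin (length Q) → Subset n
  block = L.lookup Q

  label : Fin n → Fin (length Q)
  label x = Any.index (∈-⋃⁻ Q (cover x))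

  ∈-label : ∀ x → x ∈ block (label x)
  ∈-label x = lookup-index (∈-⋃⁻ Q (cover x))

  label-unique : ∀ {x i} → x ∈ block i → label x ≡ i
  label-unique {x} {i} x∈ = lookup-unique disjoint (label x) i (∈-label x) x∈

  block-label : ∀ {X x} → X ∈ₗ Q → x ∈ X → X ≡ block (label x)
  block-label {X} {x} X∈Q x∈X = trans (lookup-index X∈Q) (cong block (sym (label-unique
    (subst (x ∈_) (lookup-index X∈Q) x∈X))))

  opaque

    δ,spec : ∃ λ (δ : Fin d → Fin (length Q)) → (∀ y → ∣ block (δ y) ∣ ≡ 1) × (∀ i → ∣ block i ∣ ≡ 1 → ∃ λ y → δ y ≡ i)
    δ,spec = positions (λ X → ∣ X ∣ ≟ 1) Q ones≡d

  δ : Fin d → Fin (length Q)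
  δ = proj₁ δ,spec

  glue : Fin (n + d) → Fin (length Q)
  glue e = [ label , δ ]′ (F.splitAt n e)

  hit-glue : ∀ G i → hit G glue i ≡ hit (λ x → G (x F.↑ˡ d)) label i + hit (λ y → G (n F.↑ʳ y)) δ i
  hit-glue G i = trans (#-⊎ {n} {d} (λ e → G e ∧ (glue e == i))) (cong₂ _+_
    (#-≗ (λ x → cong (λ z → G (x F.↑ˡ d) ∧ ([ label , δ ]′ z == i)) (F.splitAt-↑ˡ n x d)))
    (#-≗ (λ y → cong (λ z → G (n F.↑ʳ y) ∧ ([ label , δ ]′ z == i)) (F.splitAt-↑ʳ n d y))))

  size-label : ∀ i → size label i ≡ ∣ block i ∣
  size-label i = trans (#-cong (λ x t → ∈⇒T (subst (λ j → x ∈ block j) (==⇒≡ t) (∈-label x)))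
                               (λ x t → ≡⇒== (label-unique (T⇒∈ t)))) (sym (∣∣≡# (block i)))

  size-glue : ∀ i → size glue i ≡ ∣ block i ∣ + size δ i
  size-glue i = trans (hit-glue (λ _ → true) i) (cong (λ z → z + size δ i) (size-label i))

  no-dummy : ∀ {i} → ∣ block i ∣ ≢ 1 → ∀ G → hit G δ i ≡ 0
  no-dummy ≢1 G = #-empty (λ y t → ≢1 (subst (λ j → ∣ block j ∣ ≡ 1) (==⇒≡ (∧-right {G y} t)) (proj₁ (proj₂ δ,spec) y)))

  glue-size : ∀ i → 2 ≤ size glue i
  glue-size i = ≤-trans (by-size (∣ block i ∣ ≟ 1)) (≤-reflexive (sym (size-glue i)))
    where
    1≤ : 1 ≤ ∣ block i ∣
    1≤ = All.lookup nonempty (∈-lookup i)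
    by-size : Dec (∣ block i ∣ ≡ 1) → 2 ≤ ∣ block i ∣ + size δ i
    by-size (no ≢1) = ≤-trans (≤∧≢⇒< 1≤ (λ eq → ≢1 (sym eq))) (m≤m+n _ _)
    by-size (yes ≡1) with proj₂ (proj₂ δ,spec) i ≡1
    ... | y , δy≡i = +-mono-≤ 1≤ (#-pos y (≡⇒== δy≡i))

  glue-size-≢1 : ∀ i → ∣ block i ∣ ≢ 1 → size glue i ≡ ∣ block i ∣
  glue-size-≢1 i ≢1 = trans (size-glue i) (trans (cong (λ z → ∣ block i ∣ + z) (no-dummy ≢1 (λ _ → true))) (+-identityʳ _))

-- A valid set with more members of O inside than members of A met is a step of the algorithm

module Local {k : ℕ} (I : Instance k) (4≤k : 4 ≤ k) (s m : ℕ) (A O QA QO : List (Subset (Instance.n I)))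
             (packA : IsPacking I A) (packO : IsPacking I O)
             (partA : IsPartition I (∁ (⋃ A)) QA) (partO : IsPartition I (∁ (⋃ O)) QO)
             (onesA : ones I QA ≡ m) (onesO : ones I QO ≡ m)
             (mu : IsMu I [] m) (stuck : ¬ ∃ (Step I s A)) where
  open Instance I

  private
    2≤k : 2 ≤ k
    2≤k = ≤-trans (s≤s (s≤s z≤n)) 4≤k

    k≢1 : ∀ {c} → c ≡ k → c ≢ 1
    k≢1 c≡k c≡1 = <⇒≢ 2≤k (sym (trans (sym c≡k) c≡1))

    module Join {P Q : List (Subset n)} (pack : IsPacking I P) (part : IsPartition I (∁ (⋃ P)) Q) (ones≡m : ones I Q ≡ m) where

      disjoint : AllPairs Disjoint (P ++ Q)
      disjoint = AllPairs.++⁺ (IsPacking.disjoint pack) (IsPartition.disjoint part)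
        (cross-disjoint (subst (Disjoint (⋃ P)) (sym (IsPartition.union part)) (disjoint-intro (λ x∈ x∈∁ → S.x∈∁p⇒x∉p x∈∁ x∈))))

      cover : ∀ x → x ∈ ⋃ (P ++ Q)
      cover x = subst (x ∈_) (sym (⋃-++ P Q)) (S.x∈p∪q⁺ (decide (x S.∈? ⋃ P)))
        where
        decide : Dec (x ∈ ⋃ P) → x ∈ ⋃ P ⊎ x ∈ ⋃ Q
        decide (yes x∈) = inj₁ x∈
        decide (no x∉)  = inj₂ (subst (x ∈_) (sym (IsPartition.union part)) (S.x∉p⇒x∈∁p x∉))

      nonempty : All (λ X → 1 ≤ ∣ X ∣) (P ++ Q)
      nonempty = All.++⁺ (All.map (λ X≡k → ≤-trans (s≤s z≤n) (≤-trans 2≤k (≤-reflexive (sym X≡k)))) (IsPacking.size-k pack)) (IsPartition.nonempty part)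

      members : All 𝒮 (P ++ Q)
      members = All.++⁺ (IsPacking.members pack) (IsPartition.members part)

      total : ones I (P ++ Q) ≡ m
      total = trans (ones-++ I P Q) (trans (cong (λ z → z + ones I Q) (ones-none I (All.map k≢1 (IsPacking.size-k pack)))) ones≡m)

      open Glue (P ++ Q) disjoint cover nonempty total public

      -- Size alone recognises the sets of the packing, since the blocks of the completion have at
      -- most 3 < k elements.
      large : Sub (length (P ++ Q))
      large i = does (∣ block i ∣ ≟ k)

      large-size : ∀ i → T (large i) → size glue i ≡ k
      large-size i t = let eq = does-T (∣ block i ∣ ≟ k) t in trans (glue-size-≢1 i (k≢1 eq)) eq

      small : All (λ X → ∣ X ∣ ≢ k) Q
      small = All.map (λ X≤3 X≡k → <⇒≱ 4≤k (≤-trans (≤-reflexive (sym X≡k)) X≤3)) (IsPartition.atMost3 part)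

      #-large : # large ≡ length P
      #-large = trans (#-lookup (λ X → ∣ X ∣ ≟ k) (P ++ Q)) (trans (cong length (trans (filter-++ (λ X → ∣ X ∣ ≟ k) P Q)
        (cong₂ _++_ (filter-all (λ X → ∣ X ∣ ≟ k) (IsPacking.size-k pack)) (filter-none (λ X → ∣ X ∣ ≟ k) small))))
        (trans (length-++ P) (+-identityʳ _)))

      -- The blocks are cut down to the old elements selected by `G`. Those listed in `R` stay whole
      -- as sets of the new packing, so their pieces are made empty.
      module Rest (G : Sub (n + m)) (R : List (Subset n)) where

        real : Sub n
        real x = G (x F.↑ˡ m)

        dummy : Sub m
        dummy y = G (n F.↑ʳ y)

        _∈R? : ∀ X → Dec (X ∈ₗ R)
        X ∈R? = Any.any? (λ Y → V.≡-dec Data.Bool._≟_ X Y) R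

        rest : Fin (length (P ++ Q)) → Sub n
        rest i x = (real x ∧ (label x == i)) ∧ not (does (block i ∈R?))

        piece : Fin (length (P ++ Q)) → Subset n
        piece i = tabulate (rest i)

        pieces : List (Subset n)
        pieces = L.tabulate piece

        piece⊆block : ∀ i → piece i ⊆ block i
        piece⊆block i {x} x∈ = subst (λ j → x ∈ block j) (==⇒≡ (∧-right {real x} (∧-left (∈-tab⁻ (rest i) x∈)))) (∈-label x)

        pieces-members : All 𝒮 pieces
        pieces-members = All.tabulate⁺ (λ i → closed (piece⊆block i) (All.lookup members (∈-lookup i)))

        pieces-disjoint : AllPairs Disjoint pieces
        pieces-disjoint = AllPairs.tabulate⁺ λ {i} {j} i≢j → disjoint-intro λ x∈ x∈′ →
          i≢j (trans (sym (label-unique (piece⊆block i x∈))) (label-unique (piece⊆block j x∈′)))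

        ∈-pieces⁻ : ∀ {x} → x ∈ ⋃ pieces → T (real x) × ¬ block (label x) ∈ₗ R
        ∈-pieces⁻ {x} x∈ with find (∈-⋃⁻ pieces x∈)
        ... | X , X∈ , x∈X with ∈-tabulate⁻ {f = piece} X∈
        ...   | i , refl = ∧-left (∧-left t) , λ b∈R → not-elim {does (block i ∈R?)} (∧-right {real x ∧ (label x == i)} t)
                  (T-does (block i ∈R?) (subst (λ j → block j ∈ₗ R) (==⇒≡ (∧-right {real x} (∧-left t))) b∈R))
          where
          t : T (rest i x)
          t = ∈-tab⁻ (rest i) x∈X

        ∈-pieces⁺ : ∀ {x} → T (real x) → ¬ block (label x) ∈ₗ R → x ∈ ⋃ pieces
        ∈-pieces⁺ {x} Gx ∉R = ∈-⋃⁺ (∈-tabulate⁺ {f = piece} (label x)) (∈-tab⁺ (rest (label x))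
          (∧-intro (∧-intro Gx (≡⇒== refl)) (not-intro (λ t → ∉R (does-T (block (label x) ∈R?) t)))))

        -- A piece with one element comes from a block of which `G` selects at least two elements,
        -- hence also a new one. The piece is charged to this new element, which belongs to no other
        -- block.
        ones-pieces : (∀ i → hit G glue i ≢ 1) → ones I pieces ≤ # dummy
        ones-pieces ≢1 = ≤-trans (≤-reflexive (trans (sym (#-lookup (λ X → ∣ X ∣ ≟ 1) pieces)) count))
            (≤-trans (∑-mono pointwise) (≤-reflexive (∑-hit dummy δ)))
          where
          count : # (λ i → does (∣ L.lookup pieces i ∣ ≟ 1)) ≡ sum (λ i → ⟦ does (∣ piece i ∣ ≟ 1) ⟧)
          count = trans (#-lookup (λ X → ∣ X ∣ ≟ 1) pieces) (trans (tab piece) (sym (sum-⟦⟧ _)))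
            where
            opaque
              unfolding #
              tab : ∀ {a} (f : Fin a → Subset n) → length (filter (λ X → ∣ X ∣ ≟ 1) (L.tabulate f)) ≡ # (λ i → does (∣ f i ∣ ≟ 1))
              tab {zero}  f = refl
              tab {suc a} f with does (∣ f zero ∣ ≟ 1)
              ... | true  = cong suc (tab (λ i → f (suc i)))
              ... | false = tab (λ i → f (suc i))
          pointwise : ∀ i → ⟦ does (∣ piece i ∣ ≟ 1) ⟧ ≤ hit dummy δ i
          pointwise i with ∣ piece i ∣ ≟ 1
          ... | no ≢ rewrite ⟦⟧-¬T {does (∣ piece i ∣ ≟ 1)} (λ t → ≢ (does-T (∣ piece i ∣ ≟ 1) t)) = z≤n
          ... | yes ≡1 = ≤-trans (⟦⟧≤1 _) (n≢0⇒n>0 (λ h≡0 → ≢1 i (trans (hit-glue G i) (trans (cong₂ _+_ one h≡0) refl))))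
            where
            1≡# : # (rest i) ≡ 1
            1≡# = trans (sym (∣tabulate∣ (rest i))) ≡1
            outside : ¬ T (does (block i ∈R?))
            outside with #-∃ (rest i) (≤-reflexive (sym 1≡#))
            ... | x , t = not-elim (∧-right {real x ∧ (label x == i)} t)
            one : hit real label i ≡ 1
            one = trans (#-cong (λ x t → ∧-intro t (not-intro outside)) (λ x → ∧-left)) 1≡#

  module PA = Join packA partA onesA
  module PO = Join packO partO onesO

  open Search PA.glue PO.glue PA.glue-size PO.glue-size PA.large PO.large k s PA.large-size PO.large-size

  private
    module Improve (G : Sub (n + m)) (v : Exchange.Valid PA.glue PO.glue PA.glue-size PO.glue-size G)
                   (few : touched G ≤ s) (more : touched G < contained G) where
      open Exchange.Valid v

      real : Sub n
      real x = G (x F.↑ˡ m)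

      meets? : ∀ X → Dec (∃ λ x → T (elem X x ∧ real x))
      meets? X = any? (λ x → T? (elem X x ∧ real x))

      inside? : ∀ X → Dec (∀ x → T (elem X x) → T (real x))
      inside? X = all? (λ x → T? (elem X x) →-dec T? (real x))

      removed kept candidates added A′ : List (Subset n)
      removed    = filter meets? A
      kept       = filter (λ X → ¬? (meets? X)) A
      candidates = filter inside? O
      -- A step adds exactly one set more than it removes. Further candidates are not lost: they
      -- become pieces and are later cut into pairs and triples.
      added      = take (suc (length removed)) candidates
      A′         = added ++ kept

      removed≤touched : length removed ≤ touched G
      removed≤touched = ≤-trans (filter-≤ meets? large-meets? {A} (All.map (λ X≡k meets → X≡k , meets) (IsPacking.size-k packA)))
        (≤-trans (≤-trans (m≤m+n _ _) (≤-reflexive (sym (trans (cong length (filter-++ large-meets? A QA)) (length-++ (filter large-meets? A))))))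
        (≤-trans (≤-reflexive (sym (#-lookup large-meets? (A ++ QA)))) (#-mono sub)))
        where
        large-meets? : ∀ X → Dec (∣ X ∣ ≡ k × ∃ λ x → T (elem X x ∧ real x))
        large-meets? X = (∣ X ∣ ≟ k) ×-dec meets? X
        sub : ∀ i → T (does (large-meets? (PA.block i))) → T (PA.large i ∧ does (1 ≤? hit G PA.glue i))
        sub i t with does-T (large-meets? (PA.block i)) t
        ... | ≡k , x , u = ∧-intro (T-does (∣ PA.block i ∣ ≟ k) ≡k) (T-does (1 ≤? _) (≤-trans
                (≤-trans (#-pos x (∧-intro (∧-right {elem (PA.block i) x} u) (≡⇒== (PA.label-unique (T⇒∈ (∧-left u)))))) (m≤m+n _ _))
                (≤-reflexive (sym (PA.hit-glue G i)))))

      contained≤candidates : contained G ≤ length candidates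
      contained≤candidates = ≤-trans (#-mono sub) (≤-trans (≤-reflexive (#-lookup large-inside? (O ++ QO)))
        (≤-trans (≤-reflexive (trans (cong length (filter-++ large-inside? O QO)) (trans (length-++ (filter large-inside? O))
          (trans (cong (λ z → length (filter large-inside? O) + length z) (filter-none large-inside? (All.map (λ ≢k (≡k , _) → ≢k ≡k) PO.small)))
                 (+-identityʳ _)))))
        (filter-≤ large-inside? inside? {O} (All.tabulate (λ _ → proj₂)))))
        where
        large-inside? : ∀ X → Dec (∣ X ∣ ≡ k × (∀ x → T (elem X x) → T (real x)))
        large-inside? X = (∣ X ∣ ≟ k) ×-dec inside? X
        sub : ∀ j → T (PO.large j ∧ (miss G PO.glue j ≈ᵇ 0)) → T (does (large-inside? (PO.block j)))
        sub j t = T-does (large-inside? (PO.block j)) (does-T (∣ PO.block j ∣ ≟ k) (∧-left t) , λ x x∈ → full x (PO.label-unique (T⇒∈ x∈)))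
          where
          missed : miss real PO.label j ≡ 0
          missed = m+n≡0⇒m≡0 _ (trans (sym (PO.hit-glue (λ e → not (G e)) j)) (does-T (_ ≟ 0) (∧-right {PO.large j} t)))
          full : ∀ x → PO.label x ≡ j → T (real x)
          full = miss-zero missed

      added-length : length added ≡ suc (length removed)
      added-length = trans (length-take (suc (length removed)) candidates)
        (m≤n⇒m⊓n≡m (≤-trans (s≤s removed≤touched) (≤-trans more contained≤candidates)))

      ∈-added : ∀ {X} → X ∈ₗ added → X ∈ₗ O × (∀ x → T (elem X x) → T (real x))
      ∈-added X∈ = ∈-filter⁻ inside? (All.lookup (All.take⁺ (suc (length removed)) (All.tabulate (λ u → u))) X∈)

      ∈-kept : ∀ {X} → X ∈ₗ kept → X ∈ₗ A × ¬ ∃ λ x → T (elem X x ∧ real x)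
      ∈-kept = ∈-filter⁻ (λ X → ¬? (meets? X))

      packing′ : IsPacking I A′
      packing′ = record
        { members  = All.++⁺ (All.take⁺ _ (All.filter⁺ inside? (IsPacking.members packO))) (All.filter⁺ _ (IsPacking.members packA))
        ; size-k   = All.++⁺ (All.take⁺ _ (All.filter⁺ inside? (IsPacking.size-k packO))) (All.filter⁺ _ (IsPacking.size-k packA))
        ; disjoint = AllPairs.++⁺ (AllPairs.take⁺ _ (AllPairs.filter⁺ inside? (IsPacking.disjoint packO))) (AllPairs.filter⁺ _ (IsPacking.disjoint packA))
            (All.tabulate λ X∈ → All.tabulate λ Y∈ → disjoint-intro λ {x} x∈X x∈Y →
              proj₂ (∈-kept Y∈) (x , ∧-intro (∈⇒T x∈Y) (proj₂ (∈-added X∈) x (∈⇒T x∈X)))) }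

      module RA = PA.Rest (λ e → not (G e)) kept
      module RO = PO.Rest G added

      all-pieces : List (Subset n)
      all-pieces = RA.pieces ++ RO.pieces

      all-disjoint : AllPairs Disjoint all-pieces
      all-disjoint = AllPairs.++⁺ RA.pieces-disjoint RO.pieces-disjoint (cross-disjoint (disjoint-intro λ {x} x∈ x∈′ →
        not-elim {G (x F.↑ˡ m)} (proj₁ (RA.∈-pieces⁻ x∈)) (proj₁ (RO.∈-pieces⁻ x∈′))))

      union : ⋃ all-pieces ≡ ∁ (⋃ A′)
      union = S.⊆-antisym sound complete
        where
        sound : ⋃ all-pieces ⊆ ∁ (⋃ A′)
        sound {x} x∈ = S.x∉p⇒x∈∁p λ x∈A′ → clash (find (∈-⋃⁻ A′ x∈A′)) (S.x∈p∪q⁻ (⋃ RA.pieces) (⋃ RO.pieces) (subst (x ∈_) (⋃-++ RA.pieces RO.pieces) x∈))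
          where
          clash : (∃ λ X → X ∈ₗ A′ × x ∈ X) → ¬ (x ∈ ⋃ RA.pieces ⊎ x ∈ ⋃ RO.pieces)
          clash (X , X∈ , x∈X) parts with ∈-++⁻ added X∈ | parts
          ... | inj₁ X∈added | inj₁ x∈A = not-elim (proj₁ (RA.∈-pieces⁻ x∈A)) (proj₂ (∈-added X∈added) x (∈⇒T x∈X))
          ... | inj₁ X∈added | inj₂ x∈O = proj₂ (RO.∈-pieces⁻ x∈O) (subst (_∈ₗ added) (PO.block-label (∈-++⁺ˡ (proj₁ (∈-added X∈added))) x∈X) X∈added)
          ... | inj₂ X∈kept  | inj₁ x∈A = proj₂ (RA.∈-pieces⁻ x∈A) (subst (_∈ₗ kept) (PA.block-label (∈-++⁺ˡ (proj₁ (∈-kept X∈kept))) x∈X) X∈kept)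
          ... | inj₂ X∈kept  | inj₂ x∈O = proj₂ (∈-kept X∈kept) (x , ∧-intro (∈⇒T x∈X) (proj₁ (RO.∈-pieces⁻ x∈O)))
        complete : ∁ (⋃ A′) ⊆ ⋃ all-pieces
        complete {x} x∈∁ = subst (x ∈_) (sym (⋃-++ RA.pieces RO.pieces)) (S.x∈p∪q⁺ (decide (T? (real x))))
          where
          x∉A′ : x ∉ ⋃ A′
          x∉A′ = S.x∈∁p⇒x∉p x∈∁
          decide : Dec (T (real x)) → x ∈ ⋃ RA.pieces ⊎ x ∈ ⋃ RO.pieces
          decide (yes Gx) = inj₂ (RO.∈-pieces⁺ Gx λ b∈ → x∉A′ (∈-⋃⁺ (∈-++⁺ˡ b∈) (PO.∈-label x)))
          decide (no ¬Gx) = inj₁ (RA.∈-pieces⁺ (not-intro ¬Gx) λ b∈ → x∉A′ (∈-⋃⁺ (∈-++⁺ʳ added b∈) (PA.∈-label x)))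

      -- Pieces of A-blocks are charged to new elements outside `G`, pieces of O-blocks to new
      -- elements in `G`. Both sides share the same `m` new elements.
      ones-≤ : ones I all-pieces ≤ m
      ones-≤ = ≤-trans (≤-reflexive (ones-++ I RA.pieces RO.pieces)) (≤-trans (+-mono-≤ (RA.ones-pieces no-miss-1) (RO.ones-pieces no-hit-1))
        (≤-trans (≤-reflexive (trans (+-comm (# RA.dummy) (# RO.dummy)) (sym (#-split (λ _ → true) RO.dummy)))) (#≤n (λ _ → true))))

      step : Step I s A A′
      step = record
        { removed = removed ; added = added ; kept = kept
        ; before = filter-↭ meets? A ; after = ↭-refl ; p≤s = ≤-trans removed≤touched few
        ; one-more = added-length ; packing = packing′ ; noIncrease = no-increase (refine-all I (All.++⁺ RA.pieces-members RO.pieces-members) all-disjoint) }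
        where
        no-increase : (∃ λ Q → IsPartition I (⋃ all-pieces) Q × ones I Q ≡ ones I all-pieces) → NoIncrease I A′
        no-increase (Q , part , ones≡) = m , m , record
            { attained = Q , part′ , ≤-antisym (≤-trans (≤-reflexive ones≡) ones-≤) (μ-lower I 2≤k packing′ part′ mu)
            ; minimal = λ Q′ part″ → μ-lower I 2≤k packing′ part″ mu } , mu , ≤-refl
          where
          part′ : IsPartition I (∁ (⋃ A′)) Q
          part′ = subst (λ V → IsPartition I V Q) union part

  locally-optimal : LocallyOptimal
  locally-optimal G v few more = stuck (_ , Improve.step G v few more)

-- The bounds for outputs of the algorithm

module _ {k : ℕ} (I : Instance k) (4≤k : 4 ≤ k) {s : ℕ} {A O : List (Subset (Instance.n I))}
         (output : IsOutput I s A) (optimal : IsOptimal I O) where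

  private
    2≤k : 2 ≤ k
    2≤k = ≤-trans (s≤s (s≤s z≤n)) 4≤k

    packO : IsPacking I O
    packO = IsOptimal.packing optimal

    m : ℕ
    m = proj₁ (proj₂ (IsOptimal.noIncrease optimal))

    mu : IsMu I [] m
    mu = proj₁ (proj₂ (proj₂ (proj₂ (IsOptimal.noIncrease optimal))))

    Covering : List (Subset (Instance.n I)) → Set
    Covering P = IsPacking I P × (∃ λ Q → IsPartition I (∁ (⋃ P)) Q × ones I Q ≡ m)

    coverA : Covering A
    coverA with reached I (IsOutput.reachable output)
    -- No replacement was made: A is empty, and a partition attaining μ(∅) completes it.
    ... | inj₁ refl = packing-[] I , IsMu.attained mu
    ... | inj₂ (pack , no-increase) = pack , completion I 2≤k pack no-increase mu

    coverO : Covering O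
    coverO = packO , completion I 2≤k packO (IsOptimal.noIncrease optimal) mu

    open Local I 4≤k s m A O (proj₁ (proj₂ coverA)) (proj₁ (proj₂ coverO)) (proj₁ coverA) packO
      (proj₁ (proj₂ (proj₂ coverA))) (proj₁ (proj₂ (proj₂ coverO))) (proj₂ (proj₂ (proj₂ coverA))) (proj₂ (proj₂ (proj₂ coverO)))
      mu (IsOutput.stuck output)

    open Exchange PA.glue PO.glue PA.glue-size PO.glue-size

    opaque

      start : ∃ λ F → Maximal PA.large F
      start = let (F , _ , M) = extend PA.large (λ _ → false) valid-∅ (λ _ ()) in F , M

  four-bound : k ≡ 4 → 4 ≤ s → 7 * length O ≤ 16 * length A
  four-bound refl 4≤s = subst₂ (λ x y → 7 * x ≤ 16 * y) PO.#-large PA.#-large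
    (FourSets.four-set-bound PA.glue PO.glue PA.glue-size PO.glue-size PA.large PO.large s PA.large-size PO.large-size
       4≤s (proj₁ start) (proj₂ start) locally-optimal)

  many-bound : 5 ≤ k → s * (2 * length O) ≤ s * (k * length A) + 2 * length O
  many-bound 5≤k = subst₂ (λ x y → s * (2 * x) ≤ s * (k * y) + 2 * x) PO.#-large PA.#-large
    (ManySets.many-set-bound PA.glue PO.glue PA.glue-size PO.glue-size PA.large PO.large k s PA.large-size PO.large-size
       5≤k (proj₁ start) (proj₂ start) locally-optimal)

-- Rational arithmetic

/-*-fromℕ : ∀ p q .{{_ : NonZero q}} → + p / q ℚ.* fromℕ q ≡ fromℕ p
/-*-fromℕ p (suc q) = ℚ.toℚᵘ-injective (ℚᵘ.≃-trans (ℚ.toℚᵘ-homo-* (+ p / suc q) (fromℕ (suc q)))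
  (ℚᵘ.≃-trans (ℚᵘ.*-cong (ℚ.toℚᵘ-fromℚᵘ (ℚᵘ.mkℚᵘ (+ p) q)) (ℚ.toℚᵘ-fromℚᵘ (ℚᵘ.mkℚᵘ (+ suc q) 0)))
  (ℚᵘ.≃-trans (ℚᵘ.*≡* (trans (ℤ.*-identityʳ (+ p ℤ.* + suc q)) (cong (λ z → + p ℤ.* + z) (sym (*-identityʳ (suc q))))))
  (ℚᵘ.≃-sym (ℚ.toℚᵘ-fromℚᵘ (ℚᵘ.mkℚᵘ (+ p) 0))))))

fromℕ-* : ∀ m n → fromℕ (m * n) ≡ fromℕ m ℚ.* fromℕ n
fromℕ-* m n = ℚ.toℚᵘ-injective (ℚᵘ.≃-trans (ℚ.toℚᵘ-fromℚᵘ (ℚᵘ.mkℚᵘ (+ (m * n)) 0))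
  (ℚᵘ.≃-trans (ℚᵘ.*≡* (cong (λ z → z ℤ.* + 1) (ℤ.pos-* m n)))
  (ℚᵘ.≃-sym (ℚᵘ.≃-trans (ℚ.toℚᵘ-homo-* (fromℕ m) (fromℕ n))
    (ℚᵘ.*-cong (ℚ.toℚᵘ-fromℚᵘ (ℚᵘ.mkℚᵘ (+ m) 0)) (ℚ.toℚᵘ-fromℚᵘ (ℚᵘ.mkℚᵘ (+ n) 0)))))))

fromℕ-+ : ∀ m n → fromℕ (m + n) ≡ fromℕ m ℚ.+ fromℕ n
fromℕ-+ m n = ℚ.toℚᵘ-injective (ℚᵘ.≃-trans (ℚ.toℚᵘ-fromℚᵘ (ℚᵘ.mkℚᵘ (+ (m + n)) 0))
  (ℚᵘ.≃-trans (ℚᵘ.*≡* (cong (λ z → z ℤ.* + 1) (trans (ℤ.pos-+ m n) (sym (cong₂ ℤ._+_ (ℤ.*-identityʳ (+ m)) (ℤ.*-identityʳ (+ n)))))))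
  (ℚᵘ.≃-sym (ℚᵘ.≃-trans (ℚ.toℚᵘ-homo-+ (fromℕ m) (fromℕ n))
    (ℚᵘ.+-cong (ℚ.toℚᵘ-fromℚᵘ (ℚᵘ.mkℚᵘ (+ m) 0)) (ℚ.toℚᵘ-fromℚᵘ (ℚᵘ.mkℚᵘ (+ n) 0)))))))

fromℕ-mono : ∀ {m n} → m ≤ n → fromℕ m ℚ.≤ fromℕ n
fromℕ-mono {m} {n} m≤n = ℚ.toℚᵘ-cancel-≤ (ℚᵘ.≤-respˡ-≃ (ℚᵘ.≃-sym (ℚ.toℚᵘ-fromℚᵘ (ℚᵘ.mkℚᵘ (+ m) 0)))
  (ℚᵘ.≤-respʳ-≃ (ℚᵘ.≃-sym (ℚ.toℚᵘ-fromℚᵘ (ℚᵘ.mkℚᵘ (+ n) 0))) (ℚᵘ.*≤* (ℤ.*-monoʳ-≤-nonNeg (+ 1) (ℤ.+≤+ m≤n)))))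

fromℕ-pos : ∀ m .{{_ : NonZero m}} → Positive (fromℕ m)
fromℕ-pos m = ℚ.normalize-pos m 1

fromℕ-nonNeg : ∀ m → ℚ.NonNegative (fromℕ m)
fromℕ-nonNeg m = ℚ.normalize-nonNeg m 1

≤-fromℕ : ∀ p → ∃ λ m → p ℚ.≤ fromℕ m
≤-fromℕ p@(ℚ.mkℚ n d _) = ℤ.∣ n ∣ , ℚ.toℚᵘ-cancel-≤ (ℚᵘ.≤-respʳ-≃ (ℚᵘ.≃-sym (ℚ.toℚᵘ-fromℚᵘ (ℚᵘ.mkℚᵘ (+ ℤ.∣ n ∣) 0)))
  (ℚᵘ.*≤* (ℤ.≤-trans (ℤ.≤-reflexive (ℤ.*-identityʳ n)) (bound n))))
  where
  bound : ∀ n → n ℤ.≤ + ℤ.∣ n ∣ ℤ.* + suc d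
  bound (ℤ.-[1+ n ]) = ℤ.≤-trans ℤ.-≤+ (ℤ.≤-reflexive (ℤ.pos-* (suc n) (suc d)))
  bound (+ n) = ℤ.≤-trans (ℤ.+≤+ (m≤m*n n (suc d))) (ℤ.≤-reflexive (ℤ.pos-* n (suc d)))

-- After multiplication by `S` and `K`, the loss through `ε` is at least `c` times `K` times `O`
-- because `c ≤ S ε`. This is the additive term of the hypothesis, as `c K = 2`.
ratio-bound : ∀ c ε S K O A .{{_ : Positive S}} .{{_ : Positive K}} .{{_ : ℚ.NonNegative O}} →
              c ℚ.* K ≡ fromℕ 2 → c ℚ.≤ S ℚ.* ε →
              S ℚ.* (fromℕ 2 ℚ.* O) ℚ.≤ S ℚ.* (K ℚ.* A) ℚ.+ fromℕ 2 ℚ.* O → (c - ε) ℚ.* O ℚ.≤ A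
ratio-bound c ε S K O A cK≡2 c≤Sε bound = ℚ.*-cancelˡ-≤-pos (S ℚ.* K) {{ℚ.pos*pos⇒pos S K}} (begin
  S ℚ.* K ℚ.* ((c - ε) ℚ.* O)                             ≡⟨ expand c ε S K O ⟩
  S ℚ.* (c ℚ.* K ℚ.* O) ℚ.+ ℚ.- (S ℚ.* ε ℚ.* (K ℚ.* O))   ≤⟨ ℚ.+-mono-≤ bound′ (ℚ.neg-antimono-≤ (ℚ.*-monoʳ-≤-nonNeg (K ℚ.* O) {{KO}} c≤Sε)) ⟩
  (S ℚ.* (K ℚ.* A) ℚ.+ c ℚ.* K ℚ.* O) ℚ.+ ℚ.- (c ℚ.* (K ℚ.* O)) ≡⟨ collect c S K O A ⟩
  S ℚ.* K ℚ.* A                                           ∎)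
  where
  open ℚ.≤-Reasoning
  open import Data.Rational.Solver using (module +-*-Solver)
  open +-*-Solver
  KO : ℚ.NonNegative (K ℚ.* O)
  KO = ℚ.nonNeg*nonNeg⇒nonNeg K {{ℚ.pos⇒nonNeg K}} O
  bound′ : S ℚ.* (c ℚ.* K ℚ.* O) ℚ.≤ S ℚ.* (K ℚ.* A) ℚ.+ c ℚ.* K ℚ.* O
  bound′ = subst (λ z → S ℚ.* (z ℚ.* O) ℚ.≤ S ℚ.* (K ℚ.* A) ℚ.+ z ℚ.* O) (sym cK≡2) bound
  expand : ∀ c ε S K O → S ℚ.* K ℚ.* ((c - ε) ℚ.* O) ≡ S ℚ.* (c ℚ.* K ℚ.* O) ℚ.+ ℚ.- (S ℚ.* ε ℚ.* (K ℚ.* O))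
  expand = solve 5 (λ c ε S K O → S :* K :* ((c :- ε) :* O) := S :* (c :* K :* O) :+ :- (S :* ε :* (K :* O))) refl
  collect : ∀ c S K O A → (S ℚ.* (K ℚ.* A) ℚ.+ c ℚ.* K ℚ.* O) ℚ.+ ℚ.- (c ℚ.* (K ℚ.* O)) ≡ S ℚ.* K ℚ.* A
  collect = solve 5 (λ c S K O A → (S :* (K :* A) :+ c :* K :* O) :+ :- (c :* (K :* O)) := S :* K :* A) refl

four-ratio : HasApproximationRatio 4 4 (+ 7 / 16)
four-ratio I A O output optimal = ℚ.*-cancelˡ-≤-pos (fromℕ 16) {{fromℕ-pos 16}} (begin
  fromℕ 16 ℚ.* (+ 7 / 16 ℚ.* fromℕ (length O))    ≡⟨ sym (ℚ.*-assoc (fromℕ 16) (+ 7 / 16) (fromℕ (length O))) ⟩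
  fromℕ 16 ℚ.* (+ 7 / 16) ℚ.* fromℕ (length O)    ≡⟨ cong (λ z → z ℚ.* fromℕ (length O)) (ℚ.*-comm (fromℕ 16) (+ 7 / 16)) ⟩
  fromℕ 7 ℚ.* fromℕ (length O)                    ≡⟨ sym (fromℕ-* 7 (length O)) ⟩
  fromℕ (7 * length O)                            ≤⟨ fromℕ-mono (four-bound I ≤-refl output optimal refl ≤-refl) ⟩
  fromℕ (16 * length A)                           ≡⟨ fromℕ-* 16 (length A) ⟩
  fromℕ 16 ℚ.* fromℕ (length A)                   ∎)
  where open ℚ.≤-Reasoning

÷-≤ : ∀ k .{{_ : NonZero k}} ε .{{_ : Positive ε}} s → _÷_ (+ 2 / k) ε {{pos⇒nonZero ε}} ℚ.≤ fromℕ s → + 2 / k ℚ.≤ fromℕ s ℚ.* ε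
÷-≤ k ε s c÷ε≤s = ℚ.≤-trans (ℚ.≤-reflexive (sym (trans (ℚ.*-assoc (+ 2 / k) (ℚ.1/_ ε {{pos⇒nonZero ε}}) ε)
    (trans (cong (λ z → + 2 / k ℚ.* z) (ℚ.*-inverseˡ ε {{pos⇒nonZero ε}})) (ℚ.*-identityʳ (+ 2 / k))))))
  (ℚ.*-monoʳ-≤-nonNeg ε {{ℚ.pos⇒nonNeg ε}} c÷ε≤s)

many-ratio : ∀ k .{{_ : NonZero k}} → 5 ≤ k → ∀ ε .{{_ : Positive ε}} s →
             _÷_ (+ 2 / k) ε {{pos⇒nonZero ε}} ℚ.≤ fromℕ s → HasApproximationRatio k s (+ 2 / k - ε)
-- The bound has to be divided by s, and s = 0 is excluded since 2/(kε) is positive.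
many-ratio k 5≤k ε zero c÷ε≤s = ⊥-elim (absurd (ℚ.≤-trans (ℚ.≤-reflexive (sym (/-*-fromℕ 2 k)))
    (ℚ.≤-trans (ℚ.*-monoʳ-≤-nonNeg (fromℕ k) {{fromℕ-nonNeg k}} c≤0) (ℚ.≤-reflexive (ℚ.*-zeroˡ (fromℕ k))))))
  where
  c≤0 : + 2 / k ℚ.≤ ℚ.0ℚ
  c≤0 = ℚ.≤-trans (÷-≤ k ε zero c÷ε≤s) (ℚ.≤-reflexive (ℚ.*-zeroˡ ε))
  absurd : ¬ fromℕ 2 ℚ.≤ ℚ.0ℚ
  absurd (ℚ.*≤* (ℤ.+≤+ ()))
many-ratio k 5≤k ε s@(suc _) c÷ε≤s I A O output optimal = ratio-bound (+ 2 / k) ε (fromℕ s) (fromℕ k) (fromℕ (length O)) (fromℕ (length A))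
    {{fromℕ-pos s}} {{fromℕ-pos k}} {{fromℕ-nonNeg (length O)}} (/-*-fromℕ 2 k) (÷-≤ k ε s c÷ε≤s)
    (subst₂ ℚ._≤_ (trans (fromℕ-* s (2 * length O)) (cong (λ z → fromℕ s ℚ.* z) (fromℕ-* 2 (length O))))
       (trans (fromℕ-+ (s * (k * length A)) (2 * length O)) (cong₂ ℚ._+_
          (trans (fromℕ-* s (k * length A)) (cong (λ z → fromℕ s ℚ.* z) (fromℕ-* k (length A)))) (fromℕ-* 2 (length O))))
       (fromℕ-mono (many-bound I (≤-trans (n≤1+n 4) 5≤k) output optimal 5≤k)))

theorem4 : (∃ λ (s : ℕ) → HasApproximationRatio 4 s (+ 7 / 16))
    ×
    (∀ (k : ℕ) .{{_ : NonZero k}} → 5 ≤ k → ∀ (ε : ℚ) .{{_ : Positive ε}} →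
    (∃ λ (s : ℕ) → HasApproximationRatio k s (+ 2 / k - ε))
    ×
    (∀ (s : ℕ) → _÷_ (+ 2 / k) ε {{pos⇒nonZero ε}} ℚ.≤ fromℕ s →
    HasApproximationRatio k s (+ 2 / k - ε)))
theorem4 = (4 , four-ratio) , λ k 5≤k ε →
  let (s , c÷ε≤s) = ≤-fromℕ (_÷_ (+ 2 / k) ε {{pos⇒nonZero ε}})
  in (s , many-ratio k 5≤k ε s c÷ε≤s) , many-ratio k 5≤k ε
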